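{- Let $k$ and $n$ be positive integers. For $m\in\{0,1,2\}$, we have $$(-1)^{k}\left(C_m(n)-\sum_{j=1-k}^{k}(-1)^j\,u_m\big(n-j(3j-1)/2\big)\right)=\sum_{j=0}^{n}C_m(j)\,M_k(n-j).$$
   Context: Unimodal compositions. A composition of a positive integer $n$ is a sequence $(\lambda_1,\ldots,\lambda_r)$ of positive integers (parts) with sum $n$. It is unimodal if there exists $t\in\{1,\ldots,r\}$ with $\lambda_1\leqslant\cdots\leqslant\lambda_t$ and $\lambda_t\geqslant\cdots\geqslant\lambda_r$. For $n\geqslant 1$, $u_0(n)$ is the number of unimodal compositions of $n$, and $u_0(0)=0$. For $m\geqslant1$ and $n\geqslant0$, $u_m(n)$ is the number of unimodal compositions of $n+m$ in which the maximal part appears exactly $m$ times; in particular $u_m(0)=1$. Convention: $u_m(n)=0$ for $n<0$. Crank. For a partition $\lambda=(\lambda_1\geqslant\lambda_2\geqslant\cdots)$, let $\omega(\lambda)$ be the number of parts of $\lambda$ equal to $1$, and $\mu(\lambda)$ the number of parts of $\lambda$ larger than $\omega(\lambda)$. The crank is $c(\lambda)=\lambda_1$ (the largest part) if $\omega(\lambda)=0$, and $c(\lambda)=\mu(\lambda)-\omega(\lambda)$ if $\omega(\lambda)>0$. The empty partition of $0$ has crank $0$. For a non-negative integer $n\neq1$: $C_0(n)$ is the number of partitions $\lambda$ of $n$ with $c(\lambda)>0$; $C_1(n)$ is the number of partitions $\lambda$ of $n$ with $c(\lambda)\geqslant0$; $C_2(n)$ is the number of partitions $\lambda$ of $n$ with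 $c(\lambda)=0$. Thus $C_0(0)=0$ and $C_1(0)=C_2(0)=1$. Moreover, by definition, $C_0(1)=1$, $C_1(1)=0$, $C_2(1)=-1$. $M_k(n)$ (for $k\geqslant 1$, $n\geqslant 0$) is the number of partitions of $n$ in which $k$ is the least positive integer that is not a part and there are more parts $>k$ than there are parts $<k$ (parts counted with multiplicity); in particular $M_k(0)=0$. -}

module Defs where

open import Data.Fin.Base using (Fin; toℕ)
open import Data.Fin.Patterns using (0F; 1F; 2F)
open import Data.Fin.Properties using (any?)
open import Data.Integer.Base as ℤ using (ℤ; +_; -[1+_]; 0ℤ; 1ℤ; -1ℤ; ∣_∣; _⊖_)
import Data.Integer.DivMod as ℤ
import Data.Integer.Properties as ℤ
open import Data.List.Base
  using (List; []; _∷_; length; filter; map; foldr; upTo; take; drop; concatMap)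
open import Data.List.Extrema.Nat using (max)
open import Data.List.Membership.Propositional using (_∈_; _∉_)
open import Data.List.Membership.Propositional.Properties using (∈-concatMap⁺; ∈-concatMap⁻)
open import Data.List.Relation.Binary.Disjoint.Propositional using (Disjoint)
open import Data.List.Relation.Unary.All as All using (All; []; _∷_)
import Data.List.Relation.Unary.All.Properties as All
open import Data.List.Relation.Unary.AllPairs using (AllPairs; []; _∷_)
open import Data.List.Relation.Unary.Any as Any using (Any; here; there)
open import Data.List.Relation.Unary.Linked using (Linked; linked?)
open import Data.List.Relation.Unary.Unique.Propositional using (Unique)
import Data.List.Relation.Unary.Unique.Propositional.Properties as Unique
open import Data.Nat.Base using (ℕ; zero; suc; _+_; _∸_; _≤_; _<_; _≥_; z≤n; s≤s)
open import Data.Nat.ListAction using (sum)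
open import Data.Nat.Properties
  using (_≟_; _≤?_; _<?_; _≥?_; allUpTo?; suc-injective; 1+n≢n)
open import Data.List.Membership.DecPropositional _≟_ using (_∈?_; _∉?_)
open import Data.Product.Base using (∃-syntax; _×_; _,_; proj₁)
open import Function.Base using (_∘_)
open import Relation.Binary.PropositionalEquality using (_≡_; _≢_; refl; cong)
open import Relation.Nullary.Decidable using (_×-dec_; _→-dec_)
open import Relation.Unary using (Pred; Decidable)

count : ∀ {a p} {A : Set a} {P : Pred A p} → Decidable P → List A → ℕ
count P? xs = length (filter P? xs)

∑ℤ : List ℤ → ℤ
∑ℤ = foldr ℤ._+_ 0ℤ

-- Sum of f j over all integers a ≤ j ≤ b (zero if b < a): there are
-- max (b - a + 1) 0 terms, namely f (a + 0), f (a + 1), …, f b.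
∑[_⋯_] : ℤ → ℤ → (ℤ → ℤ) → ℤ
∑[ a ⋯ b ] f = ∑ℤ (map (λ i → f (a ℤ.+ + i)) (upTo ∣ (b ℤ.- a ℤ.+ 1ℤ) ℤ.⊔ 0ℤ ∣))

∑[0⋯_] : ℕ → (ℕ → ℤ) → ℤ
∑[0⋯ n ] f = ∑ℤ (map f (upTo (suc n)))

-- (-1)^j depends only on the parity of j, hence on ∣ j ∣.
[-1]^_ : ℤ → ℤ
[-1]^ j = -1ℤ ℤ.^ ∣ j ∣

-- j(3j-1) is always even, so the integer division is exact.
pentagonal : ℤ → ℤ
pentagonal j = (j ℤ.* (+ 3 ℤ.* j ℤ.- 1ℤ)) ℤ./ + 2

IsComposition : ℕ → List ℕ → Set
IsComposition n λs = All (1 ≤_) λs × sum λs ≡ n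

-- A composition of n + 1 comes from a unique composition of n, either by
-- prepending a part 1 or by increasing the first part by one.
extend : List ℕ → List (List ℕ)
extend []       = (1 ∷ []) ∷ []
extend (p ∷ ps) = (1 ∷ p ∷ ps) ∷ (suc p ∷ ps) ∷ []

-- Every composition of n, listed exactly once: see ∈-compositions⁻,
-- ∈-compositions⁺ and compositions-unique.
compositions : ℕ → List (List ℕ)
compositions zero    = [] ∷ []
compositions (suc n) = concatMap extend (compositions n)

∈-extend⁻ : ∀ {n} μs {λs} → IsComposition n μs → λs ∈ extend μs → IsComposition (suc n) λs
∈-extend⁻ []       (_ , eq)          (here refl)         = s≤s z≤n ∷ [] , cong suc eq
∈-extend⁻ (p ∷ ps) (1≤p ∷ 1≤ps , eq) (here refl)         = s≤s z≤n ∷ 1≤p ∷ 1≤ps , cong suc eq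
∈-extend⁻ (p ∷ ps) (1≤p ∷ 1≤ps , eq) (there (here refl)) = s≤s z≤n ∷ 1≤ps , cong suc eq

∈-compositions⁻ : ∀ n {λs} → λs ∈ compositions n → IsComposition n λs
∈-compositions⁻ zero    (here refl) = [] , refl
∈-compositions⁻ (suc n) λs∈ = go (compositions n) (∈-compositions⁻ n) (∈-concatMap⁻ extend {xs = compositions n} λs∈)
  where
  go : ∀ {λs} xss → (∀ {μs} → μs ∈ xss → IsComposition n μs) →
       Any (λ μs → λs ∈ extend μs) xss → IsComposition (suc n) λs
  go (μs ∷ _)   h (here λs∈)  = ∈-extend⁻ μs (h (here refl)) λs∈
  go (_ ∷ xss)  h (there any) = go xss (h ∘ there) any

∈-compositions⁺ : ∀ n {λs} → IsComposition n λs → λs ∈ compositions n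
∈-compositions⁺ zero    {[]}                 _                = here refl
∈-compositions⁺ zero    {suc _ ∷ _}          (_ , ())
∈-compositions⁺ zero    {zero ∷ _}           (() ∷ _ , _)
∈-compositions⁺ (suc n) {[]}                 (_ , ())
∈-compositions⁺ (suc n) {zero ∷ _}           (() ∷ _ , _)
∈-compositions⁺ (suc n) {suc zero ∷ []}      (_ , eq) =
  ∈-concatMap⁺ extend {xs = compositions n} (Any.map (λ { refl → here refl })
    (∈-compositions⁺ n ([] , suc-injective eq)))
∈-compositions⁺ (suc n) {suc zero ∷ p ∷ ps}  (_ ∷ 1≤ps , eq) =
  ∈-concatMap⁺ extend {xs = compositions n} (Any.map (λ { refl → here refl })
    (∈-compositions⁺ n (1≤ps , suc-injective eq)))
∈-compositions⁺ (suc n) {suc (suc p) ∷ ps}   (_ ∷ 1≤ps , eq) =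
  ∈-concatMap⁺ extend {xs = compositions n} (Any.map (λ { refl → there (here refl) })
    (∈-compositions⁺ n (s≤s z≤n ∷ 1≤ps , suc-injective eq)))

extend-injective : ∀ {λs} μs νs → All (1 ≤_) μs → All (1 ≤_) νs →
                   λs ∈ extend μs → λs ∈ extend νs → μs ≡ νs
extend-injective []       []       _         _         _                   _                   = refl
extend-injective []       (q ∷ _)  _         _         (here refl)         (here ())
extend-injective []       (q ∷ _)  _         (() ∷ _)  (here refl)         (there (here refl))
extend-injective (p ∷ _)  []       _         _         (here ())           (here refl)
extend-injective (p ∷ _)  []       (() ∷ _)  _         (there (here refl)) (here refl)
extend-injective (p ∷ _)  (q ∷ _)  _         _         (here refl)         (here refl)         = refl
extend-injective (p ∷ _)  (q ∷ _)  _         (() ∷ _)  (here refl)         (there (here refl))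
extend-injective (p ∷ _)  (q ∷ _)  (() ∷ _)  _         (there (here refl)) (here refl)
extend-injective (p ∷ _)  (q ∷ _)  _         _         (there (here refl)) (there (here refl)) = refl

compositions-unique : ∀ n → Unique (compositions n)
compositions-unique zero    = [] ∷ []
compositions-unique (suc n) = Unique.concat⁺
  (All.map⁺ (All.universal extend-unique (compositions n)))
  (disjoint (All.tabulate (proj₁ ∘ ∈-compositions⁻ n)) (compositions-unique n))
  where
  extend-unique : ∀ μs → Unique (extend μs)
  extend-unique []       = [] ∷ []
  extend-unique (_ ∷ _)  = ((λ eq → 1+n≢n (cong length eq)) ∷ []) ∷ [] ∷ []

  disjoint : ∀ {xss} → All (All (1 ≤_)) xss → Unique xss → AllPairs Disjoint (map extend xss)
  disjoint []                    []           = []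
  disjoint {μs ∷ _} (1≤μs ∷ 1≤xss) (μs∉ ∷ uniq) =
    All.map⁺ (All.zipWith separate (μs∉ , 1≤xss)) ∷ disjoint 1≤xss uniq
    where
    separate : ∀ {νs} → μs ≢ νs × All (1 ≤_) νs → Disjoint (extend μs) (extend νs)
    separate {νs} (μs≢νs , 1≤νs) (∈₁ , ∈₂) = μs≢νs (extend-injective μs νs 1≤μs 1≤νs ∈₁ ∈₂)

-- Equal to 0 on the empty list, which gives the empty partition crank 0.
maxPart : List ℕ → ℕ
maxPart = max 0

multiplicity : ℕ → List ℕ → ℕ
multiplicity p = count (_≟ p)

-- The 0-based index t stands for the (t + 1)-st part, which belongs to both
-- monotone stretches. The empty list has no such t, so it is not unimodal.
Unimodal : List ℕ → Set
Unimodal λs = ∃[ t ] Linked _≤_ (take (suc (toℕ t)) λs) × Linked _≥_ (drop (toℕ {length λs} t) λs)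

unimodal? : Decidable Unimodal
unimodal? λs = any? (λ t → linked? _≤?_ (take (suc (toℕ t)) λs) ×-dec linked? _≥?_ (drop (toℕ t) λs))

-- The case m = n = 0 gives 0, since the empty list is not unimodal.
u : ℕ → ℤ → ℕ
u _       -[1+ _ ] = 0
u zero    (+ n)    = count unimodal? (compositions n)
u (suc m) (+ n)    =
  count (λ λs → unimodal? λs ×-dec multiplicity (maxPart λs) λs ≟ suc m) (compositions (n + suc m))

partitions : ℕ → List (List ℕ)
partitions n = filter (linked? _≥?_) (compositions n)

crank : List ℕ → ℤ
crank λs with multiplicity 1 λs
... | zero      = + maxPart λs
... | ω@(suc _) = count (ω <?_) λs ⊖ ω

-- The values at 1 are conventions and not counts.
C : Fin 3 → ℕ → ℤ
C 0F 1 = 1ℤ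
C 1F 1 = 0ℤ
C 2F 1 = -1ℤ
C 0F n = + count (λ λs → 0ℤ ℤ.<? crank λs) (partitions n)
C 1F n = + count (λ λs → 0ℤ ℤ.≤? crank λs) (partitions n)
C 2F n = + count (λ λs → crank λs ℤ.≟ 0ℤ) (partitions n)

LeastMissing : ℕ → List ℕ → Set
LeastMissing k λs = k ∉ λs × (∀ {i} → i < k → 1 ≤ i → i ∈ λs)

leastMissing? : ∀ k → Decidable (LeastMissing k)
leastMissing? k λs = k ∉? λs ×-dec allUpTo? (λ i → 1 ≤? i →-dec i ∈? λs) k

-- Only meaningful for k ≥ 1.
M : ℕ → ℕ → ℕ
M k n = count
  (λ λs → leastMissing? k λs ×-dec count (_<? k) λs <? count (k <?_) λs)
  (partitions n)

{-# OPTIONS --safe #-}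
module Submission where

-- Write H t = 1/((1-x)⋯(1-x^t)), P for the generating function of partitions, and
-- Uₘ, Cₘ for those of u and C. Then Uₘ = P Cₘ, and the truncated pentagonal series
-- Θ k satisfies P (Θ k) = 1 - (-1)^k Mₖ (Andrews and Merca); the theorem compares
-- coefficients in Θ k Uₘ = P (Θ k) Cₘ.
--
-- Cutting unimodal compositions at their first maximal part gives Uₘ = Σ x^(tm) (H t)²
-- for m ≥ 1 and U₀ = Σ x^(t+1) (H t) (H (t+1)). Sorting partitions by their number w of
-- ones gives C₁ = (1-x) Σ_{w≤b} x^(w+b+wb) (H w) (H b), where b is the number of parts > w,
-- and C₂ is the part w = b of this sum. Durfee rectangles turn U₂ into P C₂; the cases
-- m = 0, 1 follow from U₁ - U₀ = U₂, U₁ + U₀ = P², C₁ - C₀ = C₂ and 2 C₁ = P + C₂.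
--
-- The formula for P (Θ k) follows by induction on k from
-- Mₖ + Mₖ₊₁ = P x^(k(3k+1)/2) (1 - x^(2k+1)), where a partition counted by Mₖ is split
-- into its parts > k, and its parts < k, which a Gaussian binomial enumerates.

open import Defs
open import Data.Fin.Base using (Fin; toℕ)
open import Data.Integer.Base using (ℤ; +_; 1ℤ; _+_; _-_; _*_)
open import Data.Nat.Base using (ℕ; _≤_; _∸_)
open import Relation.Binary.PropositionalEquality using (_≡_)

open import Algebra.Bundles using (CommutativeRing)
import Algebra.Solver.Ring as RingSolver
open import Algebra.Solver.Ring.AlmostCommutativeRing using (fromCommutativeRing; _-Raw-AlmostCommutative⟶_)
import Data.Fin.Base as Fin
open import Data.Fin.Patterns using (0F; 1F; 2F)
open import Data.Integer.Base as ℤ using (0ℤ; -1ℤ; -_; _⊖_; ∣_∣; +≤+)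
import Data.Integer.DivMod as ℤ
import Data.Integer.Properties as ℤ
import Data.Integer.Solver as ℤSolver
import Data.Integer.Tactic.RingSolver as ℤ-Ring
open import Data.List.Base as List
  using (List; []; _∷_; _++_; filter; length; take; drop; cartesianProduct; reverse; reverseAcc; applyUpTo; upTo)
open import Data.List.Extrema.Nat using (v≤max⁺; max≈v⁺; max≤v⁺)
open import Data.List.Membership.Propositional using (_∈_)
open import Data.List.Membership.Propositional.Properties
  using (∈-filter⁺; ∈-filter⁻; ∈-++⁺ˡ; ∈-++⁺ʳ; ∈-++⁻; ∈-map⁺; ∈-map⁻; ∈-cartesianProduct⁺; ∈-cartesianProduct⁻)
open import Data.List.Membership.Propositional.Properties.WithK using (unique∧set⇒bag)
open import Data.List.Properties
  using (filter-accept; filter-reject; filter-all; filter-none; length-filter; map-∘;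
    ∷-injective; ∷-injectiveʳ; reverse-injective; reverse-involutive)
open import Data.List.Relation.Binary.BagAndSetEquality using (∼bag⇒↭)
import Data.List.Relation.Binary.Permutation.Propositional as ↭
import Data.List.Relation.Binary.Permutation.Propositional.Properties as ↭ₚ
open import Data.List.Relation.Unary.All as All using (All; []; _∷_; all?)
import Data.List.Relation.Unary.All.Properties as All
open import Data.List.Relation.Unary.Any using (here; there)
open import Data.List.Relation.Unary.Linked using (Linked; linked?; []; [-]; _∷_)
open import Data.List.Relation.Unary.Unique.Propositional using (Unique; []; _∷_)
import Data.List.Relation.Unary.Unique.Propositional.Properties as Unique
open import Data.Maybe.Base using (Maybe; map)
open import Data.Nat.Base as ℕ using (zero; suc; z≤n; s≤s)
import Data.Nat.DivMod as ℕ
open import Data.Nat.ListAction using (sum)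
open import Data.Nat.ListAction.Properties using (sum-++; sum-↭)
import Data.Nat.Properties as ℕ
import Data.Nat.Tactic.RingSolver as ℕ-Ring
open import Data.List.Membership.DecPropositional ℕ._≟_ using (_∈?_)
open import Data.Product.Base using (_,_; ∃-syntax; _×_; proj₁; proj₂)
open import Data.Sum.Base using (_⊎_; inj₁; inj₂; [_,_])
open import Function.Base using (_∘_; id)
open import Function.Bundles using (mk⇔)
open import Relation.Binary.Definitions using (tri<; tri≈; tri>)
open import Relation.Binary.PropositionalEquality
  using (refl; sym; trans; cong; cong₂; subst; module ≡-Reasoning)
import Relation.Binary.Reasoning.Setoid as SetoidReasoning
open import Relation.Nullary.Decidable using (Dec; yes; no; dec⇒maybe; _×-dec_; _→-dec_)
open import Relation.Nullary.Negation using (¬_; contradiction)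
open import Relation.Unary using (Pred; Decidable)

open ↭ using (_↭_)


-- Formal power series

-- Identities between series are proved modulo x^(N+1). There P is `H N` and the infinite sums stop
-- at N, so no limit is ever taken; the theorem at `n` is the case N = n. Division by 1 - x^a is
-- replaced by uniqueness of the solution of X = A + x^a X (`unique-solution`): a closed form is
-- proved by finding the same equation for both sides. For partitions such equations come from
-- `T-peel`, which removes one largest part. The conventions at 1 are what the factor 1-x in the
-- crank series asks for. The term w = b = 0 of C₂ is 1-x. Among partitions without ones only the
-- empty one has crank 0, which accounts for the 1; the partition (1) has crank -1, so the count at
-- 1 is 0 and the value C₂(1) = -1 supplies the -x. For C₁ the count at 1 already agrees with the
-- convention 0, and C₀(1) = 1 is C₁(1) - C₂(1).

Series : Set
Series = ℕ → ℤ

infixl 6 _⊕_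
infixl 7 _⊗_
infix 8 ⊝_

-- The Cauchy product, by recursion along f = f 0 + x (`f ∘ suc`).
_⊗_ : Series → Series → Series
(f ⊗ g) zero    = f 0 * g 0
(f ⊗ g) (suc n) = f 0 * g (suc n) + ((f ∘ suc) ⊗ g) n

-- Opaque, because unifying f ⊕ g with f′ ⊕ g′ must not compare their values in ℤ.
opaque
  _⊕_ : Series → Series → Series
  (f ⊕ g) n = f n + g n

  ⊝_ : Series → Series
  (⊝ f) n = - f n

  ⊕-at : ∀ f g n → (f ⊕ g) n ≡ f n + g n
  ⊕-at f g n = refl

  ⊝-at : ∀ f n → (⊝ f) n ≡ - f n
  ⊝-at f n = refl

const : ℤ → Series
const c zero    = c
const c (suc _) = 0ℤ

x^_ : ℕ → Series
(x^ zero)          = const 1ℤ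
(x^ suc a) zero    = 0ℤ
(x^ suc a) (suc n) = (x^ a) n

infix 4 _≗_
_≗_ : Series → Series → Set
f ≗ g = ∀ n → f n ≡ g n

module ℤ-Solver = ℤSolver.+-*-Solver

+-congˡ : ∀ {a b} c → a ≡ b → c + a ≡ c + b
+-congˡ c = cong (λ z → c + z)

⊗-cong-≤ : ∀ {f f′ g g′} n → (∀ i → i ≤ n → f i ≡ f′ i) → (∀ i → i ≤ n → g i ≡ g′ i) →
           (f ⊗ g) n ≡ (f′ ⊗ g′) n
⊗-cong-≤ zero    p q = cong₂ _*_ (p 0 z≤n) (q 0 z≤n)
⊗-cong-≤ (suc n) p q = cong₂ _+_ (cong₂ _*_ (p 0 z≤n) (q (suc n) ℕ.≤-refl))
  (⊗-cong-≤ n (λ i i≤n → p (suc i) (s≤s i≤n)) (λ i i≤n → q i (ℕ.m≤n⇒m≤1+n i≤n)))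

-- Kept free of `_⊕_`: in `⊗-assoc` the tail of `f ⊗ g` unfolds to a pointwise sum of exactly this
-- form.
+-⊗-distribʳ : ∀ f g h n → ((λ i → g i + h i) ⊗ f) n ≡ (g ⊗ f) n + (h ⊗ f) n
+-⊗-distribʳ f g h zero    = ℤ.*-distribʳ-+ (f 0) (g 0) (h 0)
+-⊗-distribʳ f g h (suc n) = trans
  (+-congˡ ((g 0 + h 0) * f (suc n)) (+-⊗-distribʳ f (g ∘ suc) (h ∘ suc) n))
  (solve 5 (λ a b c u v → (a :+ b) :* c :+ (u :+ v) := a :* c :+ u :+ (b :* c :+ v)) refl
    (g 0) (h 0) (f (suc n)) (((g ∘ suc) ⊗ f) n) (((h ∘ suc) ⊗ f) n))
  where open ℤ-Solver

⊗-distribʳ : ∀ f g h → (g ⊕ h) ⊗ f ≗ g ⊗ f ⊕ h ⊗ f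
⊗-distribʳ f g h n = begin
  ((g ⊕ h) ⊗ f) n             ≡⟨ ⊗-cong-≤ n (λ i _ → ⊕-at g h i) (λ _ _ → refl) ⟩
  ((λ i → g i + h i) ⊗ f) n   ≡⟨ +-⊗-distribʳ f g h n ⟩
  (g ⊗ f) n + (h ⊗ f) n       ≡⟨ ⊕-at (g ⊗ f) (h ⊗ f) n ⟨
  (g ⊗ f ⊕ h ⊗ f) n           ∎
  where open ≡-Reasoning

⊗-sucʳ : ∀ f g n → (f ⊗ g) (suc n) ≡ f (suc n) * g 0 + (f ⊗ (g ∘ suc)) n
⊗-sucʳ f g zero    = ℤ.+-comm (f 0 * g 1) (f 1 * g 0)
⊗-sucʳ f g (suc n) = trans
  (+-congˡ (f 0 * g (suc (suc n))) (⊗-sucʳ (f ∘ suc) g n))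
  (solve 3 (λ a b c → a :+ (b :+ c) := b :+ (a :+ c)) refl
    (f 0 * g (suc (suc n))) (f (suc (suc n)) * g 0) (((f ∘ suc) ⊗ (g ∘ suc)) n))
  where open ℤ-Solver

⊗-comm : ∀ f g → f ⊗ g ≗ g ⊗ f
⊗-comm f g zero    = ℤ.*-comm (f 0) (g 0)
⊗-comm f g (suc n) = trans
  (cong₂ _+_ (ℤ.*-comm (f 0) (g (suc n))) (⊗-comm (f ∘ suc) g n))
  (sym (⊗-sucʳ g f n))

⊗-scale : ∀ c f g → (λ i → c * f i) ⊗ g ≗ λ i → c * (f ⊗ g) i
⊗-scale c f g zero    = ℤ.*-assoc c (f 0) (g 0)
⊗-scale c f g (suc n) = trans
  (+-congˡ (c * f 0 * g (suc n)) (⊗-scale c (f ∘ suc) g n))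
  (solve 4 (λ c a b d → c :* a :* b :+ c :* d := c :* (a :* b :+ d)) refl
    c (f 0) (g (suc n)) (((f ∘ suc) ⊗ g) n))
  where open ℤ-Solver

⊗-assoc : ∀ f g h → (f ⊗ g) ⊗ h ≗ f ⊗ (g ⊗ h)
⊗-assoc f g h zero    = ℤ.*-assoc (f 0) (g 0) (h 0)
⊗-assoc f g h (suc n) = begin
  f 0 * g 0 * h (suc n) + ((λ i → f 0 * g (suc i) + ((f ∘ suc) ⊗ g) i) ⊗ h) n
    ≡⟨ +-congˡ (f 0 * g 0 * h (suc n)) (+-⊗-distribʳ h (λ i → f 0 * g (suc i)) ((f ∘ suc) ⊗ g) n) ⟩
  f 0 * g 0 * h (suc n) + (((λ i → f 0 * g (suc i)) ⊗ h) n + (((f ∘ suc) ⊗ g) ⊗ h) n)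
    ≡⟨ +-congˡ (f 0 * g 0 * h (suc n))
         (cong₂ _+_ (⊗-scale (f 0) (g ∘ suc) h n) (⊗-assoc (f ∘ suc) g h n)) ⟩
  f 0 * g 0 * h (suc n) + (f 0 * ((g ∘ suc) ⊗ h) n + ((f ∘ suc) ⊗ (g ⊗ h)) n)
    ≡⟨ solve 5 (λ a b c d e → a :* b :* c :+ (a :* d :+ e) := a :* (b :* c :+ d) :+ e) refl
         (f 0) (g 0) (h (suc n)) (((g ∘ suc) ⊗ h) n) (((f ∘ suc) ⊗ (g ⊗ h)) n) ⟩
  f 0 * (g ⊗ h) (suc n) + ((f ∘ suc) ⊗ (g ⊗ h)) n ∎
  where
  open ≡-Reasoning
  open ℤ-Solver

⊗-zeroˡ : ∀ f → (λ _ → 0ℤ) ⊗ f ≗ λ _ → 0ℤ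
⊗-zeroˡ f zero    = refl
⊗-zeroˡ f (suc n) = trans (ℤ.+-identityˡ _) (⊗-zeroˡ f n)

const-⊗ : ∀ c f → const c ⊗ f ≗ λ i → c * f i
const-⊗ c f zero    = refl
const-⊗ c f (suc n) = trans (+-congˡ (c * f (suc n)) (⊗-zeroˡ f n)) (ℤ.+-identityʳ _)

x^-⊗-suc : ∀ a f n → (x^ suc a ⊗ f) (suc n) ≡ (x^ a ⊗ f) n
x^-⊗-suc a f n = ℤ.+-identityˡ _

x^-⊗-+ : ∀ a f n → (x^ a ⊗ f) (a ℕ.+ n) ≡ f n
x^-⊗-+ zero    f n = trans (const-⊗ 1ℤ f n) (ℤ.*-identityˡ (f n))
x^-⊗-+ (suc a) f n = trans (x^-⊗-suc a f (a ℕ.+ n)) (x^-⊗-+ a f n)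

x^-⊗-< : ∀ a f n → n ℕ.< a → (x^ a ⊗ f) n ≡ 0ℤ
x^-⊗-< (suc a) f zero    _         = refl
x^-⊗-< (suc a) f (suc n) (s≤s n<a) = trans (x^-⊗-suc a f n) (x^-⊗-< a f n n<a)

x^-+ : ∀ a b → x^ (a ℕ.+ b) ≗ x^ a ⊗ x^ b
x^-+ zero    b n       = sym (x^-⊗-+ 0 (x^ b) n)
x^-+ (suc a) b zero    = refl
x^-+ (suc a) b (suc n) = trans (x^-+ a b n) (sym (x^-⊗-suc a (x^ b) n))

x^-< : ∀ {a n} → n ℕ.< a → (x^ a) n ≡ 0ℤ
x^-< {suc a} {zero}  _         = refl
x^-< {suc a} {suc n} (s≤s n<a) = x^-< n<a

𝟘 𝟏 : Series
𝟘 = const 0ℤ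
𝟏 = const 1ℤ

𝟘-at : ∀ n → 𝟘 n ≡ 0ℤ
𝟘-at zero    = refl
𝟘-at (suc n) = refl

⊕-assoc : ∀ f g h → (f ⊕ g) ⊕ h ≗ f ⊕ (g ⊕ h)
⊕-assoc f g h n = begin
  ((f ⊕ g) ⊕ h) n     ≡⟨ trans (⊕-at (f ⊕ g) h n) (cong (_+ h n) (⊕-at f g n)) ⟩
  f n + g n + h n     ≡⟨ ℤ.+-assoc (f n) (g n) (h n) ⟩
  f n + (g n + h n)   ≡⟨ trans (⊕-at f (g ⊕ h) n) (+-congˡ (f n) (⊕-at g h n)) ⟨
  (f ⊕ (g ⊕ h)) n     ∎
  where open ≡-Reasoning

⊕-comm : ∀ f g → f ⊕ g ≗ g ⊕ f
⊕-comm f g n = trans (⊕-at f g n) (trans (ℤ.+-comm (f n) (g n)) (sym (⊕-at g f n)))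

⊕-identityʳ : ∀ f → f ⊕ 𝟘 ≗ f
⊕-identityʳ f n = trans (⊕-at f 𝟘 n) (trans (+-congˡ (f n) (𝟘-at n)) (ℤ.+-identityʳ (f n)))

⊝-inverseʳ : ∀ f → f ⊕ ⊝ f ≗ 𝟘
⊝-inverseʳ f n = begin
  (f ⊕ ⊝ f) n   ≡⟨ trans (⊕-at f (⊝ f) n) (+-congˡ (f n) (⊝-at f n)) ⟩
  f n + - f n   ≡⟨ ℤ.+-inverseʳ (f n) ⟩
  0ℤ            ≡⟨ 𝟘-at n ⟨
  𝟘 n           ∎
  where open ≡-Reasoning

⊗-identityˡ : ∀ f → 𝟏 ⊗ f ≗ f
⊗-identityˡ = x^-⊗-+ 0

⊗-distribˡ : ∀ f g h → f ⊗ (g ⊕ h) ≗ f ⊗ g ⊕ f ⊗ h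
⊗-distribˡ f g h n = begin
  (f ⊗ (g ⊕ h)) n         ≡⟨ ⊗-comm f (g ⊕ h) n ⟩
  ((g ⊕ h) ⊗ f) n         ≡⟨ ⊗-distribʳ f g h n ⟩
  (g ⊗ f ⊕ h ⊗ f) n       ≡⟨ ⊕-at (g ⊗ f) (h ⊗ f) n ⟩
  (g ⊗ f) n + (h ⊗ f) n   ≡⟨ cong₂ _+_ (⊗-comm g f n) (⊗-comm h f n) ⟩
  (f ⊗ g) n + (f ⊗ h) n   ≡⟨ ⊕-at (f ⊗ g) (f ⊗ h) n ⟨
  (f ⊗ g ⊕ f ⊗ h) n       ∎
  where open ≡-Reasoning

module Truncated (N : ℕ) where

  infix 4 _≈_
  -- A record, so that `f` and `g` can be read off from the type of an equation; a bare function
  -- type would only show their coefficients.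
  record _≈_ (f g : Series) : Set where
    constructor mk
    field at : ∀ {i} → i ≤ N → f i ≡ g i
  open _≈_ public

  exact : ∀ {f g} → f ≗ g → f ≈ g
  exact p = mk λ {i} _ → p i

  ⊗-cong : ∀ {f f′ g g′} → f ≈ f′ → g ≈ g′ → f ⊗ g ≈ f′ ⊗ g′
  ⊗-cong p q = mk λ {n} n≤N → ⊗-cong-≤ n
    (λ _ i≤n → at p (ℕ.≤-trans i≤n n≤N)) (λ _ i≤n → at q (ℕ.≤-trans i≤n n≤N))

  seriesRing : CommutativeRing _ _
  seriesRing = record
    { Carrier = Series ; _≈_ = _≈_ ; _+_ = _⊕_ ; _*_ = _⊗_ ; -_ = ⊝_
    ; 0# = 𝟘 ; 1# = 𝟏
    ; isCommutativeRing = record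
      { isRing = record
        { +-isAbelianGroup = record
          { isGroup = record
            { isMonoid = record
              { isSemigroup = record
                { isMagma = record
                  { isEquivalence = record
                    { refl  = mk λ _ → refl
                    ; sym   = λ p → mk λ i≤N → sym (at p i≤N)
                    ; trans = λ p q → mk λ i≤N → trans (at p i≤N) (at q i≤N)
                    }
                  ; ∙-cong = λ {f} {f′} {g} {g′} p q → mk λ {i} i≤N →
                      trans (⊕-at f g i) (trans (cong₂ _+_ (at p i≤N) (at q i≤N)) (sym (⊕-at f′ g′ i)))
                  }
                ; assoc = λ f g h → exact (⊕-assoc f g h)
                }
              ; identity = (λ f → exact λ n → trans (⊕-comm 𝟘 f n) (⊕-identityʳ f n)) , (λ f → exact (⊕-identityʳ f))
              }
            ; inverse = (λ f → exact λ n → trans (⊕-comm (⊝ f) f n) (⊝-inverseʳ f n)) , (λ f → exact (⊝-inverseʳ f))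
            ; ⁻¹-cong = λ {f} {g} p → mk λ {i} i≤N →
                trans (⊝-at f i) (trans (cong -_ (at p i≤N)) (sym (⊝-at g i)))
            }
          ; comm = λ f g → exact (⊕-comm f g)
          }
        ; *-cong = ⊗-cong
        ; *-assoc = λ f g h → exact (⊗-assoc f g h)
        ; *-identity = (λ f → exact (⊗-identityˡ f)) , (λ f → exact λ n → trans (⊗-comm f 𝟏 n) (⊗-identityˡ f n))
        ; distrib = (λ f g h → exact (⊗-distribˡ f g h)) , (λ f g h → exact (⊗-distribʳ f g h))
        }
      ; *-comm = λ f g → exact (⊗-comm f g)
      }
    }

  constMorphism : CommutativeRing.rawRing ℤ.+-*-commutativeRing
                    -Raw-AlmostCommutative⟶ fromCommutativeRing seriesRing
  constMorphism = record
    { ⟦_⟧    = const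
    ; +-homo = λ c d → exact λ { zero → sym (⊕-at (const c) (const d) 0) ; (suc n) → sym (⊕-at (const c) (const d) (suc n)) }
    ; *-homo = λ c d → exact λ { zero → refl ; (suc n) → sym (trans (const-⊗ c (const d) (suc n)) (ℤ.*-zeroʳ c)) }
    ; -‿homo = λ c → exact λ { zero → sym (⊝-at (const c) 0) ; (suc n) → sym (⊝-at (const c) (suc n)) }
    ; 0-homo = mk λ _ → refl
    ; 1-homo = mk λ _ → refl
    }

  const-≟ : ∀ c d → Maybe (const c ≈ const d)
  const-≟ c d = map (λ { refl → mk λ _ → refl }) (dec⇒maybe (c ℤ.≟ d))

  module Solver = RingSolver _ _ constMorphism const-≟

-- Weighted sums over partitions

∑ : ∀ {A : Set} → (A → ℤ) → List A → ℤ
∑ f xs = ∑ℤ (List.map f xs)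

∑-++ : ∀ {A : Set} (f : A → ℤ) xs ys → ∑ f (xs ++ ys) ≡ ∑ f xs + ∑ f ys
∑-++ f []       ys = sym (ℤ.+-identityˡ _)
∑-++ f (x ∷ xs) ys = trans (+-congˡ (f x) (∑-++ f xs ys)) (sym (ℤ.+-assoc (f x) (∑ f xs) (∑ f ys)))

∑-map : ∀ {A B : Set} (f : B → ℤ) (g : A → B) xs → ∑ f (List.map g xs) ≡ ∑ (f ∘ g) xs
∑-map f g xs = cong ∑ℤ (sym (map-∘ xs))

∑-cong : ∀ {A : Set} {f g : A → ℤ} xs → (∀ {x} → x ∈ xs → f x ≡ g x) → ∑ f xs ≡ ∑ g xs
∑-cong []       _ = refl
∑-cong (x ∷ xs) p = cong₂ _+_ (p (here refl)) (∑-cong xs (p ∘ there))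

∑-↭ : ∀ {A : Set} (f : A → ℤ) {xs ys} → xs ↭ ys → ∑ f xs ≡ ∑ f ys
∑-↭ f ↭.refl       = refl
∑-↭ f (↭.prep x p)   = +-congˡ (f x) (∑-↭ f p)
∑-↭ f (↭.swap {xs} {ys} x y p) = trans (cong (λ s → f x + (f y + s)) (∑-↭ f p))
  (solve 3 (λ a b c → a :+ (b :+ c) := b :+ (a :+ c)) refl (f x) (f y) (∑ f ys))
  where open ℤ-Solver
∑-↭ f (↭.trans p q) = trans (∑-↭ f p) (∑-↭ f q)

∑-+ : ∀ {A : Set} (f g : A → ℤ) xs → ∑ (λ x → f x + g x) xs ≡ ∑ f xs + ∑ g xs
∑-+ f g []       = refl
∑-+ f g (x ∷ xs) = trans (+-congˡ (f x + g x) (∑-+ f g xs))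
  (solve 4 (λ a b c d → a :+ b :+ (c :+ d) := a :+ c :+ (b :+ d)) refl (f x) (g x) (∑ f xs) (∑ g xs))
  where open ℤ-Solver

∑-*ˡ : ∀ {A : Set} c (f : A → ℤ) xs → ∑ (λ x → c * f x) xs ≡ c * ∑ f xs
∑-*ˡ c f []       = sym (ℤ.*-zeroʳ c)
∑-*ˡ c f (x ∷ xs) = trans (+-congˡ (c * f x) (∑-*ˡ c f xs)) (sym (ℤ.*-distribˡ-+ c (f x) (∑ f xs)))

∑-*ʳ : ∀ {A : Set} c (f : A → ℤ) xs → ∑ (λ x → f x * c) xs ≡ ∑ f xs * c
∑-*ʳ c f xs = trans (∑-cong xs (λ {x} _ → ℤ.*-comm (f x) c)) (trans (∑-*ˡ c f xs) (ℤ.*-comm c (∑ f xs)))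

∑-0 : ∀ {A : Set} (xs : List A) → ∑ (λ _ → 0ℤ) xs ≡ 0ℤ
∑-0 []       = refl
∑-0 (x ∷ xs) = trans (ℤ.+-identityˡ _) (∑-0 xs)

𝟙 : ∀ {p} {P : Set p} → Dec P → ℤ
𝟙 (yes _) = 1ℤ
𝟙 (no _)  = 0ℤ

𝟙-yes : ∀ {p} {P : Set p} (P? : Dec P) → P → 𝟙 P? ≡ 1ℤ
𝟙-yes (yes _) _ = refl
𝟙-yes (no ¬p) p = contradiction p ¬p

𝟙-no : ∀ {p} {P : Set p} (P? : Dec P) → ¬ P → 𝟙 P? ≡ 0ℤ
𝟙-no (yes p) ¬p = contradiction p ¬p
𝟙-no (no _)  _  = refl

𝟙-cong : ∀ {p q} {P : Set p} {Q : Set q} (P? : Dec P) (Q? : Dec Q) → (P → Q) → (Q → P) → 𝟙 P? ≡ 𝟙 Q?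
𝟙-cong (yes p) Q? f _ = sym (𝟙-yes Q? (f p))
𝟙-cong (no ¬p) Q? _ g = sym (𝟙-no Q? (¬p ∘ g))

𝟙-× : ∀ {p q} {P : Set p} {Q : Set q} (P? : Dec P) (Q? : Dec Q) → 𝟙 (P? ×-dec Q?) ≡ 𝟙 P? * 𝟙 Q?
𝟙-× (yes _) (yes _) = refl
𝟙-× (yes _) (no _)  = refl
𝟙-× (no _)  Q?      = refl

count-∑ : ∀ {A : Set} {p} {P : Pred A p} (P? : Decidable P) xs → + count P? xs ≡ ∑ (𝟙 ∘ P?) xs
count-∑ P? []       = refl
count-∑ P? (x ∷ xs) with P? x
... | yes _ = +-congˡ 1ℤ (count-∑ P? xs)
... | no _  = trans (count-∑ P? xs) (sym (ℤ.+-identityˡ _))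

∑-filter : ∀ {A : Set} {p} {P : Pred A p} (P? : Decidable P) (f : A → ℤ) xs →
           ∑ f (filter P? xs) ≡ ∑ (λ x → 𝟙 (P? x) * f x) xs
∑-filter P? f []       = refl
∑-filter P? f (x ∷ xs) with P? x
... | yes _ = cong₂ _+_ (sym (ℤ.*-identityˡ (f x))) (∑-filter P? f xs)
... | no _  = trans (∑-filter P? f xs) (sym (ℤ.+-identityˡ _))

-- Turns a bijection into an equality of sums: repetition-free lists with the same members are
-- permutations of each other, and `∑-↭` sums over either.
unique-↭ : ∀ {A : Set} {xs ys : List A} → Unique xs → Unique ys →
           (∀ {x} → x ∈ xs → x ∈ ys) → (∀ {x} → x ∈ ys → x ∈ xs) → xs ↭ ys
unique-↭ xs! ys! f g = ∼bag⇒↭ (unique∧set⇒bag xs! ys! (mk⇔ f g))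

-- Partitions with bounded parts

IsPartition : ℕ → ℕ → List ℕ → Set
IsPartition K n λs = IsComposition n λs × Linked ℕ._≥_ λs × All (_≤ K) λs

𝒫 : ℕ → ℕ → List (List ℕ)
𝒫 K n = filter (all? (ℕ._≤? K)) (partitions n)

∈-partitions⁻ : ∀ n {λs} → λs ∈ partitions n → IsComposition n λs × Linked ℕ._≥_ λs
∈-partitions⁻ n λs∈ with ∈-filter⁻ (linked? ℕ._≥?_) {xs = compositions n} λs∈
... | λs∈′ , l = ∈-compositions⁻ n λs∈′ , l

∈-𝒫⁻ : ∀ K n {λs} → λs ∈ 𝒫 K n → IsPartition K n λs
∈-𝒫⁻ K n λs∈ with ∈-filter⁻ (all? (ℕ._≤? K)) {xs = partitions n} λs∈
... | λs∈′ , ≤K with ∈-partitions⁻ n λs∈′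
...   | c , l = c , l , ≤K

∈-𝒫⁺ : ∀ K n {λs} → IsPartition K n λs → λs ∈ 𝒫 K n
∈-𝒫⁺ K n (c , l , ≤K) =
  ∈-filter⁺ (all? (ℕ._≤? K)) (∈-filter⁺ (linked? ℕ._≥?_) (∈-compositions⁺ n c) l) ≤K

𝒫-unique : ∀ K n → Unique (𝒫 K n)
𝒫-unique K n = Unique.filter⁺ (all? (ℕ._≤? K)) (Unique.filter⁺ (linked? ℕ._≥?_) (compositions-unique n))

opaque
  -- The weight lets one recurrence, `T-peel`, serve all restricted families of partitions: each is
  -- given by an indicator `f`.
  T : ℕ → (List ℕ → ℤ) → Series
  T K f n = ∑ f (𝒫 K n)

  T-at : ∀ K f n → T K f n ≡ ∑ f (𝒫 K n)
  T-at K f n = refl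

parts≤sum : ∀ λs → All (_≤ sum λs) λs
parts≤sum []       = []
parts≤sum (p ∷ ps) = ℕ.m≤m+n p (sum ps) ∷ All.map (λ q≤ → ℕ.≤-trans q≤ (ℕ.m≤n+m (sum ps) p)) (parts≤sum ps)

IsComposition-parts≤ : ∀ {n λs} → IsComposition n λs → All (_≤ n) λs
IsComposition-parts≤ {λs = λs} (_ , refl) = parts≤sum λs

-- Up to degree `K` the bound on the parts excludes nothing, so `T N` sees every partition that
-- matters modulo x^(N+1).
T-partitions : ∀ {K n} f → n ≤ K → ∑ f (partitions n) ≡ T K f n
T-partitions {K} {n} f n≤K = trans (cong (∑ f) (sym (filter-all (all? (ℕ._≤? K)) (All.tabulate λ λs∈ →
  All.map (λ p≤n → ℕ.≤-trans p≤n n≤K) (IsComposition-parts≤ (proj₁ (∈-partitions⁻ n λs∈))))))) (sym (T-at K f n))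

T-cong : ∀ K {f g} → (∀ λs → All (1 ≤_) λs → All (_≤ K) λs → f λs ≡ g λs) → T K f ≗ T K g
T-cong K {f} {g} p n = begin
  T K f n       ≡⟨ T-at K f n ⟩
  ∑ f (𝒫 K n)   ≡⟨ ∑-cong (𝒫 K n) (λ {λs} λs∈ → let ((1≤ , _) , _ , ≤K) = ∈-𝒫⁻ K n λs∈ in p λs 1≤ ≤K) ⟩
  ∑ g (𝒫 K n)   ≡⟨ T-at K g n ⟨
  T K g n       ∎
  where open ≡-Reasoning

T-zero : ∀ f → T 0 f ≗ const (f [])
T-zero f zero    = trans (T-at 0 f 0) (ℤ.+-identityʳ (f []))
T-zero f (suc n) = trans (T-at 0 f (suc n)) (∑-↭ f (unique-↭ (𝒫-unique 0 (suc n)) [] (λ λs∈ → contradiction (∈-𝒫⁻ 0 (suc n) λs∈) none) λ ()))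
  where
  none : ∀ {λs} → ¬ IsPartition 0 (suc n) λs
  none {[]}      ((_ , ()) , _)
  none {p ∷ _}   ((s≤s _ ∷ _ , _) , _ , () ∷ _)

𝒫-peel-< : ∀ {K n} → n ≤ K → 𝒫 (suc K) n ↭ 𝒫 K n
𝒫-peel-< {K} {n} n≤K = unique-↭ (𝒫-unique (suc K) n) (𝒫-unique K n)
  (λ λs∈ → let (c , l , _) = ∈-𝒫⁻ (suc K) n λs∈ in
     ∈-𝒫⁺ K n (c , l , All.map (λ p≤n → ℕ.≤-trans p≤n n≤K) (IsComposition-parts≤ c)))
  (λ λs∈ → let (c , l , ≤K) = ∈-𝒫⁻ K n λs∈ in ∈-𝒫⁺ (suc K) n (c , l , All.map ℕ.m≤n⇒m≤1+n ≤K))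

Linked-∷ : ∀ {p ps} → All (_≤ p) ps → Linked ℕ._≥_ ps → Linked ℕ._≥_ (p ∷ ps)
Linked-∷ {ps = []}    _         _ = [-]
Linked-∷ {ps = _ ∷ _} (q≤p ∷ _) l = q≤p ∷ l

Linked-head : ∀ {p ps} → Linked ℕ._≥_ (p ∷ ps) → All (_≤ p) ps
Linked-head [-]       = []
Linked-head (q≤p ∷ l) = q≤p ∷ All.map (λ r≤q → ℕ.≤-trans r≤q q≤p) (Linked-head l)

Linked-tail : ∀ {p ps} → Linked ℕ._≥_ (p ∷ ps) → Linked ℕ._≥_ ps
Linked-tail [-]     = []
Linked-tail (_ ∷ l) = l

𝒫-peel-≥ : ∀ K m → 𝒫 (suc K) (suc K ℕ.+ m) ↭ 𝒫 K (suc K ℕ.+ m) ++ List.map (suc K ∷_) (𝒫 (suc K) m)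
𝒫-peel-≥ K m = unique-↭ (𝒫-unique (suc K) n)
  (Unique.++⁺ (𝒫-unique K n) (Unique.map⁺ ∷-injectiveʳ (𝒫-unique (suc K) m)) disjoint)
  to [ from₁ , from₂ ]′
  where
  n = suc K ℕ.+ m

  [_,_]′ : ∀ {C : Set} {λs} → (λs ∈ 𝒫 K n → C) → (λs ∈ List.map (suc K ∷_) (𝒫 (suc K) m) → C) →
           λs ∈ 𝒫 K n ++ List.map (suc K ∷_) (𝒫 (suc K) m) → C
  [ f , g ]′ λs∈ = [ f , g ] (∈-++⁻ (𝒫 K n) λs∈)

  disjoint : ∀ {λs} → ¬ (λs ∈ 𝒫 K n × λs ∈ List.map (suc K ∷_) (𝒫 (suc K) m))
  disjoint (λs∈₁ , λs∈₂) with ∈-map⁻ (suc K ∷_) λs∈₂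
  ... | _ , _ , refl with ∈-𝒫⁻ K n λs∈₁
  ...   | _ , _ , K<K ∷ _ = ℕ.1+n≰n K<K

  to : ∀ {λs} → λs ∈ 𝒫 (suc K) n → λs ∈ 𝒫 K n ++ List.map (suc K ∷_) (𝒫 (suc K) m)
  to {λs} λs∈ with ∈-𝒫⁻ (suc K) n λs∈
  to {[]}     _ | (_ , ()) , _
  to {p ∷ ps} _ | c@(_ ∷ 1≤ps , eq) , l , p≤ ∷ ps≤ with p ℕ.≟ suc K
  ... | yes refl = ∈-++⁺ʳ (𝒫 K n) (∈-map⁺ (suc K ∷_)
          (∈-𝒫⁺ (suc K) m ((1≤ps , ℕ.+-cancelˡ-≡ (suc K) (sum ps) m eq) , Linked-tail l , ps≤)))
  ... | no p≢    = let p≤K = ℕ.≤-pred (ℕ.≤∧≢⇒< p≤ p≢) in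
          ∈-++⁺ˡ (∈-𝒫⁺ K n (c , l , p≤K ∷ All.map (λ q≤p → ℕ.≤-trans q≤p p≤K) (Linked-head l)))

  from₁ : ∀ {λs} → λs ∈ 𝒫 K n → λs ∈ 𝒫 (suc K) n
  from₁ λs∈ with ∈-𝒫⁻ K n λs∈
  ... | c , l , ≤K = ∈-𝒫⁺ (suc K) n (c , l , All.map ℕ.m≤n⇒m≤1+n ≤K)

  from₂ : ∀ {λs} → λs ∈ List.map (suc K ∷_) (𝒫 (suc K) m) → λs ∈ 𝒫 (suc K) n
  from₂ λs∈ with ∈-map⁻ (suc K ∷_) λs∈
  ... | ps , ps∈ , refl with ∈-𝒫⁻ (suc K) m ps∈
  ...   | (1≤ps , refl) , l , ps≤ =
    ∈-𝒫⁺ (suc K) n ((s≤s z≤n ∷ 1≤ps , refl) , Linked-∷ ps≤ l , ℕ.≤-refl ∷ ps≤)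

-- A partition either avoids the part `suc K` or begins with it. After one copy is removed the tail
-- may begin with it again, hence `T (suc K)` on both sides; its weight is `f` with the removed part
-- put back.
T-peel : ∀ K f → T (suc K) f ≗ T K f ⊕ x^ suc K ⊗ T (suc K) (f ∘ (suc K ∷_))
T-peel K f n = trans (go (ℕ.≤-<-connex n K)) (sym (⊕-at (T K f) (x^ suc K ⊗ T (suc K) f′) n))
  where
  open ≡-Reasoning
  f′ : List ℕ → ℤ
  f′ = f ∘ (suc K ∷_)

  go : ∀ {n} → n ≤ K ⊎ K ℕ.< n → T (suc K) f n ≡ T K f n + (x^ suc K ⊗ T (suc K) f′) n
  go {n} (inj₁ n≤K) = begin
    T (suc K) f n                                ≡⟨ T-at (suc K) f n ⟩
    ∑ f (𝒫 (suc K) n)                            ≡⟨ ∑-↭ f (𝒫-peel-< n≤K) ⟩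
    ∑ f (𝒫 K n)                                  ≡⟨ T-at K f n ⟨
    T K f n                                      ≡⟨ ℤ.+-identityʳ (T K f n) ⟨
    T K f n + 0ℤ                                 ≡⟨ +-congˡ (T K f n) (x^-⊗-< (suc K) (T (suc K) f′) n (s≤s n≤K)) ⟨
    T K f n + (x^ suc K ⊗ T (suc K) f′) n        ∎
  go {n} (inj₂ K<n) with ℕ.m≤n⇒∃[o]m+o≡n K<n
  ... | m , refl = begin
    T (suc K) f n                                             ≡⟨ T-at (suc K) f n ⟩
    ∑ f (𝒫 (suc K) n)                                         ≡⟨ ∑-↭ f (𝒫-peel-≥ K m) ⟩
    ∑ f (𝒫 K n ++ List.map (suc K ∷_) (𝒫 (suc K) m))          ≡⟨ ∑-++ f (𝒫 K n) _ ⟩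
    ∑ f (𝒫 K n) + ∑ f (List.map (suc K ∷_) (𝒫 (suc K) m))     ≡⟨ cong₂ _+_ (sym (T-at K f n)) (∑-map f (suc K ∷_) (𝒫 (suc K) m)) ⟩
    T K f n + ∑ f′ (𝒫 (suc K) m)                              ≡⟨ +-congˡ (T K f n) (T-at (suc K) f′ m) ⟨
    T K f n + T (suc K) f′ m                                  ≡⟨ +-congˡ (T K f n) (x^-⊗-+ (suc K) (T (suc K) f′) m) ⟨
    T K f n + (x^ suc K ⊗ T (suc K) f′) n                     ∎

H : ℕ → Series
H K = T K (λ _ → 1ℤ)

-- Series modulo x^(N+1)

∑< : ℕ → (ℕ → ℤ) → ℤ
∑< zero    f = 0ℤ
∑< (suc n) f = f 0 + ∑< n (f ∘ suc)

opaque
  Σ< : ℕ → (ℕ → Series) → Series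
  Σ< n F i = ∑< n λ t → F t i

  Σ<-at : ∀ n F i → Σ< n F i ≡ ∑< n λ t → F t i
  Σ<-at n F i = refl

∑<-cong : ∀ n {f g : ℕ → ℤ} → (∀ t → t ℕ.< n → f t ≡ g t) → ∑< n f ≡ ∑< n g
∑<-cong zero    p = refl
∑<-cong (suc n) p = cong₂ _+_ (p 0 (s≤s z≤n)) (∑<-cong n λ t t<n → p (suc t) (s≤s t<n))

∑<-+ : ∀ n f g → ∑< n (λ t → f t + g t) ≡ ∑< n f + ∑< n g
∑<-+ zero    f g = refl
∑<-+ (suc n) f g = trans (+-congˡ (f 0 + g 0) (∑<-+ n (f ∘ suc) (g ∘ suc)))
  (solve 4 (λ a b c d → a :+ b :+ (c :+ d) := a :+ c :+ (b :+ d)) refl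
    (f 0) (g 0) (∑< n (f ∘ suc)) (∑< n (g ∘ suc)))
  where open ℤ-Solver

∑<-0 : ∀ n → ∑< n (λ _ → 0ℤ) ≡ 0ℤ
∑<-0 zero    = refl
∑<-0 (suc n) = trans (ℤ.+-identityˡ _) (∑<-0 n)

∑<-last : ∀ n f → ∑< (suc n) f ≡ ∑< n f + f n
∑<-last zero    f = ℤ.+-comm (f 0) 0ℤ
∑<-last (suc n) f = trans (+-congˡ (f 0) (∑<-last n (f ∘ suc)))
  (sym (ℤ.+-assoc (f 0) (∑< n (f ∘ suc)) (f (suc n))))

∑<-swap : ∀ m n (f : ℕ → ℕ → ℤ) → ∑< m (λ i → ∑< n (f i)) ≡ ∑< n (λ j → ∑< m (λ i → f i j))
∑<-swap zero    n f = sym (∑<-0 n)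
∑<-swap (suc m) n f = trans (+-congˡ (∑< n (f 0)) (∑<-swap m n (f ∘ suc)))
  (sym (∑<-+ n (f 0) (λ j → ∑< m (λ i → f (suc i) j))))

∑<-δ : ∀ {a n} → a ℕ.< n → (g : ℕ → ℤ) → ∑< n (λ i → 𝟙 (a ℕ.≟ i) * g i) ≡ g a
∑<-δ {zero}  {suc n} _ g = begin
  1ℤ * g 0 + ∑< n (λ i → 𝟙 (0 ℕ.≟ suc i) * g (suc i))
    ≡⟨ cong₂ _+_ (ℤ.*-identityˡ (g 0)) (trans (∑<-cong n λ i _ → cong (_* g (suc i)) (𝟙-no (0 ℕ.≟ suc i) λ ())) (∑<-0 n)) ⟩
  g 0 + 0ℤ ≡⟨ ℤ.+-identityʳ (g 0) ⟩
  g 0 ∎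
  where open ≡-Reasoning
∑<-δ {suc a} {suc n} (s≤s a<n) g = begin
  0ℤ * g 0 + ∑< n (λ i → 𝟙 (suc a ℕ.≟ suc i) * g (suc i))
    ≡⟨ ℤ.+-identityˡ _ ⟩
  ∑< n (λ i → 𝟙 (suc a ℕ.≟ suc i) * g (suc i))
    ≡⟨ ∑<-cong n (λ i _ → cong (_* g (suc i)) (𝟙-cong (suc a ℕ.≟ suc i) (a ℕ.≟ i) ℕ.suc-injective (cong suc))) ⟩
  ∑< n (λ i → 𝟙 (a ℕ.≟ i) * g (suc i))
    ≡⟨ ∑<-δ a<n (g ∘ suc) ⟩
  g (suc a) ∎
  where open ≡-Reasoning

∑-by : ∀ {A : Set} (s : A → ℕ) m (f : A → ℤ) xs → All (λ x → s x ℕ.< m) xs →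
       ∑ f xs ≡ ∑< m λ i → ∑ (λ x → 𝟙 (s x ℕ.≟ i) * f x) xs
∑-by s m f []       []         = sym (∑<-0 m)
∑-by s m f (x ∷ xs) (s<m ∷ ss) = trans
  (cong₂ _+_ (sym (∑<-δ s<m (λ _ → f x))) (∑-by s m f xs ss))
  (sym (∑<-+ m (λ i → 𝟙 (s x ℕ.≟ i) * f x) (λ i → ∑ (λ y → 𝟙 (s y ℕ.≟ i) * f y) xs)))

module QSeries (N : ℕ) where
  open Truncated N public
  open CommutativeRing seriesRing public using (setoid)
    renaming (refl to ≈-refl; sym to ≈-sym; trans to ≈-trans; reflexive to ≈-reflexive;
      +-cong to ⊕-cong; +-congˡ to ⊕-congˡ; +-congʳ to ⊕-congʳ; *-congˡ to ⊗-congˡ; *-congʳ to ⊗-congʳ;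
      +-identityˡ to ⊕-identityˡ-≈; +-identityʳ to ⊕-identityʳ-≈; *-identityˡ to ⊗-identityˡ-≈;
      *-identityʳ to ⊗-identityʳ-≈; zeroˡ to ⊗-zeroˡ-≈; zeroʳ to ⊗-zeroʳ-≈; -‿cong to ⊝-cong;
      *-assoc to ⊗-assoc-≈; *-comm to ⊗-comm-≈; distribˡ to ⊗-distribˡ-≈)
  open Solver public using (solve; _:=_; _:+_; _:*_; :-_; _:-_; con)
  open SetoidReasoning setoid public

  opaque
    unfolding Σ< _⊕_

    Σ<-cong : ∀ n {F G} → (∀ t → t ℕ.< n → F t ≈ G t) → Σ< n F ≈ Σ< n G
    Σ<-cong n p = mk λ i≤N → ∑<-cong n λ t t<n → at (p t t<n) i≤N

    Σ<-⊕ : ∀ n F G → Σ< n (λ t → F t ⊕ G t) ≈ Σ< n F ⊕ Σ< n G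
    Σ<-⊕ n F G = mk λ {i} _ → ∑<-+ n (λ t → F t i) (λ t → G t i)

    Σ<-suc : ∀ n F → Σ< (suc n) F ≈ F 0 ⊕ Σ< n (F ∘ suc)
    Σ<-suc n F = mk λ _ → refl

    Σ<-last : ∀ n F → Σ< (suc n) F ≈ Σ< n F ⊕ F n
    Σ<-last n F = mk λ {i} _ → ∑<-last n (λ t → F t i)

    Σ<-swap : ∀ m n (F : ℕ → ℕ → Series) → Σ< m (λ i → Σ< n (F i)) ≈ Σ< n (λ j → Σ< m (λ i → F i j))
    Σ<-swap m n F = mk λ {k} _ → ∑<-swap m n (λ i j → F i j k)

    Σ<-zero : ∀ F → Σ< 0 F ≈ 𝟘
    Σ<-zero F = mk λ {i} _ → sym (𝟘-at i)

    Σ<-≈𝟘 : ∀ n {F} → (∀ t → t ℕ.< n → F t ≈ 𝟘) → Σ< n F ≈ 𝟘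
    Σ<-≈𝟘 n p = mk λ {i} i≤N → trans
      (trans (∑<-cong n λ t t<n → trans (at (p t t<n) i≤N) (𝟘-at i)) (∑<-0 n)) (sym (𝟘-at i))

  Σ<-⊗ˡ : ∀ n A F → Σ< n (λ t → A ⊗ F t) ≈ A ⊗ Σ< n F
  Σ<-⊗ˡ zero    A F = begin
    Σ< 0 (λ t → A ⊗ F t) ≈⟨ Σ<-zero (λ t → A ⊗ F t) ⟩
    𝟘                    ≈⟨ ⊗-zeroʳ-≈ A ⟨
    A ⊗ 𝟘                ≈⟨ ⊗-congˡ (Σ<-zero F) ⟨
    A ⊗ Σ< 0 F           ∎
  Σ<-⊗ˡ (suc n) A F = begin
    Σ< (suc n) (λ t → A ⊗ F t)             ≈⟨ Σ<-suc n (λ t → A ⊗ F t) ⟩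
    A ⊗ F 0 ⊕ Σ< n (λ t → A ⊗ F (suc t))   ≈⟨ ⊕-congˡ (Σ<-⊗ˡ n A (F ∘ suc)) ⟩
    A ⊗ F 0 ⊕ A ⊗ Σ< n (F ∘ suc)           ≈⟨ ⊗-distribˡ-≈ A (F 0) (Σ< n (F ∘ suc)) ⟨
    A ⊗ (F 0 ⊕ Σ< n (F ∘ suc))             ≈⟨ ⊗-congˡ (Σ<-suc n F) ⟨
    A ⊗ Σ< (suc n) F                       ∎

  Σ<-⊗ʳ : ∀ n A F → Σ< n (λ t → F t ⊗ A) ≈ Σ< n F ⊗ A
  Σ<-⊗ʳ n A F = begin
    Σ< n (λ t → F t ⊗ A) ≈⟨ Σ<-cong n (λ t _ → ⊗-comm-≈ (F t) A) ⟩
    Σ< n (λ t → A ⊗ F t) ≈⟨ Σ<-⊗ˡ n A F ⟩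
    A ⊗ Σ< n F           ≈⟨ ⊗-comm-≈ A (Σ< n F) ⟩
    Σ< n F ⊗ A           ∎

  Σ<-drop : ∀ m n F → (∀ t → m ≤ t → F t ≈ 𝟘) → Σ< (m ℕ.+ n) F ≈ Σ< m F
  Σ<-drop zero    n F p = ≈-trans (Σ<-≈𝟘 n λ t _ → p t z≤n) (≈-sym (Σ<-zero F))
  Σ<-drop (suc m) n F p = begin
    Σ< (suc m ℕ.+ n) F              ≈⟨ Σ<-suc (m ℕ.+ n) F ⟩
    F 0 ⊕ Σ< (m ℕ.+ n) (F ∘ suc)    ≈⟨ ⊕-congˡ (Σ<-drop m n (F ∘ suc) λ t m≤t → p (suc t) (s≤s m≤t)) ⟩
    F 0 ⊕ Σ< m (F ∘ suc)            ≈⟨ Σ<-suc m F ⟨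
    Σ< (suc m) F                    ∎

  x^-+-≈ : ∀ a b → x^ (a ℕ.+ b) ≈ x^ a ⊗ x^ b
  x^-+-≈ a b = exact (x^-+ a b)

  x^-≡ : ∀ {a b} → a ≡ b → x^ a ≈ x^ b
  x^-≡ refl = ≈-refl

  x^-≈𝟘 : ∀ {a} → N ℕ.< a → x^ a ≈ 𝟘
  x^-≈𝟘 N<a = mk λ {i} i≤N → trans (x^-< (ℕ.≤-<-trans i≤N N<a)) (sym (𝟘-at i))

  x^-⊗-≈𝟘 : ∀ {a} f → N ℕ.< a → x^ a ⊗ f ≈ 𝟘
  x^-⊗-≈𝟘 f N<a = ≈-trans (⊗-congʳ (x^-≈𝟘 N<a)) (⊗-zeroˡ-≈ f)

  -- The coefficients below a + 1 vanish, and the one at a + 1 + j equals the one at j: a strong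
  -- induction, in which the first argument of `go` bounds the index.
  ≈𝟘-contraction : ∀ a {D} → D ≈ x^ suc a ⊗ D → D ≈ 𝟘
  ≈𝟘-contraction a {D} p = mk λ {i} i≤N → trans (go (suc i) i (ℕ.n<1+n i) i≤N) (sym (𝟘-at i))
    where
    go : ∀ m i → i ℕ.< m → i ≤ N → D i ≡ 0ℤ
    go (suc m) i (s≤s i≤m) i≤N with ℕ.≤-<-connex i a
    ... | inj₁ i≤a = trans (at p i≤N) (x^-⊗-< (suc a) D i (s≤s i≤a))
    ... | inj₂ a<i with ℕ.m≤n⇒∃[o]m+o≡n a<i
    ...   | j , refl = trans (at p i≤N) (trans (x^-⊗-+ (suc a) D j)
              (go m j (ℕ.<-≤-trans (ℕ.m<n+m j {suc a} (s≤s z≤n)) i≤m)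
                      (ℕ.≤-trans (ℕ.m≤n+m j (suc a)) i≤N)))

  ⊕⊝-≈𝟘 : ∀ {X Y} → X ⊕ ⊝ Y ≈ 𝟘 → X ≈ Y
  ⊕⊝-≈𝟘 {X} {Y} p = begin
    X              ≈⟨ solve 2 (λ x y → x := (x :- y) :+ y) ≈-refl X Y ⟩
    X ⊕ ⊝ Y ⊕ Y    ≈⟨ ⊕-congʳ p ⟩
    𝟘 ⊕ Y          ≈⟨ ⊕-identityˡ-≈ Y ⟩
    Y              ∎

  -- Stands in for division by 1 - x^(a+1): both `X` and `Y` are A/(1 - x^(a+1)).
  unique-solution : ∀ a {A X Y} → X ≈ A ⊕ x^ suc a ⊗ X → Y ≈ A ⊕ x^ suc a ⊗ Y → X ≈ Y
  unique-solution a {A} {X} {Y} p q = ⊕⊝-≈𝟘 (≈𝟘-contraction a (begin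
    X ⊕ ⊝ Y                                              ≈⟨ ⊕-cong p (⊝-cong q) ⟩
    (A ⊕ x^ suc a ⊗ X) ⊕ ⊝ (A ⊕ x^ suc a ⊗ Y)            ≈⟨ solve 4 (λ a b x y → (a :+ b :* x) :- (a :+ b :* y) := b :* (x :- y)) ≈-refl A (x^ suc a) X Y ⟩
    x^ suc a ⊗ (X ⊕ ⊝ Y)                                 ∎))

  T-𝟘 : ∀ K {f} → (∀ λs → All (1 ≤_) λs → All (_≤ K) λs → f λs ≡ 0ℤ) → T K f ≈ 𝟘
  T-𝟘 K {f} p = exact λ n → trans (T-cong K p n) (trans (T-at K (λ _ → 0ℤ) n) (trans (∑-0 (𝒫 K n)) (sym (𝟘-at n))))

  T-cong-≈ : ∀ K {f g} → (∀ λs → All (1 ≤_) λs → All (_≤ K) λs → f λs ≡ g λs) → T K f ≈ T K g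
  T-cong-≈ K p = exact (T-cong K p)

  T-peel-≈ : ∀ K f → T (suc K) f ≈ T K f ⊕ x^ suc K ⊗ T (suc K) (f ∘ (suc K ∷_))
  T-peel-≈ K f = exact (T-peel K f)

  H-zero : H 0 ≈ 𝟏
  H-zero = exact (T-zero (λ _ → 1ℤ))

  H-suc : ∀ t → H (suc t) ≈ H t ⊕ x^ suc t ⊗ H (suc t)
  H-suc t = T-peel-≈ t (λ _ → 1ℤ)

  P : Series
  P = H N

  T-stable : ∀ f d → T (N ℕ.+ d) f ≈ T N f
  T-stable f d = mk λ {i} i≤N → trans (sym (T-partitions f (ℕ.≤-trans i≤N (ℕ.m≤m+n N d)))) (T-partitions f i≤N)

  -- With S the shift φ ↦ φ ∘ suc, E k is the operator ∏_{i>k} (1 - x^i S)⁻¹, by Euler's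
  -- expansion of this product in powers of S.
  E : ℕ → (ℕ → Series) → ℕ → Series
  E k φ b = Σ< (suc N) λ c → x^ (suc k ℕ.* c) ⊗ H c ⊗ φ (b ℕ.+ c)

  E-cong : ∀ k {φ ψ} → (∀ b → φ b ≈ ψ b) → ∀ b → E k φ b ≈ E k ψ b
  E-cong k p b = Σ<-cong (suc N) λ c _ → ⊗-congˡ (p (b ℕ.+ c))

  -- This is (1 - x^(k+1) S) `E k` = `E (suc k)`: among parts > k, either k + 1 does not occur or
  -- one copy of it is removed, which shifts the argument of `ψ`. On the summands it amounts to
  -- `H-suc` at the summation index.
  E-down : ∀ k ψ b → E k ψ b ≈ E (suc k) ψ b ⊕ x^ suc k ⊗ E k ψ (suc b)
  E-down k ψ b = begin
    Σ< (suc N) G                                          ≈⟨ Σ<-suc N G ⟩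
    G 0 ⊕ Σ< N (G ∘ suc)                                  ≈⟨ ⊕-cong G₀ (Σ<-cong N λ c _ → G-suc c) ⟩
    G′ 0 ⊕ Σ< N (λ c → G′ (suc c) ⊕ x^ suc k ⊗ K c)       ≈⟨ ⊕-congˡ (Σ<-⊕ N (G′ ∘ suc) (λ c → x^ suc k ⊗ K c)) ⟩
    G′ 0 ⊕ (Σ< N (G′ ∘ suc) ⊕ Σ< N (λ c → x^ suc k ⊗ K c)) ≈⟨ ⊕-congˡ (⊕-congˡ (⊕-identityʳ-≈ _)) ⟨
    -- The reindexed sum stops one term short of `E k ψ (suc b)`; the missing term has degree above
    -- N and may be added.
    G′ 0 ⊕ (Σ< N (G′ ∘ suc) ⊕ (Σ< N (λ c → x^ suc k ⊗ K c) ⊕ 𝟘)) ≈⟨ ⊕-congˡ (⊕-congˡ (⊕-congˡ K-last)) ⟨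
    G′ 0 ⊕ (Σ< N (G′ ∘ suc) ⊕ (Σ< N (λ c → x^ suc k ⊗ K c) ⊕ x^ suc k ⊗ K N)) ≈⟨ ⊕-congˡ (⊕-congˡ (Σ<-last N (λ c → x^ suc k ⊗ K c))) ⟨
    G′ 0 ⊕ (Σ< N (G′ ∘ suc) ⊕ Σ< (suc N) (λ c → x^ suc k ⊗ K c)) ≈⟨ ⊕-congˡ (⊕-congˡ (Σ<-⊗ˡ (suc N) (x^ suc k) K)) ⟩
    G′ 0 ⊕ (Σ< N (G′ ∘ suc) ⊕ x^ suc k ⊗ Σ< (suc N) K)    ≈⟨ solve 3 (λ a b c → a :+ (b :+ c) := a :+ b :+ c) ≈-refl (G′ 0) (Σ< N (G′ ∘ suc)) (x^ suc k ⊗ Σ< (suc N) K) ⟩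
    G′ 0 ⊕ Σ< N (G′ ∘ suc) ⊕ x^ suc k ⊗ Σ< (suc N) K      ≈⟨ ⊕-congʳ (Σ<-suc N G′) ⟨
    Σ< (suc N) G′ ⊕ x^ suc k ⊗ Σ< (suc N) K               ∎
    where
    G G′ K : ℕ → Series
    G c  = x^ (suc k ℕ.* c) ⊗ H c ⊗ ψ (b ℕ.+ c)
    G′ c = x^ (suc (suc k) ℕ.* c) ⊗ H c ⊗ ψ (b ℕ.+ c)
    K c  = x^ (suc k ℕ.* c) ⊗ H c ⊗ ψ (suc b ℕ.+ c)

    G₀ : G 0 ≈ G′ 0
    G₀ = ⊗-congʳ (⊗-congʳ (x^-≡ (trans (ℕ.*-zeroʳ (suc k)) (sym (ℕ.*-zeroʳ (suc (suc k)))))))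

    K-last : x^ suc k ⊗ K N ≈ 𝟘
    K-last = begin
      x^ suc k ⊗ (x^ (suc k ℕ.* N) ⊗ H N ⊗ ψ (suc b ℕ.+ N))
        ≈⟨ solve 4 (λ a b c d → a :* (b :* c :* d) := (a :* b) :* (c :* d)) ≈-refl (x^ suc k) (x^ (suc k ℕ.* N)) (H N) (ψ (suc b ℕ.+ N)) ⟩
      (x^ suc k ⊗ x^ (suc k ℕ.* N)) ⊗ (H N ⊗ ψ (suc b ℕ.+ N))
        ≈⟨ ⊗-congʳ (x^-+-≈ (suc k) (suc k ℕ.* N)) ⟨
      x^ (suc k ℕ.+ suc k ℕ.* N) ⊗ (H N ⊗ ψ (suc b ℕ.+ N))
        ≈⟨ x^-⊗-≈𝟘 _ (s≤s (ℕ.≤-trans (ℕ.m≤m+n N (k ℕ.* N)) (ℕ.m≤n+m (suc k ℕ.* N) k))) ⟩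
      𝟘 ∎

    G-suc : ∀ c → G (suc c) ≈ G′ (suc c) ⊕ x^ suc k ⊗ K c
    G-suc c = begin
      x^ (suc k ℕ.* suc c) ⊗ H (suc c) ⊗ ψ (b ℕ.+ suc c)
        ≈⟨ ⊗-congʳ (⊗-congˡ (H-suc c)) ⟩
      x^ (suc k ℕ.* suc c) ⊗ (H c ⊕ x^ suc c ⊗ H (suc c)) ⊗ ψ (b ℕ.+ suc c)
        ≈⟨ solve 5 (λ a h y g p → a :* (h :+ y :* g) :* p := (y :* a) :* g :* p :+ a :* h :* p) ≈-refl
             (x^ (suc k ℕ.* suc c)) (H c) (x^ suc c) (H (suc c)) (ψ (b ℕ.+ suc c)) ⟩
      (x^ suc c ⊗ x^ (suc k ℕ.* suc c)) ⊗ H (suc c) ⊗ ψ (b ℕ.+ suc c) ⊕ x^ (suc k ℕ.* suc c) ⊗ H c ⊗ ψ (b ℕ.+ suc c)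
        ≈⟨ ⊕-cong (⊗-congʳ (⊗-congʳ (≈-sym (x^-+-≈ (suc c) (suc k ℕ.* suc c)))))
             (⊗-cong (⊗-congʳ (≈-trans (x^-≡ (ℕ.*-suc (suc k) c)) (x^-+-≈ (suc k) (suc k ℕ.* c))))
                     (≈-reflexive (cong ψ (ℕ.+-suc b c)))) ⟩
      G′ (suc c) ⊕ (x^ suc k ⊗ x^ (suc k ℕ.* c)) ⊗ H c ⊗ ψ (suc b ℕ.+ c)
        ≈⟨ ⊕-congˡ (solve 4 (λ a b c d → (a :* b) :* c :* d := a :* (b :* c :* d)) ≈-refl (x^ suc k) (x^ (suc k ℕ.* c)) (H c) (ψ (suc b ℕ.+ c))) ⟩
      G′ (suc c) ⊕ x^ suc k ⊗ K c ∎

  -- The hypothesis reads φ = (1 - x^(k+1) S) ψ, and the operator absorbs this factor: `E-down` for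
  -- `ψ`, with the common term cancelled.
  E-step : ∀ k {φ ψ} → (∀ b → ψ b ≈ φ b ⊕ x^ suc k ⊗ ψ (suc b)) → ∀ b → E k φ b ≈ E (suc k) ψ b
  E-step k {φ} {ψ} p b = begin
    E k φ b
      ≈⟨ solve 2 (λ x y → x := (x :+ y) :- y) ≈-refl (E k φ b) (x^ suc k ⊗ E k ψ (suc b)) ⟩
    E k φ b ⊕ x^ suc k ⊗ E k ψ (suc b) ⊕ ⊝ (x^ suc k ⊗ E k ψ (suc b))
      ≈⟨ ⊕-congʳ (begin
        E k φ b ⊕ x^ suc k ⊗ E k ψ (suc b)                                      ≈⟨ ⊕-congˡ (Σ<-⊗ˡ (suc N) (x^ suc k) _) ⟨
        E k φ b ⊕ Σ< (suc N) (λ c → x^ suc k ⊗ (x^ (suc k ℕ.* c) ⊗ H c ⊗ ψ (suc b ℕ.+ c))) ≈⟨ Σ<-⊕ (suc N) _ _ ⟨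
        Σ< (suc N) (λ c → x^ (suc k ℕ.* c) ⊗ H c ⊗ φ (b ℕ.+ c) ⊕ x^ suc k ⊗ (x^ (suc k ℕ.* c) ⊗ H c ⊗ ψ (suc b ℕ.+ c)))
          ≈⟨ Σ<-cong (suc N) (λ c _ → ≈-trans
               (solve 5 (λ a h f y g → a :* h :* f :+ y :* (a :* h :* g) := a :* h :* (f :+ y :* g)) ≈-refl
                 (x^ (suc k ℕ.* c)) (H c) (φ (b ℕ.+ c)) (x^ suc k) (ψ (suc b ℕ.+ c)))
               (⊗-congˡ (≈-sym (p (b ℕ.+ c))))) ⟩
        E k ψ b                                                                  ≈⟨ E-down k ψ b ⟩
        E (suc k) ψ b ⊕ x^ suc k ⊗ E k ψ (suc b) ∎) ⟩
    E (suc k) ψ b ⊕ x^ suc k ⊗ E k ψ (suc b) ⊕ ⊝ (x^ suc k ⊗ E k ψ (suc b))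
      ≈⟨ solve 2 (λ x y → (x :+ y) :- y := x) ≈-refl (E (suc k) ψ b) (x^ suc k ⊗ E k ψ (suc b)) ⟩
    E (suc k) ψ b ∎

  -- Each summand with c > 0 has degree at least k + 1 > N.
  E-limit : ∀ {k} → N ≤ k → ∀ φ b → E k φ b ≈ φ b
  E-limit {k} N≤k φ b = begin
    E k φ b                                                    ≈⟨ Σ<-suc N G ⟩
    G 0 ⊕ Σ< N (G ∘ suc)                                       ≈⟨ ⊕-cong G₀ (Σ<-≈𝟘 N λ c _ → G-suc c) ⟩
    φ b ⊕ 𝟘                                                    ≈⟨ ⊕-identityʳ-≈ (φ b) ⟩
    φ b                                                        ∎
    where
    G : ℕ → Series
    G c = x^ (suc k ℕ.* c) ⊗ H c ⊗ φ (b ℕ.+ c)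

    G₀ : G 0 ≈ φ b
    G₀ = begin
      x^ (suc k ℕ.* 0) ⊗ H 0 ⊗ φ (b ℕ.+ 0) ≈⟨ ⊗-cong (⊗-cong (x^-≡ (ℕ.*-zeroʳ (suc k))) H-zero) (≈-reflexive (cong φ (ℕ.+-identityʳ b))) ⟩
      𝟏 ⊗ 𝟏 ⊗ φ b                           ≈⟨ solve 1 (λ f → con 1ℤ :* con 1ℤ :* f := f) ≈-refl (φ b) ⟩
      φ b                                   ∎

    G-suc : ∀ c → G (suc c) ≈ 𝟘
    G-suc c = begin
      x^ (suc k ℕ.* suc c) ⊗ H (suc c) ⊗ φ (b ℕ.+ suc c) ≈⟨ ⊗-congʳ (x^-⊗-≈𝟘 (H (suc c)) (ℕ.≤-trans (s≤s N≤k) (ℕ.m≤m*n (suc k) (suc c)))) ⟩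
      𝟘 ⊗ φ (b ℕ.+ suc c)                                 ≈⟨ ⊗-zeroˡ-≈ _ ⟩
      𝟘                                                   ∎

  -- The factors for i = k + 1, ..., k + N are absorbed one at a time until the operator is the
  -- identity. In the applications `φ d` is a generating function with parts bounded by k + d.
  E-tower : ∀ k (φ : ℕ → ℕ → Series) →
            (∀ d b → φ (suc d) b ≈ φ d b ⊕ x^ suc (k ℕ.+ d) ⊗ φ (suc d) (suc b)) →
            ∀ b → E k (φ 0) b ≈ φ N b
  E-tower k φ p b = begin
    E k (φ 0) b          ≈⟨ ≈-reflexive (cong (λ j → E j (φ 0) b) (ℕ.+-identityʳ k)) ⟨
    E (k ℕ.+ 0) (φ 0) b  ≈⟨ climb N ⟩
    E (k ℕ.+ N) (φ N) b  ≈⟨ E-limit (ℕ.m≤n+m N k) (φ N) b ⟩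
    φ N b                ∎
    where
    climb : ∀ d → E (k ℕ.+ 0) (φ 0) b ≈ E (k ℕ.+ d) (φ d) b
    climb zero    = ≈-refl
    climb (suc d) = ≈-trans (climb d) (≈-trans (E-step (k ℕ.+ d) (p d) b)
      (≈-reflexive (cong (λ j → E j (φ (suc d)) b) (sym (ℕ.+-suc k d)))))

  -- The hypothesis says that F b λs depends only on the parts ≤ k of λs and on
  -- b plus the number of parts > k.
  T-large-parts : ∀ k (F : ℕ → List ℕ → ℤ) → (∀ {p} b λs → k ℕ.< p → F b (p ∷ λs) ≡ F (suc b) λs) →
                  T N (F 0) ≈ E k (λ b → T k (F b)) 0
  T-large-parts k F p = begin
    T N (F 0)                        ≈⟨ T-stable (F 0) k ⟨
    T (N ℕ.+ k) (F 0)                ≈⟨ ≈-reflexive (cong (λ K → T K (F 0)) (ℕ.+-comm N k)) ⟩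
    T (k ℕ.+ N) (F 0)                ≈⟨ E-tower k (λ d b → T (k ℕ.+ d) (F b)) step 0 ⟨
    E k (λ b → T (k ℕ.+ 0) (F b)) 0  ≈⟨ E-cong k (λ b → ≈-reflexive (cong (λ K → T K (F b)) (ℕ.+-identityʳ k))) 0 ⟩
    E k (λ b → T k (F b)) 0          ∎
    where
    step : ∀ d b → T (k ℕ.+ suc d) (F b) ≈ T (k ℕ.+ d) (F b) ⊕ x^ suc (k ℕ.+ d) ⊗ T (k ℕ.+ suc d) (F (suc b))
    step d b rewrite ℕ.+-suc k d = ≈-trans (T-peel-≈ (k ℕ.+ d) (F b))
      (⊕-congˡ (⊗-congˡ (T-cong-≈ (suc (k ℕ.+ d)) λ λs _ _ → p b λs (s≤s (ℕ.m≤m+n k d)))))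

  -- A partition consists of parts ≤ k, enumerated by `H k`, and of some number c of parts > k,
  -- enumerated by x^((k+1)c) `H c`.
  euler : ∀ k b → E k (λ _ → H k) b ≈ P
  euler k b = begin
    E k (λ _ → H k) b               ≈⟨ E-cong k (λ _ → ≈-reflexive (cong H (ℕ.+-identityʳ k))) b ⟨
    E k (λ _ → H (k ℕ.+ 0)) b       ≈⟨ E-tower k (λ d _ → H (k ℕ.+ d)) step b ⟩
    H (k ℕ.+ N)                     ≈⟨ ≈-reflexive (cong H (ℕ.+-comm k N)) ⟩
    H (N ℕ.+ k)                     ≈⟨ T-stable (λ _ → 1ℤ) k ⟩
    P                               ∎
    where
    step : ∀ d (b : ℕ) → H (k ℕ.+ suc d) ≈ H (k ℕ.+ d) ⊕ x^ suc (k ℕ.+ d) ⊗ H (k ℕ.+ suc d)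
    step d _ rewrite ℕ.+-suc k d = H-suc (k ℕ.+ d)

-- Durfee rectangles and Gaussian binomials

-- An antidiagonal sum, over i + j = t. Summed over `t` these become double sums (`Σ<-Δ`).
Δ : ℕ → (ℕ → ℕ → Series) → Series
Δ zero    F = F 0 0
Δ (suc t) F = F 0 (suc t) ⊕ Δ t (F ∘ suc)

tri : ℕ → ℕ
tri zero    = 0
tri (suc k) = tri k ℕ.+ suc k

-- B j c enumerates the partitions with set of parts {1, …, j} and fewer than c parts.
B : ℕ → ℕ → Series
B zero    zero    = 𝟘
B zero    (suc c) = 𝟏
B (suc j) zero    = 𝟘
B (suc j) (suc c) = x^ suc j ⊗ (B j c ⊕ B (suc j) c)

gaussian : ℕ → ℕ → Series
gaussian c       zero    = 𝟏
gaussian zero    (suc j) = 𝟘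
gaussian (suc c) (suc j) = gaussian c j ⊕ x^ suc j ⊗ gaussian c (suc j)

sgn : ℕ → Series
sgn k = const (-1ℤ ℤ.^ k)

-- The sum of (-1)^j x^(j(3j-1)/2) over 1-k ≤ j ≤ k. The terms of index -k and
-- k + 1 have exponents k(3k+1)/2 = k² + tri k and k² + tri k + (2k+1).
Θ : ℕ → Series
Θ zero    = 𝟘
Θ (suc k) = Θ k ⊕ sgn k ⊗ (x^ (k ℕ.* k ℕ.+ tri k) ⊗ (𝟏 ⊕ ⊝ x^ (k ℕ.+ suc k)))

module Identities (N : ℕ) where
  open QSeries N public

  V : Series
  V = 𝟏 ⊕ ⊝ x^ 1

  Δ-cong : ∀ t {F G} → (∀ i j → i ℕ.+ j ≡ t → F i j ≈ G i j) → Δ t F ≈ Δ t G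
  Δ-cong zero    p = p 0 0 refl
  Δ-cong (suc t) p = ⊕-cong (p 0 (suc t) refl) (Δ-cong t λ i j eq → p (suc i) j (cong suc eq))

  Δ-⊕ : ∀ t F G → Δ t (λ i j → F i j ⊕ G i j) ≈ Δ t F ⊕ Δ t G
  Δ-⊕ zero    F G = ≈-refl
  Δ-⊕ (suc t) F G = ≈-trans (⊕-congˡ (Δ-⊕ t (F ∘ suc) (G ∘ suc)))
    (solve 4 (λ a b c d → (a :+ b) :+ (c :+ d) := (a :+ c) :+ (b :+ d)) ≈-refl
      (F 0 (suc t)) (G 0 (suc t)) (Δ t (F ∘ suc)) (Δ t (G ∘ suc)))

  Δ-⊗ˡ : ∀ t A F → Δ t (λ i j → A ⊗ F i j) ≈ A ⊗ Δ t F
  Δ-⊗ˡ zero    A F = ≈-refl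
  Δ-⊗ˡ (suc t) A F = ≈-trans (⊕-congˡ (Δ-⊗ˡ t A (F ∘ suc))) (≈-sym (⊗-distribˡ-≈ A (F 0 (suc t)) (Δ t (F ∘ suc))))

  Δ-last : ∀ t F → Δ (suc t) F ≈ Δ t (λ i j → F i (suc j)) ⊕ F (suc t) 0
  Δ-last zero    F = ≈-refl
  Δ-last (suc t) F = ≈-trans (⊕-congˡ (Δ-last t (F ∘ suc)))
    (solve 3 (λ a b c → a :+ (b :+ c) := (a :+ b) :+ c) ≈-refl
      (F 0 (suc (suc t))) (Δ t (λ i j → F (suc i) (suc j))) (F (suc (suc t)) 0))

  Σ<-Δ : ∀ n F → Σ< n (λ t → Δ t F) ≈ Σ< n (λ i → Σ< (n ∸ i) (F i))
  Σ<-Δ zero    F = ≈-trans (Σ<-zero _) (≈-sym (Σ<-zero _))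
  Σ<-Δ (suc n) F = begin
    Σ< (suc n) (λ t → Δ t F)                                       ≈⟨ Σ<-suc n (λ t → Δ t F) ⟩
    F 0 0 ⊕ Σ< n (λ t → F 0 (suc t) ⊕ Δ t (F ∘ suc))               ≈⟨ ⊕-congˡ (Σ<-⊕ n (F 0 ∘ suc) (λ t → Δ t (F ∘ suc))) ⟩
    F 0 0 ⊕ (Σ< n (F 0 ∘ suc) ⊕ Σ< n (λ t → Δ t (F ∘ suc)))        ≈⟨ ⊕-congˡ (⊕-congˡ (Σ<-Δ n (F ∘ suc))) ⟩
    F 0 0 ⊕ (Σ< n (F 0 ∘ suc) ⊕ R)                                 ≈⟨ solve 3 (λ a b c → a :+ (b :+ c) := (a :+ b) :+ c) ≈-refl (F 0 0) (Σ< n (F 0 ∘ suc)) R ⟩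
    F 0 0 ⊕ Σ< n (F 0 ∘ suc) ⊕ R                                   ≈⟨ ⊕-congʳ (Σ<-suc n (F 0)) ⟨
    Σ< (suc n) (F 0) ⊕ R                                           ≈⟨ Σ<-suc n (λ i → Σ< (suc n ∸ i) (F i)) ⟨
    Σ< (suc n) (λ i → Σ< (suc n ∸ i) (F i))                        ∎
    where
    R : Series
    R = Σ< n (λ i → Σ< (n ∸ i) (F (suc i)))

  -- `H (t - 1)`. The value 𝟘 at 0 keeps `H-⁻` valid there, where x^0 = 1, and makes the boundary
  -- terms in `Δ-H⊗H` vanish.
  H⁻ : ℕ → Series
  H⁻ zero    = 𝟘
  H⁻ (suc t) = H t

  H-⁻ : ∀ t → H t ≈ H⁻ t ⊕ x^ t ⊗ H t
  H-⁻ zero    = solve 1 (λ h → h := con 0ℤ :+ con 1ℤ :* h) ≈-refl (H 0)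
  H-⁻ (suc t) = H-suc t

  -- This is 1 - x^(i+j) = (1 - x^i) + x^i (1 - x^j), multiplied by `H i ⊗ H j`; a factor 1 - x^i
  -- turns `H i` into `H⁻ i`.
  H⊗H : ∀ i j → H i ⊗ H j ≈ H⁻ i ⊗ H j ⊕ x^ i ⊗ (H i ⊗ H⁻ j) ⊕ x^ (i ℕ.+ j) ⊗ (H i ⊗ H j)
  H⊗H i j = begin
    H i ⊗ H j
      ≈⟨ ⊗-congʳ (H-⁻ i) ⟩
    (H⁻ i ⊕ x^ i ⊗ H i) ⊗ H j
      ≈⟨ solve 4 (λ a b c d → (a :+ b :* c) :* d := a :* d :+ b :* (c :* d)) ≈-refl (H⁻ i) (x^ i) (H i) (H j) ⟩
    H⁻ i ⊗ H j ⊕ x^ i ⊗ (H i ⊗ H j)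
      ≈⟨ ⊕-congˡ (⊗-congˡ (⊗-congˡ (H-⁻ j))) ⟩
    H⁻ i ⊗ H j ⊕ x^ i ⊗ (H i ⊗ (H⁻ j ⊕ x^ j ⊗ H j))
      ≈⟨ solve 6 (λ a b c d e f → a :+ b :* (c :* (d :+ e :* f)) := (a :+ b :* (c :* d)) :+ (b :* e) :* (c :* f)) ≈-refl
           (H⁻ i ⊗ H j) (x^ i) (H i) (H⁻ j) (x^ j) (H j) ⟩
    H⁻ i ⊗ H j ⊕ x^ i ⊗ (H i ⊗ H⁻ j) ⊕ (x^ i ⊗ x^ j) ⊗ (H i ⊗ H j)
      ≈⟨ ⊕-congˡ (⊗-congʳ (x^-+-≈ i j)) ⟨
    H⁻ i ⊗ H j ⊕ x^ i ⊗ (H i ⊗ H⁻ j) ⊕ x^ (i ℕ.+ j) ⊗ (H i ⊗ H j) ∎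

  -- On an antidiagonal x^(i+j) is constant and leaves the sum. The other two terms of `H⊗H` vanish
  -- at one end each, so after reindexing they are sums over the previous antidiagonal, and only the
  -- weight `g` has changed.
  Δ-H⊗H : ∀ t (g : ℕ → Series) →
          Δ (suc t) (λ i j → g i ⊗ (H i ⊗ H j)) ≈
          Δ t (λ i j → (g (suc i) ⊕ x^ i ⊗ g i) ⊗ (H i ⊗ H j)) ⊕ x^ suc t ⊗ Δ (suc t) (λ i j → g i ⊗ (H i ⊗ H j))
  Δ-H⊗H t g = begin
    Δ (suc t) F
      ≈⟨ Δ-cong (suc t) (λ i j eq → begin
           g i ⊗ (H i ⊗ H j)
             ≈⟨ ⊗-congˡ (H⊗H i j) ⟩
           g i ⊗ (H⁻ i ⊗ H j ⊕ x^ i ⊗ (H i ⊗ H⁻ j) ⊕ x^ (i ℕ.+ j) ⊗ (H i ⊗ H j))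
             ≈⟨ solve 6 (λ g a b c d e → g :* (a :+ b :* c :+ d :* e) := (g :* a :+ (b :* g) :* c) :+ d :* (g :* e)) ≈-refl
                  (g i) (H⁻ i ⊗ H j) (x^ i) (H i ⊗ H⁻ j) (x^ (i ℕ.+ j)) (H i ⊗ H j) ⟩
           F₁ i j ⊕ F₂ i j ⊕ x^ (i ℕ.+ j) ⊗ F i j
             ≈⟨ ⊕-congˡ (⊗-congʳ (x^-≡ eq)) ⟩
           F₁ i j ⊕ F₂ i j ⊕ x^ suc t ⊗ F i j ∎) ⟩
    Δ (suc t) (λ i j → F₁ i j ⊕ F₂ i j ⊕ x^ suc t ⊗ F i j)
      ≈⟨ Δ-⊕ (suc t) (λ i j → F₁ i j ⊕ F₂ i j) (λ i j → x^ suc t ⊗ F i j) ⟩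
    Δ (suc t) (λ i j → F₁ i j ⊕ F₂ i j) ⊕ Δ (suc t) (λ i j → x^ suc t ⊗ F i j)
      ≈⟨ ⊕-cong (Δ-⊕ (suc t) F₁ F₂) (Δ-⊗ˡ (suc t) (x^ suc t) F) ⟩
    Δ (suc t) F₁ ⊕ Δ (suc t) F₂ ⊕ x^ suc t ⊗ Δ (suc t) F
      ≈⟨ ⊕-congʳ (⊕-cong shift₁ shift₂) ⟩
    Δ t (F₁ ∘ suc) ⊕ Δ t (λ i j → F₂ i (suc j)) ⊕ x^ suc t ⊗ Δ (suc t) F
      ≈⟨ ⊕-congʳ (Δ-⊕ t (F₁ ∘ suc) (λ i j → F₂ i (suc j))) ⟨
    Δ t (λ i j → F₁ (suc i) j ⊕ F₂ i (suc j)) ⊕ x^ suc t ⊗ Δ (suc t) F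
      ≈⟨ ⊕-congʳ (Δ-cong t λ i j _ → solve 4 (λ a b c d → a :* d :+ (b :* c) :* d := (a :+ b :* c) :* d) ≈-refl
           (g (suc i)) (x^ i) (g i) (H i ⊗ H j)) ⟩
    Δ t (λ i j → (g (suc i) ⊕ x^ i ⊗ g i) ⊗ (H i ⊗ H j)) ⊕ x^ suc t ⊗ Δ (suc t) F ∎
    where
    F F₁ F₂ : ℕ → ℕ → Series
    F i j  = g i ⊗ (H i ⊗ H j)
    F₁ i j = g i ⊗ (H⁻ i ⊗ H j)
    F₂ i j = (x^ i ⊗ g i) ⊗ (H i ⊗ H⁻ j)

    shift₁ : Δ (suc t) F₁ ≈ Δ t (F₁ ∘ suc)
    shift₁ = begin
      g 0 ⊗ (𝟘 ⊗ H (suc t)) ⊕ Δ t (F₁ ∘ suc)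
        ≈⟨ solve 3 (λ a b c → a :* (con 0ℤ :* b) :+ c := c) ≈-refl (g 0) (H (suc t)) (Δ t (F₁ ∘ suc)) ⟩
      Δ t (F₁ ∘ suc) ∎

    shift₂ : Δ (suc t) F₂ ≈ Δ t (λ i j → F₂ i (suc j))
    shift₂ = begin
      Δ (suc t) F₂
        ≈⟨ Δ-last t F₂ ⟩
      Δ t (λ i j → F₂ i (suc j)) ⊕ (x^ suc t ⊗ g (suc t)) ⊗ (H (suc t) ⊗ 𝟘)
        ≈⟨ solve 3 (λ a b c → c :+ a :* (b :* con 0ℤ) := c) ≈-refl (x^ suc t ⊗ g (suc t)) (H (suc t)) (Δ t (λ i j → F₂ i (suc j))) ⟩
      Δ t (λ i j → F₂ i (suc j)) ∎

  -- Sorting the pairs of partitions counted on the right by the side of a Durfee rectangle.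
  durfee : ∀ t a → Δ t (λ i j → (x^ (i ℕ.* (i ℕ.+ a)) ⊗ H (i ℕ.+ a)) ⊗ (H i ⊗ H j)) ≈ H t ⊗ H (t ℕ.+ a)
  durfee zero    a = begin
    (𝟏 ⊗ H a) ⊗ (H 0 ⊗ H 0)  ≈⟨ ⊗-congˡ (⊗-cong H-zero ≈-refl) ⟩
    (𝟏 ⊗ H a) ⊗ (𝟏 ⊗ H 0)    ≈⟨ solve 2 (λ h k → (con 1ℤ :* h) :* (con 1ℤ :* k) := k :* h) ≈-refl (H a) (H 0) ⟩
    H 0 ⊗ H a                 ∎
  -- The induction is on `t` for all `a` at once: passing from `g i` to `g (suc i) ⊕ x^ i ⊗ g i`
  -- replaces `a` by `suc a` (`step`).
  durfee (suc t) a = unique-solution t (Δ-H⊗H t g) (begin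
    H (suc t) ⊗ H (suc t ℕ.+ a)
      ≈⟨ ⊗-congʳ (H-suc t) ⟩
    (H t ⊕ x^ suc t ⊗ H (suc t)) ⊗ H (suc t ℕ.+ a)
      ≈⟨ solve 4 (λ a b c d → (a :+ b :* c) :* d := a :* d :+ b :* (c :* d)) ≈-refl (H t) (x^ suc t) (H (suc t)) (H (suc t ℕ.+ a)) ⟩
    H t ⊗ H (suc t ℕ.+ a) ⊕ x^ suc t ⊗ (H (suc t) ⊗ H (suc t ℕ.+ a))
      ≈⟨ ⊕-congʳ (begin
           H t ⊗ H (suc t ℕ.+ a)  ≈⟨ ⊗-congˡ (≈-reflexive (cong H (ℕ.+-suc t a))) ⟨
           H t ⊗ H (t ℕ.+ suc a)  ≈⟨ durfee t (suc a) ⟨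
           Δ t (λ i j → (x^ (i ℕ.* (i ℕ.+ suc a)) ⊗ H (i ℕ.+ suc a)) ⊗ (H i ⊗ H j))
             ≈⟨ Δ-cong t (λ i j _ → ⊗-congʳ (≈-sym (step i))) ⟩
           Δ t (λ i j → (g (suc i) ⊕ x^ i ⊗ g i) ⊗ (H i ⊗ H j)) ∎) ⟩
    Δ t (λ i j → (g (suc i) ⊕ x^ i ⊗ g i) ⊗ (H i ⊗ H j)) ⊕ x^ suc t ⊗ (H (suc t) ⊗ H (suc t ℕ.+ a)) ∎)
    where
    g : ℕ → Series
    g i = x^ (i ℕ.* (i ℕ.+ a)) ⊗ H (i ℕ.+ a)

    exponent₁ : ∀ i a → suc i ℕ.* (suc i ℕ.+ a) ≡ i ℕ.* (i ℕ.+ suc a) ℕ.+ suc (i ℕ.+ a)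
    exponent₁ = ℕ-Ring.solve-∀

    exponent₂ : ∀ i → i ℕ.+ i ℕ.* (i ℕ.+ a) ≡ i ℕ.* (i ℕ.+ suc a)
    exponent₂ i = sym (trans (cong (i ℕ.*_) (ℕ.+-suc i a)) (ℕ.*-suc i (i ℕ.+ a)))

    step : ∀ i → g (suc i) ⊕ x^ i ⊗ g i ≈ x^ (i ℕ.* (i ℕ.+ suc a)) ⊗ H (i ℕ.+ suc a)
    step i = begin
      x^ (suc i ℕ.* (suc i ℕ.+ a)) ⊗ H (suc i ℕ.+ a) ⊕ x^ i ⊗ (x^ (i ℕ.* (i ℕ.+ a)) ⊗ H (i ℕ.+ a))
        ≈⟨ ⊕-cong (⊗-congʳ (≈-trans (x^-≡ (exponent₁ i a)) (x^-+-≈ e (suc (i ℕ.+ a)))))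
             (≈-trans (≈-sym (⊗-assoc-≈ _ _ _)) (⊗-congʳ (≈-trans (≈-sym (x^-+-≈ i _)) (x^-≡ (exponent₂ i))))) ⟩
      (x^ e ⊗ x^ suc (i ℕ.+ a)) ⊗ H (suc i ℕ.+ a) ⊕ x^ e ⊗ H (i ℕ.+ a)
        ≈⟨ solve 4 (λ a b c d → (a :* b) :* c :+ a :* d := a :* (d :+ b :* c)) ≈-refl (x^ e) (x^ suc (i ℕ.+ a)) (H (suc i ℕ.+ a)) (H (i ℕ.+ a)) ⟩
      x^ e ⊗ (H (i ℕ.+ a) ⊕ x^ suc (i ℕ.+ a) ⊗ H (suc i ℕ.+ a))
        ≈⟨ ⊗-congˡ (H-suc (i ℕ.+ a)) ⟨
      x^ e ⊗ H (suc i ℕ.+ a)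
        ≈⟨ ⊗-congˡ (≈-reflexive (cong H (ℕ.+-suc i a))) ⟨
      x^ e ⊗ H (i ℕ.+ suc a) ∎
      where
      e : ℕ
      e = i ℕ.* (i ℕ.+ suc a)

  -- Identities between the unimodal and the crank series

  E-⊗ʳ : ∀ k φ A b → E k (λ c → φ c ⊗ A) b ≈ E k φ b ⊗ A
  E-⊗ʳ k φ A b = ≈-trans (Σ<-cong (suc N) λ c _ → ≈-sym (⊗-assoc-≈ _ _ _)) (Σ<-⊗ʳ (suc N) A _)

  V⊗H₁ : V ⊗ H 1 ≈ 𝟏
  V⊗H₁ = begin
    (𝟏 ⊕ ⊝ x^ 1) ⊗ H 1                        ≈⟨ solve 2 (λ x h → (con 1ℤ :- x) :* h := h :- x :* h) ≈-refl (x^ 1) (H 1) ⟩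
    H 1 ⊕ ⊝ (x^ 1 ⊗ H 1)                      ≈⟨ ⊕-congʳ (H-suc 0) ⟩
    H 0 ⊕ x^ 1 ⊗ H 1 ⊕ ⊝ (x^ 1 ⊗ H 1)         ≈⟨ solve 2 (λ h y → (h :+ y) :- y := h) ≈-refl (H 0) (x^ 1 ⊗ H 1) ⟩
    H 0                                        ≈⟨ H-zero ⟩
    𝟏                                          ∎

  -- Only parts ≥ 2 occur, so the factor 1/(1-x) of P is missing. Inserting `V ⊗ H 1`, which is 1,
  -- supplies the `H 1` that `euler` expects.
  E₁ : ∀ b → E 1 (λ _ → 𝟏) b ≈ V ⊗ P
  E₁ b = begin
    E 1 (λ _ → 𝟏) b                     ≈⟨ ⊗-identityʳ-≈ _ ⟨
    E 1 (λ _ → 𝟏) b ⊗ 𝟏                 ≈⟨ ⊗-congˡ V⊗H₁ ⟨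
    E 1 (λ _ → 𝟏) b ⊗ (V ⊗ H 1)         ≈⟨ solve 3 (λ e v h → e :* (v :* h) := v :* (e :* h)) ≈-refl (E 1 (λ _ → 𝟏) b) V (H 1) ⟩
    V ⊗ (E 1 (λ _ → 𝟏) b ⊗ H 1)         ≈⟨ ⊗-congˡ (E-⊗ʳ 1 (λ _ → 𝟏) (H 1) b) ⟨
    V ⊗ E 1 (λ _ → 𝟏 ⊗ H 1) b           ≈⟨ ⊗-congˡ (E-cong 1 (λ _ → ⊗-identityˡ-≈ (H 1)) b) ⟩
    V ⊗ E 1 (λ _ → H 1) b               ≈⟨ ⊗-congˡ (euler 1 b) ⟩
    V ⊗ P                               ∎

  -- The maximal part is t + 1. For m ≥ 1 its m copies weigh (t+1) m, of which the shift by m in `u`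
  -- leaves t m. For m = 0 the first copy is cut out, and `H (suc t)` enumerates the parts after it.
  Uˢ : ℕ → Series
  Uˢ zero      = Σ< (suc N) λ t → x^ suc t ⊗ (H t ⊗ H (suc t))
  Uˢ m@(suc _) = Σ< (suc N) λ t → x^ (t ℕ.* m) ⊗ (H t ⊗ H t)

  -- For w ≥ 1, `V ⊗ G w b` enumerates the partitions with w ones and b parts > w: `V ⊗ H w` gives
  -- the parts from 2 to w, and x^((w+1)b) `H b` the larger ones. For w = 0 the sum over all b gives
  -- V P, the partitions without ones.
  G : ℕ → ℕ → Series
  G w b = (x^ w ⊗ H w) ⊗ (x^ (suc w ℕ.* b) ⊗ H b)

  C₂ˢ : Series
  C₂ˢ = V ⊗ Σ< (suc N) λ w → G w w

  -- `durfee` with a = 0 expands (H t)² over i + j = t, and x^(2t) = x^(2i) x^(2j). Hence the double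
  -- sum factors: the terms x^(i²+2i) (H i)² are `G i i`, and the terms x^(2j) `H j` add up to
  -- `E 1`, which is V P.
  U₂≈P⊗C₂ : Uˢ 2 ≈ P ⊗ C₂ˢ
  U₂≈P⊗C₂ = begin
    Σ< (suc N) (λ t → x^ (t ℕ.* 2) ⊗ (H t ⊗ H t))
      ≈⟨ Σ<-cong (suc N) (λ t _ → begin
           x^ (t ℕ.* 2) ⊗ (H t ⊗ H t)   ≈⟨ ⊗-congˡ (≈-trans (⊗-congˡ (≈-reflexive (cong H (sym (ℕ.+-identityʳ t))))) (≈-sym (durfee t 0))) ⟩
           x^ (t ℕ.* 2) ⊗ Δ t F         ≈⟨ Δ-⊗ˡ t (x^ (t ℕ.* 2)) F ⟨
           Δ t (λ i j → x^ (t ℕ.* 2) ⊗ F i j) ≈⟨ Δ-cong t (λ i j eq → ⊗-congʳ (x^-≡ (cong (ℕ._* 2) (sym eq)))) ⟩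
           Δ t F₂ ∎) ⟩
    Σ< (suc N) (λ t → Δ t F₂)
      ≈⟨ Σ<-Δ (suc N) F₂ ⟩
    Σ< (suc N) (λ i → Σ< (suc N ∸ i) (F₂ i))
      -- The triangle is completed to a square; the added terms have i + j > N, hence degree above
      -- N.
      ≈⟨ Σ<-cong (suc N) (λ i i≤N → complete i (ℕ.<⇒≤ i≤N)) ⟩
    Σ< (suc N) (λ i → Σ< (suc N) (F₂ i))
      ≈⟨ Σ<-cong (suc N) (λ i _ → begin
           Σ< (suc N) (F₂ i)                                                       ≈⟨ Σ<-cong (suc N) (λ j _ → regroup i j) ⟩
           Σ< (suc N) (λ j → G i i ⊗ (x^ (2 ℕ.* j) ⊗ H j ⊗ 𝟏))                    ≈⟨ Σ<-⊗ˡ (suc N) (G i i) _ ⟩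
           G i i ⊗ E 1 (λ _ → 𝟏) 0                                                 ∎) ⟩
    Σ< (suc N) (λ i → G i i ⊗ E 1 (λ _ → 𝟏) 0)
      ≈⟨ Σ<-⊗ʳ (suc N) (E 1 (λ _ → 𝟏) 0) (λ i → G i i) ⟩
    Σ< (suc N) (λ i → G i i) ⊗ E 1 (λ _ → 𝟏) 0
      ≈⟨ ⊗-congˡ (E₁ 0) ⟩
    Σ< (suc N) (λ i → G i i) ⊗ (V ⊗ P)
      ≈⟨ solve 3 (λ a b c → a :* (b :* c) := c :* (b :* a)) ≈-refl (Σ< (suc N) (λ i → G i i)) V P ⟩
    P ⊗ C₂ˢ ∎
    where
    F F₂ : ℕ → ℕ → Series
    F i j  = (x^ (i ℕ.* (i ℕ.+ 0)) ⊗ H (i ℕ.+ 0)) ⊗ (H i ⊗ H j)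
    F₂ i j = x^ ((i ℕ.+ j) ℕ.* 2) ⊗ F i j

    complete : ∀ i → i ≤ suc N → Σ< (suc N ∸ i) (F₂ i) ≈ Σ< (suc N) (F₂ i)
    complete i i≤N = begin
      Σ< (suc N ∸ i) (F₂ i)           ≈⟨ Σ<-drop (suc N ∸ i) i (F₂ i) (λ j j≥ → x^-⊗-≈𝟘 (F i j) (bound j j≥)) ⟨
      Σ< (suc N ∸ i ℕ.+ i) (F₂ i)     ≈⟨ ≈-reflexive (cong (λ n → Σ< n (F₂ i)) (ℕ.m∸n+n≡m i≤N)) ⟩
      Σ< (suc N) (F₂ i)               ∎
      where
      bound : ∀ j → suc N ∸ i ≤ j → suc N ≤ (i ℕ.+ j) ℕ.* 2
      bound j j≥ = ℕ.≤-trans (ℕ.≤-trans (ℕ.m≤n+m∸n (suc N) i) (ℕ.+-monoʳ-≤ i j≥)) (ℕ.m≤m*n (i ℕ.+ j) 2)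

    exponent : ∀ i j → (i ℕ.+ j) ℕ.* 2 ℕ.+ i ℕ.* (i ℕ.+ 0) ≡ i ℕ.+ suc i ℕ.* i ℕ.+ 2 ℕ.* j
    exponent = ℕ-Ring.solve-∀

    regroup : ∀ i j → F₂ i j ≈ G i i ⊗ (x^ (2 ℕ.* j) ⊗ H j ⊗ 𝟏)
    regroup i j = begin
      x^ ((i ℕ.+ j) ℕ.* 2) ⊗ ((x^ (i ℕ.* (i ℕ.+ 0)) ⊗ H (i ℕ.+ 0)) ⊗ (H i ⊗ H j))
        ≈⟨ ⊗-congˡ (⊗-congʳ (⊗-congˡ (≈-reflexive (cong H (ℕ.+-identityʳ i))))) ⟩
      x^ ((i ℕ.+ j) ℕ.* 2) ⊗ ((x^ (i ℕ.* (i ℕ.+ 0)) ⊗ H i) ⊗ (H i ⊗ H j))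
        ≈⟨ solve 4 (λ a b h k → a :* ((b :* h) :* (h :* k)) := (a :* b) :* (h :* (h :* k))) ≈-refl
             (x^ ((i ℕ.+ j) ℕ.* 2)) (x^ (i ℕ.* (i ℕ.+ 0))) (H i) (H j) ⟩
      (x^ ((i ℕ.+ j) ℕ.* 2) ⊗ x^ (i ℕ.* (i ℕ.+ 0))) ⊗ (H i ⊗ (H i ⊗ H j))
        ≈⟨ ⊗-congʳ (≈-trans (≈-sym (x^-+-≈ ((i ℕ.+ j) ℕ.* 2) (i ℕ.* (i ℕ.+ 0)))) (≈-trans (x^-≡ (exponent i j))
             (≈-trans (x^-+-≈ (i ℕ.+ suc i ℕ.* i) (2 ℕ.* j)) (⊗-congʳ (x^-+-≈ i (suc i ℕ.* i)))))) ⟩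
      ((x^ i ⊗ x^ (suc i ℕ.* i)) ⊗ x^ (2 ℕ.* j)) ⊗ (H i ⊗ (H i ⊗ H j))
        ≈⟨ solve 5 (λ a b c h k → ((a :* b) :* c) :* (h :* (h :* k)) := ((a :* h) :* (b :* h)) :* (c :* k :* con 1ℤ)) ≈-refl
             (x^ i) (x^ (suc i ℕ.* i)) (x^ (2 ℕ.* j)) (H i) (H j) ⟩
      G i i ⊗ (x^ (2 ℕ.* j) ⊗ H j ⊗ 𝟏) ∎

  H-≈P : H (suc N) ≈ P
  H-≈P = ≈-trans (≈-reflexive (cong H (ℕ.+-comm 1 N))) (T-stable (λ _ → 1ℤ) 1)

  H-pred : ∀ t → H t ≈ H (suc t) ⊕ ⊝ (x^ suc t ⊗ H (suc t))
  H-pred t = begin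
    H t                                                            ≈⟨ solve 2 (λ h y → h := (h :+ y) :- y) ≈-refl (H t) (x^ suc t ⊗ H (suc t)) ⟩
    (H t ⊕ x^ suc t ⊗ H (suc t)) ⊕ ⊝ (x^ suc t ⊗ H (suc t))        ≈⟨ ⊕-congʳ (H-suc t) ⟨
    H (suc t) ⊕ ⊝ (x^ suc t ⊗ H (suc t))                           ∎

  Σ<-telescope : ∀ n (D : ℕ → Series) → Σ< n (λ t → D (suc t) ⊕ ⊝ D t) ≈ D n ⊕ ⊝ D 0
  Σ<-telescope zero    D = ≈-trans (Σ<-zero _) (solve 1 (λ d → con 0ℤ := d :- d) ≈-refl (D 0))
  Σ<-telescope (suc n) D = begin
    Σ< (suc n) (λ t → D (suc t) ⊕ ⊝ D t)          ≈⟨ Σ<-last n _ ⟩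
    Σ< n (λ t → D (suc t) ⊕ ⊝ D t) ⊕ (D (suc n) ⊕ ⊝ D n) ≈⟨ ⊕-congʳ (Σ<-telescope n D) ⟩
    (D n ⊕ ⊝ D 0) ⊕ (D (suc n) ⊕ ⊝ D n)            ≈⟨ solve 3 (λ a b c → (a :- b) :+ (c :- a) := c :- b) ≈-refl (D n) (D 0) (D (suc n)) ⟩
    D (suc n) ⊕ ⊝ D 0                              ∎

  -- With t = 0 split off, the summands line up with those of `Uˢ 0`; the summand added at the far
  -- end has degree above N.
  Uˢ-shift : ∀ m → Uˢ (suc m) ≈ 𝟏 ⊕ Σ< (suc N) λ t → x^ (suc t ℕ.* suc m) ⊗ (H (suc t) ⊗ H (suc t))
  Uˢ-shift m = begin
    Uˢ (suc m)                                 ≈⟨ Σ<-suc N F ⟩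
    F 0 ⊕ Σ< N (F ∘ suc)                       ≈⟨ ⊕-cong (≈-trans (⊗-congˡ (⊗-cong H-zero H-zero)) (solve 0 (con 1ℤ :* (con 1ℤ :* con 1ℤ) := con 1ℤ) ≈-refl)) (≈-sym (⊕-identityʳ-≈ _)) ⟩
    𝟏 ⊕ (Σ< N (F ∘ suc) ⊕ 𝟘)                   ≈⟨ ⊕-congˡ (⊕-congˡ (x^-⊗-≈𝟘 _ (ℕ.m≤m*n (suc N) (suc m)))) ⟨
    𝟏 ⊕ (Σ< N (F ∘ suc) ⊕ F (suc N))           ≈⟨ ⊕-congˡ (Σ<-last N (F ∘ suc)) ⟨
    𝟏 ⊕ Σ< (suc N) (F ∘ suc)                   ∎
    where
    F : ℕ → Series
    F t = x^ (t ℕ.* suc m) ⊗ (H t ⊗ H t)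

  -- Let X = x^(t+1) and Y = `H (suc t)`, so that `H t` = (1 - X) Y. The summands at t add up to X
  -- Y² + X (1 - X) Y² = Y² - (H t)², and the sum telescopes from (H 0)² = 1 to P².
  U₁⊕U₀≈P⊗P : Uˢ 1 ⊕ Uˢ 0 ≈ P ⊗ P
  U₁⊕U₀≈P⊗P = begin
    Uˢ 1 ⊕ Uˢ 0
      ≈⟨ ⊕-congʳ (Uˢ-shift 0) ⟩
    𝟏 ⊕ Σ< (suc N) (λ t → x^ (suc t ℕ.* 1) ⊗ (H (suc t) ⊗ H (suc t))) ⊕ Uˢ 0
      ≈⟨ ≈-trans (solve 3 (λ a b c → (a :+ b) :+ c := a :+ (b :+ c)) ≈-refl 𝟏 _ (Uˢ 0)) (⊕-congˡ (≈-sym (Σ<-⊕ (suc N) _ _))) ⟩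
    𝟏 ⊕ Σ< (suc N) (λ t → x^ (suc t ℕ.* 1) ⊗ (H (suc t) ⊗ H (suc t)) ⊕ x^ suc t ⊗ (H t ⊗ H (suc t)))
      ≈⟨ ⊕-congˡ (Σ<-cong (suc N) λ t _ → step t) ⟩
    𝟏 ⊕ Σ< (suc N) (λ t → H (suc t) ⊗ H (suc t) ⊕ ⊝ (H t ⊗ H t))
      ≈⟨ ⊕-congˡ (Σ<-telescope (suc N) (λ t → H t ⊗ H t)) ⟩
    𝟏 ⊕ (H (suc N) ⊗ H (suc N) ⊕ ⊝ (H 0 ⊗ H 0))
      ≈⟨ ⊕-congˡ (⊕-cong (⊗-cong H-≈P H-≈P) (⊝-cong (⊗-cong H-zero H-zero))) ⟩
    𝟏 ⊕ (P ⊗ P ⊕ ⊝ (𝟏 ⊗ 𝟏))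
      ≈⟨ solve 1 (λ p → con 1ℤ :+ (p :- con 1ℤ :* con 1ℤ) := p) ≈-refl (P ⊗ P) ⟩
    P ⊗ P ∎
    where
    step : ∀ t → x^ (suc t ℕ.* 1) ⊗ (H (suc t) ⊗ H (suc t)) ⊕ x^ suc t ⊗ (H t ⊗ H (suc t))
                   ≈ H (suc t) ⊗ H (suc t) ⊕ ⊝ (H t ⊗ H t)
    step t = begin
      x^ (suc t ℕ.* 1) ⊗ (Y ⊗ Y) ⊕ X ⊗ (H t ⊗ Y)
        ≈⟨ ⊕-cong (⊗-congʳ (x^-≡ (ℕ.*-identityʳ (suc t)))) (⊗-congˡ (⊗-congʳ (H-pred t))) ⟩
      X ⊗ (Y ⊗ Y) ⊕ X ⊗ ((Y ⊕ ⊝ (X ⊗ Y)) ⊗ Y)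
        ≈⟨ solve 2 (λ x y → x :* (y :* y) :+ x :* ((y :- x :* y) :* y) := y :* y :- (y :- x :* y) :* (y :- x :* y)) ≈-refl X Y ⟩
      Y ⊗ Y ⊕ ⊝ ((Y ⊕ ⊝ (X ⊗ Y)) ⊗ (Y ⊕ ⊝ (X ⊗ Y)))
        ≈⟨ ⊕-congˡ (⊝-cong (⊗-cong (H-pred t) (H-pred t))) ⟨
      Y ⊗ Y ⊕ ⊝ (H t ⊗ H t) ∎
      where
      X Y : Series
      X = x^ suc t
      Y = H (suc t)

  -- Termwise, X² Y² + X (1 - X) Y² = X Y² for X = x^(t+1) and Y = `H (suc t)`.
  U₂⊕U₀≈U₁ : Uˢ 2 ⊕ Uˢ 0 ≈ Uˢ 1
  U₂⊕U₀≈U₁ = begin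
    Uˢ 2 ⊕ Uˢ 0
      ≈⟨ ⊕-congʳ (Uˢ-shift 1) ⟩
    𝟏 ⊕ Σ< (suc N) (λ t → x^ (suc t ℕ.* 2) ⊗ (H (suc t) ⊗ H (suc t))) ⊕ Uˢ 0
      ≈⟨ ≈-trans (solve 3 (λ a b c → (a :+ b) :+ c := a :+ (b :+ c)) ≈-refl 𝟏 _ (Uˢ 0)) (⊕-congˡ (≈-sym (Σ<-⊕ (suc N) _ _))) ⟩
    𝟏 ⊕ Σ< (suc N) (λ t → x^ (suc t ℕ.* 2) ⊗ (H (suc t) ⊗ H (suc t)) ⊕ x^ suc t ⊗ (H t ⊗ H (suc t)))
      ≈⟨ ⊕-congˡ (Σ<-cong (suc N) λ t _ → step t) ⟩
    𝟏 ⊕ Σ< (suc N) (λ t → x^ (suc t ℕ.* 1) ⊗ (H (suc t) ⊗ H (suc t)))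
      ≈⟨ Uˢ-shift 0 ⟨
    Uˢ 1 ∎
    where
    exponent : ∀ t → t ℕ.* 2 ≡ t ℕ.* 1 ℕ.+ t
    exponent = ℕ-Ring.solve-∀

    step : ∀ t → x^ (suc t ℕ.* 2) ⊗ (H (suc t) ⊗ H (suc t)) ⊕ x^ suc t ⊗ (H t ⊗ H (suc t))
                   ≈ x^ (suc t ℕ.* 1) ⊗ (H (suc t) ⊗ H (suc t))
    step t = begin
      x^ (suc t ℕ.* 2) ⊗ (Y ⊗ Y) ⊕ X ⊗ (H t ⊗ Y)
        ≈⟨ ⊕-cong (⊗-congʳ (≈-trans (x^-≡ (exponent (suc t))) (≈-trans (x^-+-≈ (suc t ℕ.* 1) (suc t)) (⊗-congʳ X₁)))) (⊗-congˡ (⊗-congʳ (H-pred t))) ⟩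
      (X ⊗ X) ⊗ (Y ⊗ Y) ⊕ X ⊗ ((Y ⊕ ⊝ (X ⊗ Y)) ⊗ Y)
        ≈⟨ solve 2 (λ x y → (x :* x) :* (y :* y) :+ x :* ((y :- x :* y) :* y) := x :* (y :* y)) ≈-refl X Y ⟩
      X ⊗ (Y ⊗ Y)
        ≈⟨ ⊗-congʳ X₁ ⟨
      x^ (suc t ℕ.* 1) ⊗ (Y ⊗ Y) ∎
      where
      X Y : Series
      X = x^ suc t
      Y = H (suc t)

      X₁ : x^ (suc t ℕ.* 1) ≈ X
      X₁ = x^-≡ (ℕ.*-identityʳ (suc t))

  ι : ∀ {P : Set} → Dec P → Series
  ι P? = const (𝟙 P?)

  C₁ˢ : Series
  C₁ˢ = V ⊗ Σ< (suc N) λ w → Σ< (suc N) λ b → ι (w ℕ.≤? b) ⊗ G w b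

  opaque
    unfolding Σ< _⊕_

    Σ<-δ : ∀ {a n} → a ℕ.< n → (F : ℕ → Series) → Σ< n (λ i → ι (a ℕ.≟ i) ⊗ F i) ≈ F a
    Σ<-δ {a} {n} a<n F = mk λ {k} _ → trans
      (∑<-cong n λ i _ → const-⊗ (𝟙 (a ℕ.≟ i)) (F i) k) (∑<-δ a<n λ i → F i k)

    halve : ∀ {X Y} → X ⊕ X ≈ Y ⊕ Y → X ≈ Y
    halve {X} {Y} p = mk λ {i} i≤N → ℤ.*-cancelˡ-≡ (+ 2) (X i) (Y i) (trans (twice (X i)) (trans (at p i≤N) (sym (twice (Y i)))))
      where
      twice : ∀ z → + 2 * z ≡ z + z
      twice z = ℤ-Solver.solve 1 (λ z → ℤ-Solver.con (+ 2) ℤ-Solver.:* z ℤ-Solver.:= z ℤ-Solver.:+ z) refl z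

  ι-≤-≥ : ∀ w b → ι (w ℕ.≤? b) ⊕ ι (b ℕ.≤? w) ≈ 𝟏 ⊕ ι (w ℕ.≟ b)
  ι-≤-≥ w b with w ℕ.≤? b | b ℕ.≤? w | w ℕ.≟ b
  ... | yes _   | yes _   | yes _    = ≈-refl
  ... | yes w≤b | yes b≤w | no w≢b   = contradiction (ℕ.≤-antisym w≤b b≤w) w≢b
  ... | yes _   | no b≰w  | yes refl = contradiction ℕ.≤-refl b≰w
  ... | yes _   | no _    | no _     = ≈-refl
  ... | no w≰b  | _       | yes refl = contradiction ℕ.≤-refl w≰b
  ... | no _    | yes _   | no _     = solve 0 (con 0ℤ :+ con 1ℤ := con 1ℤ :+ con 0ℤ) ≈-refl
  ... | no w≰b  | no b≰w  | no _     = contradiction (ℕ.<⇒≤ (ℕ.≰⇒> w≰b)) b≰w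

  G-sym : ∀ w b → G w b ≈ G b w
  G-sym w b = begin
    (x^ w ⊗ H w) ⊗ (x^ (suc w ℕ.* b) ⊗ H b)
      ≈⟨ solve 4 (λ a h c k → (a :* h) :* (c :* k) := (a :* c) :* (h :* k)) ≈-refl (x^ w) (H w) (x^ (suc w ℕ.* b)) (H b) ⟩
    (x^ w ⊗ x^ (suc w ℕ.* b)) ⊗ (H w ⊗ H b)
      ≈⟨ ⊗-congʳ (≈-trans (≈-sym (x^-+-≈ w (suc w ℕ.* b))) (≈-trans (x^-≡ (exponent w b)) (x^-+-≈ b (suc b ℕ.* w)))) ⟩
    (x^ b ⊗ x^ (suc b ℕ.* w)) ⊗ (H w ⊗ H b)
      ≈⟨ solve 4 (λ a h c k → (a :* c) :* (h :* k) := (a :* k) :* (c :* h)) ≈-refl (x^ b) (H w) (x^ (suc b ℕ.* w)) (H b) ⟩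
    G b w ∎
    where
    exponent : ∀ w b → w ℕ.+ suc w ℕ.* b ≡ b ℕ.+ suc b ℕ.* w
    exponent = ℕ-Ring.solve-∀

  G-row : ∀ w → Σ< (suc N) (G w) ≈ x^ w ⊗ P
  G-row w = begin
    Σ< (suc N) (G w)                                                 ≈⟨ Σ<-cong (suc N) (λ b _ → solve 3 (λ x h k → (x :* h) :* k := x :* (k :* h)) ≈-refl (x^ w) (H w) (x^ (suc w ℕ.* b) ⊗ H b)) ⟩
    Σ< (suc N) (λ b → x^ w ⊗ (x^ (suc w ℕ.* b) ⊗ H b ⊗ H w))         ≈⟨ Σ<-⊗ˡ (suc N) (x^ w) _ ⟩
    x^ w ⊗ E w (λ _ → H w) 0                                         ≈⟨ ⊗-congˡ (euler w 0) ⟩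
    x^ w ⊗ P                                                         ∎

  -- By `G-sym` one copy of C₁ may be summed over b ≤ w instead of w ≤ b. Together the two triangles
  -- cover the square once and the diagonal a second time. The rows of the square are x^w P, and
  -- (1-x) Σ x^w = 1; the diagonal is C₂.
  C₁⊕C₁≈P⊕C₂ : C₁ˢ ⊕ C₁ˢ ≈ P ⊕ C₂ˢ
  C₁⊕C₁≈P⊕C₂ = begin
    V ⊗ S ⊕ V ⊗ S
      ≈⟨ ⊕-congˡ (⊗-congˡ S-sym) ⟩
    V ⊗ S ⊕ V ⊗ S′
      ≈⟨ ⊗-distribˡ-≈ V S S′ ⟨
    V ⊗ (S ⊕ S′)
      ≈⟨ ⊗-congˡ (≈-trans (≈-sym (Σ<-⊕ (suc N) _ _)) (Σ<-cong (suc N) row)) ⟩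
    V ⊗ Σ< (suc N) (λ w → x^ w ⊗ P ⊕ G w w)
      ≈⟨ ⊗-congˡ (≈-trans (Σ<-⊕ (suc N) _ _) (⊕-congʳ (Σ<-⊗ʳ (suc N) P x^_))) ⟩
    V ⊗ (Σ< (suc N) x^_ ⊗ P ⊕ Σ< (suc N) λ w → G w w)
      ≈⟨ solve 4 (λ v s p g → v :* (s :* p :+ g) := (v :* s) :* p :+ v :* g) ≈-refl V (Σ< (suc N) x^_) P (Σ< (suc N) λ w → G w w) ⟩
    (V ⊗ Σ< (suc N) x^_) ⊗ P ⊕ C₂ˢ
      ≈⟨ ⊕-congʳ (≈-trans (⊗-congʳ geometric) (⊗-identityˡ-≈ P)) ⟩
    P ⊕ C₂ˢ ∎
    where
    S S′ : Series
    S  = Σ< (suc N) λ w → Σ< (suc N) λ b → ι (w ℕ.≤? b) ⊗ G w b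
    S′ = Σ< (suc N) λ w → Σ< (suc N) λ b → ι (b ℕ.≤? w) ⊗ G w b

    S-sym : S ≈ S′
    S-sym = ≈-trans (Σ<-swap (suc N) (suc N) _)
      (Σ<-cong (suc N) λ w _ → Σ<-cong (suc N) λ b _ → ⊗-congˡ (G-sym b w))

    row : ∀ w → w ℕ.< suc N →
          Σ< (suc N) (λ b → ι (w ℕ.≤? b) ⊗ G w b) ⊕ Σ< (suc N) (λ b → ι (b ℕ.≤? w) ⊗ G w b) ≈ x^ w ⊗ P ⊕ G w w
    row w w<N = begin
      Σ< (suc N) (λ b → ι (w ℕ.≤? b) ⊗ G w b) ⊕ Σ< (suc N) (λ b → ι (b ℕ.≤? w) ⊗ G w b)
        ≈⟨ Σ<-⊕ (suc N) _ _ ⟨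
      Σ< (suc N) (λ b → ι (w ℕ.≤? b) ⊗ G w b ⊕ ι (b ℕ.≤? w) ⊗ G w b)
        ≈⟨ Σ<-cong (suc N) (λ b _ → begin
             ι (w ℕ.≤? b) ⊗ G w b ⊕ ι (b ℕ.≤? w) ⊗ G w b
               ≈⟨ solve 3 (λ a b g → a :* g :+ b :* g := (a :+ b) :* g) ≈-refl (ι (w ℕ.≤? b)) (ι (b ℕ.≤? w)) (G w b) ⟩
             (ι (w ℕ.≤? b) ⊕ ι (b ℕ.≤? w)) ⊗ G w b
               ≈⟨ ⊗-congʳ (ι-≤-≥ w b) ⟩
             (𝟏 ⊕ ι (w ℕ.≟ b)) ⊗ G w b
               ≈⟨ solve 2 (λ d g → (con 1ℤ :+ d) :* g := g :+ d :* g) ≈-refl (ι (w ℕ.≟ b)) (G w b) ⟩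
             G w b ⊕ ι (w ℕ.≟ b) ⊗ G w b ∎) ⟩
      Σ< (suc N) (λ b → G w b ⊕ ι (w ℕ.≟ b) ⊗ G w b)
        ≈⟨ Σ<-⊕ (suc N) _ _ ⟩
      Σ< (suc N) (G w) ⊕ Σ< (suc N) (λ b → ι (w ℕ.≟ b) ⊗ G w b)
        ≈⟨ ⊕-cong (G-row w) (Σ<-δ w<N (G w)) ⟩
      x^ w ⊗ P ⊕ G w w ∎

    geometric : V ⊗ Σ< (suc N) x^_ ≈ 𝟏
    geometric = begin
      V ⊗ Σ< (suc N) x^_                                     ≈⟨ Σ<-⊗ˡ (suc N) V x^_ ⟨
      Σ< (suc N) (λ w → (𝟏 ⊕ ⊝ x^ 1) ⊗ x^ w)                 ≈⟨ Σ<-cong (suc N) (λ w _ → begin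
        (𝟏 ⊕ ⊝ x^ 1) ⊗ x^ w          ≈⟨ solve 2 (λ x y → (con 1ℤ :- x) :* y := :- (x :* y) :- (:- y)) ≈-refl (x^ 1) (x^ w) ⟩
        ⊝ (x^ 1 ⊗ x^ w) ⊕ ⊝ (⊝ x^ w) ≈⟨ ⊕-congʳ (⊝-cong (≈-sym (x^-+-≈ 1 w))) ⟩
        ⊝ x^ suc w ⊕ ⊝ (⊝ x^ w)      ∎) ⟩
      Σ< (suc N) (λ w → ⊝ x^ suc w ⊕ ⊝ (⊝ x^ w))             ≈⟨ Σ<-telescope (suc N) (λ w → ⊝ x^ w) ⟩
      ⊝ x^ suc N ⊕ ⊝ (⊝ x^ 0)                                ≈⟨ ⊕-congʳ (⊝-cong (x^-≈𝟘 (ℕ.n<1+n N))) ⟩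
      ⊝ 𝟘 ⊕ ⊝ (⊝ 𝟏)                                          ≈⟨ solve 0 (:- con 0ℤ :+ :- (:- con 1ℤ) := con 1ℤ) ≈-refl ⟩
      𝟏                                                      ∎

  -- The relations for U₁ - U₀ and U₁ + U₀, like the one for the cranks, determine only twice the
  -- series; coefficients in ℤ can be halved.
  U₁≈P⊗C₁ : Uˢ 1 ≈ P ⊗ C₁ˢ
  U₁≈P⊗C₁ = halve (begin
    Uˢ 1 ⊕ Uˢ 1              ≈⟨ ⊕-congˡ U₂⊕U₀≈U₁ ⟨
    Uˢ 1 ⊕ (Uˢ 2 ⊕ Uˢ 0)     ≈⟨ solve 3 (λ a b c → a :+ (b :+ c) := (a :+ c) :+ b) ≈-refl (Uˢ 1) (Uˢ 2) (Uˢ 0) ⟩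
    Uˢ 1 ⊕ Uˢ 0 ⊕ Uˢ 2       ≈⟨ ⊕-cong U₁⊕U₀≈P⊗P U₂≈P⊗C₂ ⟩
    P ⊗ P ⊕ P ⊗ C₂ˢ          ≈⟨ ⊗-distribˡ-≈ P P C₂ˢ ⟨
    P ⊗ (P ⊕ C₂ˢ)            ≈⟨ ⊗-congˡ C₁⊕C₁≈P⊕C₂ ⟨
    P ⊗ (C₁ˢ ⊕ C₁ˢ)          ≈⟨ ⊗-distribˡ-≈ P C₁ˢ C₁ˢ ⟩
    P ⊗ C₁ˢ ⊕ P ⊗ C₁ˢ        ∎)

  U₀≈P⊗C₀ : Uˢ 0 ≈ P ⊗ (C₁ˢ ⊕ ⊝ C₂ˢ)
  U₀≈P⊗C₀ = begin
    Uˢ 0                           ≈⟨ solve 2 (λ a b → a := (b :+ a) :- b) ≈-refl (Uˢ 0) (Uˢ 2) ⟩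
    (Uˢ 2 ⊕ Uˢ 0) ⊕ ⊝ Uˢ 2         ≈⟨ ⊕-cong (≈-trans U₂⊕U₀≈U₁ U₁≈P⊗C₁) (⊝-cong U₂≈P⊗C₂) ⟩
    P ⊗ C₁ˢ ⊕ ⊝ (P ⊗ C₂ˢ)          ≈⟨ solve 3 (λ p a b → p :* a :- p :* b := p :* (a :- b)) ≈-refl P C₁ˢ C₂ˢ ⟩
    P ⊗ (C₁ˢ ⊕ ⊝ C₂ˢ)              ∎

  -- Gaussian binomials and P times the truncated pentagonal series

  gaussian-< : ∀ {c j} → c ℕ.< j → gaussian c j ≈ 𝟘
  gaussian-< {zero}  {suc j} _         = ≈-refl
  gaussian-< {suc c} {suc j} (s≤s c<j) = begin
    gaussian c j ⊕ x^ suc j ⊗ gaussian c (suc j)   ≈⟨ ⊕-cong (gaussian-< c<j) (⊗-congˡ (gaussian-< (ℕ.m≤n⇒m≤1+n c<j))) ⟩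
    𝟘 ⊕ x^ suc j ⊗ 𝟘                               ≈⟨ solve 1 (λ x → con 0ℤ :+ x :* con 0ℤ := con 0ℤ) ≈-refl (x^ suc j) ⟩
    𝟘                                              ∎

  gaussian-diagonal : ∀ j → gaussian j j ≈ 𝟏
  gaussian-diagonal zero    = ≈-refl
  gaussian-diagonal (suc j) = begin
    gaussian j j ⊕ x^ suc j ⊗ gaussian j (suc j)   ≈⟨ ⊕-cong (gaussian-diagonal j) (⊗-congˡ (gaussian-< (ℕ.n<1+n j))) ⟩
    𝟏 ⊕ x^ suc j ⊗ 𝟘                               ≈⟨ solve 1 (λ x → con 1ℤ :+ x :* con 0ℤ := con 1ℤ) ≈-refl (x^ suc j) ⟩
    𝟏                                              ∎

  -- The quotient formula for Gaussian binomials. Both sides solve the same equation: the left one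
  -- by the Pascal rule and the two smaller instances, the right one by `H⊗H`.
  H⊗gaussian : ∀ i j → H (j ℕ.+ i) ⊗ gaussian (j ℕ.+ i) j ≈ H j ⊗ H i
  H⊗gaussian i zero = begin
    H i ⊗ 𝟏      ≈⟨ solve 1 (λ h → h :* con 1ℤ := con 1ℤ :* h) ≈-refl (H i) ⟩
    𝟏 ⊗ H i      ≈⟨ ⊗-congʳ H-zero ⟨
    H 0 ⊗ H i    ∎
  H⊗gaussian zero (suc j) rewrite ℕ.+-identityʳ j = ⊗-congˡ (≈-trans (gaussian-diagonal (suc j)) (≈-sym H-zero))
  H⊗gaussian (suc i) (suc j) = unique-solution n
    (begin
      H (suc n) ⊗ γ                                   ≈⟨ ⊗-congʳ (H-suc n) ⟩
      (H n ⊕ x^ suc n ⊗ H (suc n)) ⊗ γ                ≈⟨ solve 4 (λ a b c d → (a :+ b :* c) :* d := a :* d :+ b :* (c :* d)) ≈-refl (H n) (x^ suc n) (H (suc n)) γ ⟩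
      H n ⊗ γ ⊕ x^ suc n ⊗ (H (suc n) ⊗ γ)            ≈⟨ ⊕-congʳ lower ⟩
      A ⊕ x^ suc n ⊗ (H (suc n) ⊗ γ)                  ∎)
    (begin
      H (suc j) ⊗ H (suc i)                           ≈⟨ H⊗H (suc j) (suc i) ⟩
      A ⊕ x^ (suc j ℕ.+ suc i) ⊗ (H (suc j) ⊗ H (suc i)) ∎)
    where
    n : ℕ
    n = j ℕ.+ suc i

    γ A : Series
    γ = gaussian (suc n) (suc j)
    A = H j ⊗ H (suc i) ⊕ x^ suc j ⊗ (H (suc j) ⊗ H i)

    lower : H n ⊗ γ ≈ A
    lower = begin
      H n ⊗ (gaussian n j ⊕ x^ suc j ⊗ gaussian n (suc j))
        ≈⟨ solve 4 (λ h a b c → h :* (a :+ b :* c) := h :* a :+ b :* (h :* c)) ≈-refl (H n) (gaussian n j) (x^ suc j) (gaussian n (suc j)) ⟩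
      H n ⊗ gaussian n j ⊕ x^ suc j ⊗ (H n ⊗ gaussian n (suc j))
        ≈⟨ ⊕-cong (H⊗gaussian (suc i) j) (⊗-congˡ (≈-trans (≈-reflexive (cong (λ m → H m ⊗ gaussian m (suc j)) (ℕ.+-suc j i))) (H⊗gaussian i (suc j)))) ⟩
      A ∎

  -- Removing one copy of each of 1, ..., j leaves at most c - j parts, all ≤ j; a Gaussian binomial
  -- enumerates these. In `B⊕B-gaussian` the part j + 1 is allowed as well and the bound is one
  -- lower, whence its lower index j + 1. The two are proved by mutual recursion.
  B-gaussian : ∀ j c → B j (suc c) ≈ x^ tri j ⊗ gaussian c j
  B⊕B-gaussian : ∀ j c → B j c ⊕ B (suc j) c ≈ x^ tri j ⊗ gaussian c (suc j)

  B-gaussian zero    c = ≈-sym (⊗-identityˡ-≈ 𝟏)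
  B-gaussian (suc j) c = begin
    x^ suc j ⊗ (B j c ⊕ B (suc j) c)               ≈⟨ ⊗-congˡ (B⊕B-gaussian j c) ⟩
    x^ suc j ⊗ (x^ tri j ⊗ gaussian c (suc j))     ≈⟨ solve 3 (λ a b g → a :* (b :* g) := (b :* a) :* g) ≈-refl (x^ suc j) (x^ tri j) (gaussian c (suc j)) ⟩
    (x^ tri j ⊗ x^ suc j) ⊗ gaussian c (suc j)     ≈⟨ ⊗-congʳ (x^-+-≈ (tri j) (suc j)) ⟨
    x^ tri (suc j) ⊗ gaussian c (suc j)            ∎

  B⊕B-gaussian zero    zero = solve 1 (λ a → con 0ℤ :+ con 0ℤ := a :* con 0ℤ) ≈-refl (x^ tri zero)
  B⊕B-gaussian (suc j) zero = solve 1 (λ a → con 0ℤ :+ con 0ℤ := a :* con 0ℤ) ≈-refl (x^ tri (suc j))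
  B⊕B-gaussian j    (suc c) = begin
    B j (suc c) ⊕ x^ suc j ⊗ (B j c ⊕ B (suc j) c)                        ≈⟨ ⊕-cong (B-gaussian j c) (⊗-congˡ (B⊕B-gaussian j c)) ⟩
    x^ tri j ⊗ gaussian c j ⊕ x^ suc j ⊗ (x^ tri j ⊗ gaussian c (suc j))  ≈⟨ solve 4 (λ t a x b → t :* a :+ x :* (t :* b) := t :* (a :+ x :* b)) ≈-refl (x^ tri j) (gaussian c j) (x^ suc j) (gaussian c (suc j)) ⟩
    x^ tri j ⊗ gaussian (suc c) (suc j)                                   ∎

  Σ<-split : ∀ m n F → Σ< (m ℕ.+ n) F ≈ Σ< m F ⊕ Σ< n (λ t → F (m ℕ.+ t))
  Σ<-split zero    n F = begin
    Σ< n F             ≈⟨ ⊕-identityˡ-≈ (Σ< n F) ⟨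
    𝟘 ⊕ Σ< n F         ≈⟨ ⊕-congʳ (Σ<-zero F) ⟨
    Σ< 0 F ⊕ Σ< n F    ∎
  Σ<-split (suc m) n F = begin
    Σ< (suc m ℕ.+ n) F                                      ≈⟨ Σ<-suc (m ℕ.+ n) F ⟩
    F 0 ⊕ Σ< (m ℕ.+ n) (F ∘ suc)                            ≈⟨ ⊕-congˡ (Σ<-split m n (F ∘ suc)) ⟩
    F 0 ⊕ (Σ< m (F ∘ suc) ⊕ Σ< n (λ t → F (suc m ℕ.+ t)))   ≈⟨ solve 3 (λ a b c → a :+ (b :+ c) := (a :+ b) :+ c) ≈-refl (F 0) (Σ< m (F ∘ suc)) (Σ< n (λ t → F (suc m ℕ.+ t))) ⟩
    F 0 ⊕ Σ< m (F ∘ suc) ⊕ Σ< n (λ t → F (suc m ℕ.+ t))     ≈⟨ ⊕-congʳ (Σ<-suc m F) ⟨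
    Σ< (suc m) F ⊕ Σ< n (λ t → F (suc m ℕ.+ t))             ∎

  -- The series of `M (suc j)`. With k = j + 1, the operator runs over the number c of parts > k,
  -- and `B j c` enumerates the parts < k.
  Mˢ : ℕ → Series
  Mˢ j = E (suc j) (B j) 0

  -- Let k = j + 1. For c < k the Gaussian binomial vanishes. For c = k + i its product with `H c`
  -- is `H k ⊗ H i`, so the sum over i is the one in `euler`. The remaining exponent (k+1) k +
  -- `tri j` is k² + `tri k`.
  E-B⊕B : ∀ j → E (suc j) (λ c → B j c ⊕ B (suc j) c) 0 ≈ x^ (suc j ℕ.* suc j ℕ.+ tri (suc j)) ⊗ P
  E-B⊕B j = begin
    Σ< (suc N) F
      -- With k vanishing terms appended, the shift c = k + i leaves a sum of exactly `suc N` terms,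
      -- as in `E`.
      ≈⟨ Σ<-drop (suc N) k F (λ c N<c → ≈-trans (⊗-congʳ (x^-⊗-≈𝟘 (H c) (ℕ.≤-trans N<c (ℕ.m≤n*m c (suc k))))) (⊗-zeroˡ-≈ _)) ⟨
    Σ< (suc N ℕ.+ k) F
      ≈⟨ ≈-reflexive (cong (λ n → Σ< n F) (ℕ.+-comm (suc N) k)) ⟩
    Σ< (k ℕ.+ suc N) F
      ≈⟨ Σ<-split k (suc N) F ⟩
    Σ< k F ⊕ Σ< (suc N) (λ i → F (k ℕ.+ i))
      ≈⟨ ⊕-cong (Σ<-≈𝟘 k λ c c<k → small c c<k) (Σ<-cong (suc N) λ i _ → large i) ⟩
    𝟘 ⊕ Σ< (suc N) (λ i → x^ w ⊗ (x^ (suc k ℕ.* i) ⊗ H i ⊗ H k))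
      ≈⟨ ≈-trans (⊕-identityˡ-≈ _) (Σ<-⊗ˡ (suc N) (x^ w) _) ⟩
    x^ w ⊗ E k (λ _ → H k) 0
      ≈⟨ ⊗-congˡ (euler k 0) ⟩
    x^ w ⊗ P ∎
    where
    k w : ℕ
    k = suc j
    w = k ℕ.* k ℕ.+ tri k

    F : ℕ → Series
    F c = x^ (suc k ℕ.* c) ⊗ H c ⊗ (B j c ⊕ B (suc j) c)

    small : ∀ c → c ℕ.< k → F c ≈ 𝟘
    small c c<k = begin
      x^ (suc k ℕ.* c) ⊗ H c ⊗ (B j c ⊕ B (suc j) c)    ≈⟨ ⊗-congˡ (≈-trans (B⊕B-gaussian j c) (⊗-congˡ (gaussian-< c<k))) ⟩
      x^ (suc k ℕ.* c) ⊗ H c ⊗ (x^ tri j ⊗ 𝟘)           ≈⟨ solve 2 (λ a b → a :* (b :* con 0ℤ) := con 0ℤ) ≈-refl (x^ (suc k ℕ.* c) ⊗ H c) (x^ tri j) ⟩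
      𝟘                                                  ∎

    exponent : ∀ k i t → suc k ℕ.* (k ℕ.+ i) ℕ.+ t ≡ k ℕ.* k ℕ.+ (t ℕ.+ k) ℕ.+ suc k ℕ.* i
    exponent = ℕ-Ring.solve-∀

    large : ∀ i → F (k ℕ.+ i) ≈ x^ w ⊗ (x^ (suc k ℕ.* i) ⊗ H i ⊗ H k)
    large i = begin
      x^ (suc k ℕ.* (k ℕ.+ i)) ⊗ H (k ℕ.+ i) ⊗ (B j (k ℕ.+ i) ⊕ B (suc j) (k ℕ.+ i))
        ≈⟨ ⊗-congˡ (B⊕B-gaussian j (k ℕ.+ i)) ⟩
      x^ (suc k ℕ.* (k ℕ.+ i)) ⊗ H (k ℕ.+ i) ⊗ (x^ tri j ⊗ gaussian (k ℕ.+ i) k)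
        ≈⟨ solve 4 (λ a h b g → (a :* h) :* (b :* g) := (a :* b) :* (h :* g)) ≈-refl (x^ (suc k ℕ.* (k ℕ.+ i))) (H (k ℕ.+ i)) (x^ tri j) (gaussian (k ℕ.+ i) k) ⟩
      (x^ (suc k ℕ.* (k ℕ.+ i)) ⊗ x^ tri j) ⊗ (H (k ℕ.+ i) ⊗ gaussian (k ℕ.+ i) k)
        ≈⟨ ⊗-cong (≈-trans (≈-sym (x^-+-≈ (suc k ℕ.* (k ℕ.+ i)) (tri j))) (≈-trans (x^-≡ (exponent k i (tri j))) (x^-+-≈ w (suc k ℕ.* i)))) (H⊗gaussian i k) ⟩
      (x^ w ⊗ x^ (suc k ℕ.* i)) ⊗ (H k ⊗ H i)
        ≈⟨ solve 4 (λ a b h g → (a :* b) :* (h :* g) := a :* (b :* g :* h)) ≈-refl (x^ w) (x^ (suc k ℕ.* i)) (H k) (H i) ⟩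
      x^ w ⊗ (x^ (suc k ℕ.* i) ⊗ H i ⊗ H k) ∎

  E-⊕ : ∀ k φ ψ b → E k (λ c → φ c ⊕ ψ c) b ≈ E k φ b ⊕ E k ψ b
  E-⊕ k φ ψ b = ≈-trans (Σ<-cong (suc N) λ c _ → ⊗-distribˡ-≈ _ _ _) (Σ<-⊕ (suc N) _ _)

  E-⊗ˡ : ∀ k A φ b → E k (λ c → A ⊗ φ c) b ≈ A ⊗ E k φ b
  E-⊗ˡ k A φ b = ≈-trans (E-cong k (λ c → ⊗-comm-≈ A (φ c)) b) (≈-trans (E-⊗ʳ k φ A b) (⊗-comm-≈ _ A))

  -- `E-down` rewrites `Mˢ k` as `E k (B k) 0` minus x^(k+1) times `E k (B k) 1`. The recursion of
  -- `B` turns the latter into x^k times `R`, and `R` is also the sum of `Mˢ j` and `E k (B k) 0`;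
  -- so the total is `R` times 1 - x^(2k+1).
  M-consecutive : ∀ j → let k = suc j in
    Mˢ j ⊕ Mˢ k ≈ P ⊗ (x^ (k ℕ.* k ℕ.+ tri k) ⊗ (𝟏 ⊕ ⊝ x^ (k ℕ.+ suc k)))
  M-consecutive j = begin
    E k (B j) 0 ⊕ E (suc k) (B k) 0
      ≈⟨ solve 3 (λ a b c → a :+ b := (a :+ (b :+ c)) :- c) ≈-refl (E k (B j) 0) (E (suc k) (B k) 0) (x^ suc k ⊗ E k (B k) 1) ⟩
    E k (B j) 0 ⊕ (E (suc k) (B k) 0 ⊕ x^ suc k ⊗ E k (B k) 1) ⊕ ⊝ (x^ suc k ⊗ E k (B k) 1)
      ≈⟨ ⊕-congʳ (⊕-congˡ (E-down k (B k) 0)) ⟨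
    E k (B j) 0 ⊕ E k (B k) 0 ⊕ ⊝ (x^ suc k ⊗ E k (B k) 1)
      ≈⟨ ⊕-cong (≈-sym (E-⊕ k (B j) (B k) 0)) (⊝-cong (⊗-congˡ (E-⊗ˡ k (x^ k) (λ c → B j c ⊕ B k c) 0))) ⟩
    R ⊕ ⊝ (x^ suc k ⊗ (x^ k ⊗ R))
      ≈⟨ solve 3 (λ r x y → r :- x :* (y :* r) := r :* (con 1ℤ :- y :* x)) ≈-refl R (x^ suc k) (x^ k) ⟩
    R ⊗ (𝟏 ⊕ ⊝ (x^ k ⊗ x^ suc k))
      ≈⟨ ⊗-cong (E-B⊕B j) (⊕-congˡ (⊝-cong (≈-sym (x^-+-≈ k (suc k))))) ⟩
    (x^ (k ℕ.* k ℕ.+ tri k) ⊗ P) ⊗ (𝟏 ⊕ ⊝ x^ (k ℕ.+ suc k))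
      ≈⟨ solve 3 (λ a p b → (a :* p) :* b := p :* (a :* b)) ≈-refl (x^ (k ℕ.* k ℕ.+ tri k)) P (𝟏 ⊕ ⊝ x^ (k ℕ.+ suc k)) ⟩
    P ⊗ (x^ (k ℕ.* k ℕ.+ tri k) ⊗ (𝟏 ⊕ ⊝ x^ (k ℕ.+ suc k))) ∎
    where
    k : ℕ
    k = suc j

    R : Series
    R = E k (λ c → B j c ⊕ B k c) 0

  sgn-suc : ∀ k → sgn (suc k) ≈ ⊝ sgn k
  sgn-suc k = ≈-trans (≈-reflexive (cong const (ℤ.-1*i≡-i (-1ℤ ℤ.^ k)))) (exact λ
    { zero → sym (⊝-at (sgn k) 0) ; (suc i) → sym (⊝-at (sgn k) (suc i)) })

  sgn⊗sgn : ∀ k → sgn k ⊗ sgn k ≈ 𝟏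
  sgn⊗sgn zero    = ⊗-identityˡ-≈ 𝟏
  sgn⊗sgn (suc k) = begin
    sgn (suc k) ⊗ sgn (suc k) ≈⟨ ⊗-cong (sgn-suc k) (sgn-suc k) ⟩
    ⊝ sgn k ⊗ ⊝ sgn k         ≈⟨ solve 1 (λ s → (:- s) :* (:- s) := s :* s) ≈-refl (sgn k) ⟩
    sgn k ⊗ sgn k             ≈⟨ sgn⊗sgn k ⟩
    𝟏                         ∎

  -- For k = 1 there are no parts < k, so the partitions in question are the nonempty ones without
  -- ones.
  M₀ : Mˢ 0 ≈ V ⊗ P ⊕ ⊝ 𝟏
  M₀ = begin
    E 1 (B 0) 0
      ≈⟨ Σ<-suc N _ ⟩
    x^ 0 ⊗ H 0 ⊗ 𝟘 ⊕ R
      ≈⟨ solve 2 (λ a r → a :* con 0ℤ :+ r := (con 1ℤ :* con 1ℤ :* con 1ℤ :+ r) :- con 1ℤ) ≈-refl (x^ 0 ⊗ H 0) R ⟩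
    𝟏 ⊗ 𝟏 ⊗ 𝟏 ⊕ R ⊕ ⊝ 𝟏
      ≈⟨ ⊕-congʳ (⊕-congʳ (⊗-congʳ (⊗-congˡ H-zero))) ⟨
    x^ 0 ⊗ H 0 ⊗ 𝟏 ⊕ R ⊕ ⊝ 𝟏
      ≈⟨ ⊕-congʳ (Σ<-suc N _) ⟨
    E 1 (λ _ → 𝟏) 0 ⊕ ⊝ 𝟏
      ≈⟨ ⊕-congʳ (E₁ 0) ⟩
    V ⊗ P ⊕ ⊝ 𝟏 ∎
    where
    R : Series
    R = Σ< N λ c → x^ (2 ℕ.* suc c) ⊗ H (suc c) ⊗ 𝟏

  -- The sign (-1)^j is -(-1)^k for k = j + 1. In the step, the summand of `Θ` with index k
  -- contributes (-1)^k times `Mˢ j ⊕ Mˢ k`, whose first half cancels the old remainder.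
  P⊗Θ : ∀ j → P ⊗ Θ (suc j) ≈ 𝟏 ⊕ sgn j ⊗ Mˢ j
  P⊗Θ zero = begin
    P ⊗ (𝟘 ⊕ 𝟏 ⊗ (𝟏 ⊗ (𝟏 ⊕ ⊝ x^ 1)))   ≈⟨ solve 2 (λ p x → p :* (con 0ℤ :+ con 1ℤ :* (con 1ℤ :* (con 1ℤ :- x))) := con 1ℤ :+ con 1ℤ :* ((con 1ℤ :- x) :* p :- con 1ℤ)) ≈-refl P (x^ 1) ⟩
    𝟏 ⊕ 𝟏 ⊗ (V ⊗ P ⊕ ⊝ 𝟏)              ≈⟨ ⊕-congˡ (⊗-congˡ M₀) ⟨
    𝟏 ⊕ sgn 0 ⊗ Mˢ 0                    ∎
  P⊗Θ (suc j) = begin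
    P ⊗ (Θ k ⊕ sgn k ⊗ Z)                                    ≈⟨ solve 4 (λ p t s z → p :* (t :+ s :* z) := p :* t :+ s :* (p :* z)) ≈-refl P (Θ k) (sgn k) Z ⟩
    P ⊗ Θ k ⊕ sgn k ⊗ (P ⊗ Z)                                ≈⟨ ⊕-cong (P⊗Θ j) (⊗-congˡ (≈-sym (M-consecutive j))) ⟩
    𝟏 ⊕ sgn j ⊗ Mˢ j ⊕ sgn k ⊗ (Mˢ j ⊕ Mˢ k)                 ≈⟨ ⊕-congˡ (⊗-congʳ (sgn-suc j)) ⟩
    𝟏 ⊕ sgn j ⊗ Mˢ j ⊕ ⊝ sgn j ⊗ (Mˢ j ⊕ Mˢ k)               ≈⟨ solve 3 (λ s m n → con 1ℤ :+ s :* m :+ (:- s) :* (m :+ n) := con 1ℤ :+ (:- s) :* n) ≈-refl (sgn j) (Mˢ j) (Mˢ k) ⟩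
    𝟏 ⊕ ⊝ sgn j ⊗ Mˢ k                                       ≈⟨ ⊕-congˡ (⊗-congʳ (sgn-suc j)) ⟨
    𝟏 ⊕ sgn k ⊗ Mˢ k                                         ∎
    where
    k : ℕ
    k = suc j

    Z : Series
    Z = x^ (k ℕ.* k ℕ.+ tri k) ⊗ (𝟏 ⊕ ⊝ x^ (k ℕ.+ suc k))

-- Partitions by least missing part

module _ {A : Set} {p} {P : Pred A p} (P? : Decidable P) where

  count-accept : ∀ {x} xs → P x → count P? (x ∷ xs) ≡ suc (count P? xs)
  count-accept xs px = cong length (filter-accept P? {xs = xs} px)

  count-reject : ∀ {x} xs → ¬ P x → count P? (x ∷ xs) ≡ count P? xs
  count-reject xs ¬px = cong length (filter-reject P? {xs = xs} ¬px)

  count-all : ∀ {xs} → All P xs → count P? xs ≡ length xs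
  count-all pxs = cong length (filter-all P? pxs)

  count-none : ∀ {xs} → All (¬_ ∘ P) xs → count P? xs ≡ 0
  count-none ¬pxs = cong length (filter-none P? ¬pxs)

∈-tail : ∀ {i p} {λs : List ℕ} → i ℕ.< p → i ∈ p ∷ λs → i ∈ λs
∈-tail i<p (here refl) = contradiction i<p (ℕ.<-irrefl refl)
∈-tail _   (there i∈)  = i∈

-- Bounded by `suc j`, so that it is literally the second half of `LeastMissing (suc j)`.
Full : ℕ → List ℕ → Set
Full j λs = ∀ {i} → i ℕ.< suc j → 1 ≤ i → i ∈ λs

full? : ∀ j → Decidable (Full j)
full? j λs = ℕ.allUpTo? (λ i → 1 ℕ.≤? i →-dec i ∈? λs) (suc j)

Q : ℕ → ℕ → List ℕ → ℤ
Q j b λs = 𝟙 (full? j λs ×-dec length λs ℕ.<? b)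

module MSeries (N : ℕ) where
  open Identities N

  Q-∷ : ∀ j b λs → Q j (suc b) (suc j ∷ λs) ≡ Q j b λs
  Q-∷ j b λs = 𝟙-cong (full? j (suc j ∷ λs) ×-dec _) (full? j λs ×-dec _)
    (λ { (full , s≤s <b) → (λ i<j 1≤i → ∈-tail i<j (full i<j 1≤i)) , <b })
    (λ (full , <b) → (λ i<j 1≤i → there (full i<j 1≤i)) , s≤s <b)

  Q-suc-∷ : ∀ j b λs → Q (suc j) (suc b) (suc j ∷ λs) ≡ Q j b λs
  Q-suc-∷ j b λs = trans (𝟙-cong (full? (suc j) (suc j ∷ λs) ×-dec _) (full? j (suc j ∷ λs) ×-dec _)
    (λ (full , <b) → (λ i<j → full (ℕ.m≤n⇒m≤1+n i<j)) , <b)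
    (λ (full , <b) → (λ i<j 1≤i → add full i<j 1≤i) , <b)) (Q-∷ j b λs)
    where
    add : Full j (suc j ∷ λs) → Full (suc j) (suc j ∷ λs)
    add full {i} (s≤s i≤) 1≤i with i ℕ.≟ suc j
    ... | yes refl = here refl
    ... | no i≢    = full (ℕ.≤∧≢⇒< i≤ i≢) 1≤i

  Q-zero : ∀ j λs → Q j 0 λs ≡ 0ℤ
  Q-zero j λs = 𝟙-no (full? j λs ×-dec length λs ℕ.<? 0) λ ()

  -- Containing j + 1 as a part bounded by j + 1 means beginning with it. After its removal j + 1
  -- may or may not occur again, hence `Q j` with the bound still `suc j`.
  T-Q-∷ : ∀ j b → T (suc j) (Q (suc j) (suc b)) ≈ x^ suc j ⊗ T (suc j) (Q j b)
  T-Q-∷ j b = begin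
    T (suc j) (Q (suc j) (suc b))
      ≈⟨ T-peel-≈ j _ ⟩
    T j (Q (suc j) (suc b)) ⊕ x^ suc j ⊗ T (suc j) (Q (suc j) (suc b) ∘ (suc j ∷_))
      ≈⟨ ⊕-cong (T-𝟘 j λ λs _ ≤j → 𝟙-no (full? (suc j) λs ×-dec _) λ (full , _) →
                   ℕ.1+n≰n (All.lookup ≤j (full ℕ.≤-refl (s≤s z≤n))))
                (⊗-congˡ (T-cong-≈ (suc j) λ λs _ _ → Q-suc-∷ j b λs)) ⟩
    𝟘 ⊕ x^ suc j ⊗ T (suc j) (Q j b)
      ≈⟨ ⊕-identityˡ-≈ _ ⟩
    x^ suc j ⊗ T (suc j) (Q j b) ∎

  T-Q-split : ∀ j b → T (suc j) (Q j b) ≈ T j (Q j b) ⊕ T (suc j) (Q (suc j) b)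
  T-Q-split j zero = begin
    T (suc j) (Q j 0)                           ≈⟨ T-𝟘 (suc j) (λ λs _ _ → Q-zero j λs) ⟩
    𝟘                                           ≈⟨ ⊕-identityˡ-≈ 𝟘 ⟨
    𝟘 ⊕ 𝟘                                       ≈⟨ ⊕-cong (T-𝟘 j λ λs _ _ → Q-zero j λs) (T-𝟘 (suc j) λ λs _ _ → Q-zero (suc j) λs) ⟨
    T j (Q j 0) ⊕ T (suc j) (Q (suc j) 0)       ∎
  T-Q-split j (suc b) = begin
    T (suc j) (Q j (suc b))
      ≈⟨ T-peel-≈ j _ ⟩
    T j (Q j (suc b)) ⊕ x^ suc j ⊗ T (suc j) (Q j (suc b) ∘ (suc j ∷_))
      ≈⟨ ⊕-congˡ (⊗-congˡ (T-cong-≈ (suc j) λ λs _ _ → Q-∷ j b λs)) ⟩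
    T j (Q j (suc b)) ⊕ x^ suc j ⊗ T (suc j) (Q j b)
      ≈⟨ ⊕-congˡ (T-Q-∷ j b) ⟨
    T j (Q j (suc b)) ⊕ T (suc j) (Q (suc j) (suc b)) ∎

  T-Q : ∀ j b → T j (Q j b) ≈ B j b
  T-Q zero    zero    = T-𝟘 0 λ λs _ _ → Q-zero 0 λs
  T-Q zero    (suc b) = exact (λ n → trans (T-zero (Q 0 (suc b)) n) (cong (λ c → const c n)
    (𝟙-yes (full? 0 [] ×-dec 0 ℕ.<? suc b) ((λ i<1 1≤i → contradiction i<1 (ℕ.≤⇒≯ 1≤i)) , s≤s z≤n))))
  T-Q (suc j) zero    = T-𝟘 (suc j) λ λs _ _ → Q-zero (suc j) λs
  T-Q (suc j) (suc b) = begin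
    T (suc j) (Q (suc j) (suc b))                           ≈⟨ T-Q-∷ j b ⟩
    x^ suc j ⊗ T (suc j) (Q j b)                            ≈⟨ ⊗-congˡ (T-Q-split j b) ⟩
    x^ suc j ⊗ (T j (Q j b) ⊕ T (suc j) (Q (suc j) b))      ≈⟨ ⊗-congˡ (⊕-cong (T-Q j b) (T-Q (suc j) b)) ⟩
    x^ suc j ⊗ (B j b ⊕ B (suc j) b)                        ∎

  M≈ : ∀ j → (λ n → + M (suc j) n) ≈ Mˢ j
  M≈ j = begin
    (λ n → + M k n)           ≈⟨ mk (λ {n} n≤N → trans (count-∑ _ (partitions n)) (T-partitions (F 0) n≤N)) ⟩
    T N (F 0)                 ≈⟨ T-large-parts k F F-large ⟩
    E k (λ b → T k (F b)) 0   ≈⟨ E-cong k T-F 0 ⟩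
    E k (B j) 0               ∎
    where
    k : ℕ
    k = suc j

    -- `b` stands for the parts > k already removed, in the form that `T-large-parts` asks for.
    F : ℕ → List ℕ → ℤ
    F b λs = 𝟙 (leastMissing? k λs ×-dec count (ℕ._<? k) λs ℕ.<? b ℕ.+ count (k ℕ.<?_) λs)

    F-large : ∀ {p} b λs → k ℕ.< p → F b (p ∷ λs) ≡ F (suc b) λs
    F-large {p} b λs k<p
      rewrite count-reject (ℕ._<? k) λs (ℕ.<-asym k<p) | count-accept (k ℕ.<?_) λs k<p | ℕ.+-suc b (count (k ℕ.<?_) λs) =
      𝟙-cong (leastMissing? k (p ∷ λs) ×-dec _) (leastMissing? k λs ×-dec _)
        (λ ((k∉ , full) , <b) → ((λ k∈ → k∉ (there k∈)) , (λ i<k 1≤i → ∈-tail (ℕ.<-trans i<k k<p) (full i<k 1≤i))) , <b)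
        (λ ((k∉ , full) , <b) → ((λ { (here refl) → ℕ.<-irrefl refl k<p ; (there k∈) → k∉ k∈ })
                                , (λ i<k 1≤i → there (full i<k 1≤i))) , <b)

    F-small : ∀ b λs → All (_≤ j) λs → F b λs ≡ Q j b λs
    F-small b λs ≤j
      rewrite count-all (ℕ._<? k) (All.map s≤s ≤j)
            | count-none (k ℕ.<?_) {λs} (All.map (λ p≤j k<p → ℕ.1+n≰n (ℕ.≤-trans k<p (ℕ.m≤n⇒m≤1+n p≤j))) ≤j)
            | ℕ.+-identityʳ b =
      𝟙-cong (leastMissing? k λs ×-dec _) (full? j λs ×-dec _)
        (λ ((_ , full) , <b) → full , <b)
        (λ (full , <b) → ((λ k∈ → ℕ.1+n≰n (All.lookup ≤j k∈)) , full) , <b)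

    T-F : ∀ b → T k (F b) ≈ B j b
    T-F b = begin
      T k (F b)                                    ≈⟨ T-peel-≈ j (F b) ⟩
      -- The weight excludes the part k, so the bound on the parts drops from k to j.
      T j (F b) ⊕ x^ k ⊗ T k (F b ∘ (k ∷_))        ≈⟨ ⊕-cong (T-cong-≈ j λ λs _ ≤j → F-small b λs ≤j)
                                                        (⊗-congˡ (T-𝟘 k λ λs _ _ → 𝟙-no (leastMissing? k (k ∷ λs) ×-dec _) λ ((k∉ , _) , _) → k∉ (here refl))) ⟩
      T j (Q j b) ⊕ x^ k ⊗ 𝟘                       ≈⟨ solve 2 (λ t x → t :+ x :* con 0ℤ := t) ≈-refl (T j (Q j b)) (x^ k) ⟩
      T j (Q j b)                                  ≈⟨ T-Q j b ⟩
      B j b                                        ∎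

-- Partitions by crank

0≤⊖⇒≤ : ∀ {m n} → 0ℤ ℤ.≤ m ⊖ n → n ≤ m
0≤⊖⇒≤ {m} {n} p with n ℕ.≤? m
... | yes n≤m = n≤m
... | no n≰m  = contradiction
  (ℤ.<-≤-trans (subst (m ⊖ n ℤ.<_) (ℤ.n⊖n≡0 n) (ℤ.⊖-monoˡ-< n (ℕ.≰⇒> n≰m))) p) (ℤ.<-irrefl refl)

≤⇒0≤⊖ : ∀ {m n} → n ≤ m → 0ℤ ℤ.≤ m ⊖ n
≤⇒0≤⊖ {m} {n} n≤m = subst (ℤ._≤ m ⊖ n) (ℤ.n⊖n≡0 n) (ℤ.⊖-monoˡ-≤ n n≤m)

⊖≡0⇒≡ : ∀ {m n} → m ⊖ n ≡ 0ℤ → n ≡ m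
⊖≡0⇒≡ {m} {n} eq = sym (ℤ.+-injective (ℤ.i-j≡0⇒i≡j (+ m) (+ n) (trans (ℤ.[+m]-[+n]≡m⊖n m n) eq)))

𝟙-*-cong : ∀ {p} {P : Set p} (P? : Dec P) {a b} → (P → a ≡ b) → 𝟙 P? * a ≡ 𝟙 P? * b
𝟙-*-cong (yes p) eq = cong (1ℤ *_) (eq p)
𝟙-*-cong (no _)  _  = refl

ones : List ℕ → ℕ
ones = multiplicity 1

crank-ones≡0 : ∀ λs → ones λs ≡ 0 → crank λs ≡ + maxPart λs
crank-ones≡0 λs eq with multiplicity 1 λs | eq
... | .0 | refl = refl

crank-ones≡suc : ∀ {v} λs → ones λs ≡ suc v → crank λs ≡ count (suc v ℕ.<?_) λs ⊖ suc v
crank-ones≡suc λs eq with multiplicity 1 λs | eq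
... | .(suc _) | refl = refl

ones≤ : ∀ n {λs} → λs ∈ partitions n → ones λs ≤ n
ones≤ n {λs} λs∈ with proj₁ (∈-partitions⁻ n λs∈)
... | 1≤ , refl = ℕ.≤-trans (length-filter (ℕ._≟ 1) λs) (length≤sum 1≤)
  where
  length≤sum : ∀ {λs} → All (1 ≤_) λs → length λs ≤ sum λs
  length≤sum []       = z≤n
  length≤sum (p ∷ ps) = ℕ.+-mono-≤ p (length≤sum ps)

C₁-count : ∀ n → C 1F n ≡ + count (λ λs → 0ℤ ℤ.≤? crank λs) (partitions n)
C₁-count 0             = refl
C₁-count 1             = refl
C₁-count (suc (suc n)) = refl

-- The only partition of 1 has crank -1, so the count at 1 is 0 and the convention -1 enters as the
-- correction -x.
C₂-count : ∀ n → C 2F n ≡ + count (λ λs → crank λs ℤ.≟ 0ℤ) (partitions n) + - (x^ 1) n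
C₂-count 0             = refl
C₂-count 1             = refl
C₂-count (suc (suc n)) = sym (ℤ.+-identityʳ c)
  where
  c : ℤ
  c = + count (λ λs → crank λs ℤ.≟ 0ℤ) (partitions (suc (suc n)))

-- At 1 the conventions satisfy 1 = 0 - (-1); elsewhere a nonnegative crank is either positive or
-- zero.
C₀-C₁-C₂ : ∀ n → C 0F n ≡ C 1F n + - C 2F n
C₀-C₁-C₂ 0             = refl
C₀-C₁-C₂ 1             = refl
C₀-C₁-C₂ (suc (suc n)) = begin
  + count pos? λss                      ≡⟨ ℤ-Solver.solve 2 (λ a b → a := (a :+ b) :+ :- b) refl (+ count pos? λss) (+ count zero? λss) ⟩
  (+ count pos? λss + + count zero? λss) + - + count zero? λss ≡⟨ cong (_+ - + count zero? λss) (begin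
    + count pos? λss + + count zero? λss  ≡⟨ cong₂ _+_ (count-∑ pos? λss) (count-∑ zero? λss) ⟩
    ∑ (𝟙 ∘ pos?) λss + ∑ (𝟙 ∘ zero?) λss  ≡⟨ ∑-+ (𝟙 ∘ pos?) (𝟙 ∘ zero?) λss ⟨
    ∑ (λ λs → 𝟙 (pos? λs) + 𝟙 (zero? λs)) λss ≡⟨ ∑-cong λss (λ {λs} _ → split (crank λs)) ⟩
    ∑ (𝟙 ∘ nonneg?) λss                   ≡⟨ count-∑ nonneg? λss ⟨
    + count nonneg? λss                   ∎) ⟩
  + count nonneg? λss + - + count zero? λss ∎
  where
  open ≡-Reasoning
  open ℤ-Solver using (_:+_; :-_; _:=_)
  λss = partitions (suc (suc n))
  pos?    = λ λs → 0ℤ ℤ.<? crank λs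
  nonneg? = λ λs → 0ℤ ℤ.≤? crank λs
  zero?   = λ λs → crank λs ℤ.≟ 0ℤ

  split : ∀ z → 𝟙 (0ℤ ℤ.<? z) + 𝟙 (z ℤ.≟ 0ℤ) ≡ 𝟙 (0ℤ ℤ.≤? z)
  split z with ℤ.<-cmp 0ℤ z
  ... | tri< 0<z 0≢z _ = trans (cong₂ _+_ (𝟙-yes (0ℤ ℤ.<? z) 0<z) (𝟙-no (z ℤ.≟ 0ℤ) (0≢z ∘ sym))) (sym (𝟙-yes (0ℤ ℤ.≤? z) (ℤ.<⇒≤ 0<z)))
  ... | tri≈ _ refl _  = refl
  ... | tri> 0≮z 0≢z z<0 = trans (cong₂ _+_ (𝟙-no (0ℤ ℤ.<? z) 0≮z) (𝟙-no (z ℤ.≟ 0ℤ) (0≢z ∘ sym))) (sym (𝟙-no (0ℤ ℤ.≤? z) (ℤ.<⇒≱ z<0)))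

module CSeries (N : ℕ) where
  open Identities N

  T-const : ∀ K f c → T K (λ λs → f λs * c) ≈ const c ⊗ T K f
  T-const K f c = exact λ n →
    trans (T-at K _ n) (trans (∑-*ʳ c f (𝒫 K n)) (trans (ℤ.*-comm (∑ f (𝒫 K n)) c)
      (trans (cong (c *_) (sym (T-at K f n))) (sym (const-⊗ c (T K f) n)))))

  T-by : (s : List ℕ → ℕ) → (∀ n {λs} → λs ∈ partitions n → s λs ≤ n) → ∀ f →
         T N f ≈ Σ< (suc N) λ w → T N λ λs → 𝟙 (s λs ℕ.≟ w) * f λs
  T-by s s≤ f = mk λ {i} i≤N → trans (sym (T-partitions f i≤N)) (trans
    (∑-by s (suc N) f (partitions i) (All.tabulate λ λs∈ → s≤s (ℕ.≤-trans (s≤ i λs∈) i≤N)))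
    (trans (∑<-cong (suc N) λ w _ → T-partitions (λ λs → 𝟙 (s λs ℕ.≟ w) * f λs) i≤N) (sym (Σ<-at (suc N) _ i))))

  -- `V` cancels the factor 1/(1-x) of `H (suc K)` that belongs to the part 1, and x^w takes its
  -- place.
  T-ones : ∀ w K → T (suc K) (λ λs → 𝟙 (ones λs ℕ.≟ w)) ≈ x^ w ⊗ (V ⊗ H (suc K))
  T-ones w (suc K) = unique-solution (suc K)
    (≈-trans (T-peel-≈ (suc K) _) (⊕-cong (T-ones w K) (⊗-congˡ (T-cong-≈ (suc (suc K)) λ λs _ _ →
      cong (λ m → 𝟙 (m ℕ.≟ w)) (count-reject (ℕ._≟ 1) {suc (suc K)} λs λ ())))))
    (begin
      x^ w ⊗ (V ⊗ H (suc (suc K)))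
        ≈⟨ ⊗-congˡ (⊗-congˡ (H-suc (suc K))) ⟩
      x^ w ⊗ (V ⊗ (H (suc K) ⊕ x^ suc (suc K) ⊗ H (suc (suc K))))
        ≈⟨ solve 5 (λ a v h x k → a :* (v :* (h :+ x :* k)) := a :* (v :* h) :+ x :* (a :* (v :* k))) ≈-refl
             (x^ w) V (H (suc K)) (x^ suc (suc K)) (H (suc (suc K))) ⟩
      x^ w ⊗ (V ⊗ H (suc K)) ⊕ x^ suc (suc K) ⊗ (x^ w ⊗ (V ⊗ H (suc (suc K)))) ∎)
  T-ones w zero = ≈-trans (base w) (≈-trans (≈-sym (⊗-identityʳ-≈ (x^ w))) (⊗-congˡ (≈-sym V⊗H₁)))
    where
    base : ∀ w → T 1 (λ λs → 𝟙 (ones λs ℕ.≟ w)) ≈ x^ w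
    base zero = begin
      T 1 (λ λs → 𝟙 (ones λs ℕ.≟ 0))
        ≈⟨ T-peel-≈ 0 _ ⟩
      T 0 (λ λs → 𝟙 (ones λs ℕ.≟ 0)) ⊕ x^ 1 ⊗ T 1 (λ λs → 𝟙 (ones (1 ∷ λs) ℕ.≟ 0))
        ≈⟨ ⊕-cong (exact (T-zero _)) (⊗-congˡ (T-𝟘 1 λ λs _ _ → 𝟙-no (ones (1 ∷ λs) ℕ.≟ 0) λ ())) ⟩
      𝟏 ⊕ x^ 1 ⊗ 𝟘
        ≈⟨ solve 1 (λ x → con 1ℤ :+ x :* con 0ℤ := con 1ℤ) ≈-refl (x^ 1) ⟩
      𝟏 ∎
    base (suc w) = begin
      T 1 (λ λs → 𝟙 (ones λs ℕ.≟ suc w))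
        ≈⟨ T-peel-≈ 0 _ ⟩
      T 0 (λ λs → 𝟙 (ones λs ℕ.≟ suc w)) ⊕ x^ 1 ⊗ T 1 (λ λs → 𝟙 (ones (1 ∷ λs) ℕ.≟ suc w))
        ≈⟨ ⊕-cong (exact (T-zero _)) (⊗-congˡ (T-cong-≈ 1 λ λs _ _ →
             𝟙-cong (ones (1 ∷ λs) ℕ.≟ suc w) (ones λs ℕ.≟ w) ℕ.suc-injective (cong suc))) ⟩
      𝟘 ⊕ x^ 1 ⊗ T 1 (λ λs → 𝟙 (ones λs ℕ.≟ w))
        ≈⟨ ≈-trans (⊕-identityˡ-≈ _) (⊗-congˡ (base w)) ⟩
      x^ 1 ⊗ x^ w
        ≈⟨ x^-+-≈ 1 w ⟨
      x^ suc w ∎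

  T-no-ones : T N (λ λs → 𝟙 (ones λs ℕ.≟ 0)) ≈ V ⊗ P
  T-no-ones = begin
    -- `T-ones` is stated for a positive bound, while N may be 0.
    T N f                  ≈⟨ T-stable f 1 ⟨
    T (N ℕ.+ 1) f          ≈⟨ ≈-reflexive (cong (λ K → T K f) (ℕ.+-comm N 1)) ⟩
    T (suc N) f            ≈⟨ T-ones 0 N ⟩
    𝟏 ⊗ (V ⊗ H (suc N))    ≈⟨ ≈-trans (⊗-identityˡ-≈ _) (⊗-congˡ H-≈P) ⟩
    V ⊗ P                  ∎
    where
    f : List ℕ → ℤ
    f λs = 𝟙 (ones λs ℕ.≟ 0)

  -- With w ≥ 1 ones the crank is b - w for b parts > w, so a condition on its sign is a condition
  -- `R?` on b: w ≤ b for C₁ and w = b for C₂.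
  T-ones-large : ∀ v {R : ℕ → Set} (R? : Decidable R) → let w = suc v in
    T N (λ λs → 𝟙 (ones λs ℕ.≟ w) * 𝟙 (R? (count (w ℕ.<?_) λs))) ≈ V ⊗ Σ< (suc N) λ b → ι (R? b) ⊗ G w b
  T-ones-large v R? = begin
    T N (F 0)
      ≈⟨ T-large-parts w F F-large ⟩
    E w (λ b → T w (F b)) 0
      ≈⟨ E-cong w (λ b → ≈-trans (T-cong-≈ w λ λs _ ≤w → cong (λ m → 𝟙 (ones λs ℕ.≟ w) * 𝟙 (R? m)) (F-small b ≤w))
           (≈-trans (T-const w _ (𝟙 (R? b))) (⊗-congˡ (T-ones w v)))) 0 ⟩
    E w (λ b → ι (R? b) ⊗ (x^ w ⊗ (V ⊗ H w))) 0
      ≈⟨ Σ<-cong (suc N) (λ b _ → solve 6 (λ a h r x v k → a :* h :* (r :* (x :* (v :* k))) := v :* (r :* ((x :* k) :* (a :* h)))) ≈-refl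
           (x^ (suc w ℕ.* b)) (H b) (ι (R? b)) (x^ w) V (H w)) ⟩
    Σ< (suc N) (λ b → V ⊗ (ι (R? b) ⊗ G w b))
      ≈⟨ Σ<-⊗ˡ (suc N) V _ ⟩
    V ⊗ Σ< (suc N) (λ b → ι (R? b) ⊗ G w b) ∎
    where
    w : ℕ
    w = suc v

    F : ℕ → List ℕ → ℤ
    F b λs = 𝟙 (ones λs ℕ.≟ w) * 𝟙 (R? (b ℕ.+ count (w ℕ.<?_) λs))

    F-large : ∀ {p} b λs → w ℕ.< p → F b (p ∷ λs) ≡ F (suc b) λs
    F-large {suc zero}    b λs (s≤s ())
    F-large {suc (suc p)} b λs w<p = cong₂ (λ m n → 𝟙 (m ℕ.≟ w) * 𝟙 (R? n)) (count-reject (ℕ._≟ 1) {suc (suc p)} λs λ ())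
      (trans (cong (b ℕ.+_) (count-accept (w ℕ.<?_) λs w<p)) (ℕ.+-suc b _))

    F-small : ∀ b {λs} → All (_≤ w) λs → b ℕ.+ count (w ℕ.<?_) λs ≡ b
    F-small b ≤w = trans (cong (b ℕ.+_) (count-none (w ℕ.<?_) (All.map ℕ.≤⇒≯ ≤w))) (ℕ.+-identityʳ b)

  C₁≈ : C 1F ≈ C₁ˢ
  C₁≈ = begin
    C 1F
      ≈⟨ mk (λ {n} n≤N → trans (C₁-count n) (trans (count-∑ _ (partitions n)) (T-partitions f n≤N))) ⟩
    T N f
      ≈⟨ T-by ones ones≤ f ⟩
    Σ< (suc N) (λ w → T N (λ λs → 𝟙 (ones λs ℕ.≟ w) * f λs))
      ≈⟨ Σ<-cong (suc N) (λ w _ → by-ones w) ⟩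
    Σ< (suc N) (λ w → V ⊗ Σ< (suc N) (λ b → ι (w ℕ.≤? b) ⊗ G w b))
      ≈⟨ Σ<-⊗ˡ (suc N) V _ ⟩
    C₁ˢ ∎
    where
    f : List ℕ → ℤ
    f λs = 𝟙 (0ℤ ℤ.≤? crank λs)

    by-ones : ∀ w → T N (λ λs → 𝟙 (ones λs ℕ.≟ w) * f λs) ≈ V ⊗ Σ< (suc N) (λ b → ι (w ℕ.≤? b) ⊗ G w b)
    -- Without ones the crank is the largest part and never negative; accordingly 0 ≤ b admits every
    -- b.
    by-ones zero = begin
      T N (λ λs → 𝟙 (ones λs ℕ.≟ 0) * f λs)
        ≈⟨ T-cong-≈ N (λ λs _ _ → trans
             (𝟙-*-cong (ones λs ℕ.≟ 0) λ eq → 𝟙-yes (0ℤ ℤ.≤? crank λs) (subst (0ℤ ℤ.≤_) (sym (crank-ones≡0 λs eq)) (+≤+ z≤n)))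
             (ℤ.*-identityʳ (𝟙 (ones λs ℕ.≟ 0)))) ⟩
      T N (λ λs → 𝟙 (ones λs ℕ.≟ 0))
        ≈⟨ T-no-ones ⟩
      V ⊗ P
        ≈⟨ ⊗-congˡ (≈-trans (G-row 0) (⊗-identityˡ-≈ P)) ⟨
      V ⊗ Σ< (suc N) (G 0)
        ≈⟨ ⊗-congˡ (Σ<-cong (suc N) λ b _ → ≈-trans (⊗-congʳ (≈-reflexive (cong const (𝟙-yes (0 ℕ.≤? b) z≤n)))) (⊗-identityˡ-≈ (G 0 b))) ⟨
      V ⊗ Σ< (suc N) (λ b → ι (0 ℕ.≤? b) ⊗ G 0 b) ∎
    by-ones (suc v) = ≈-trans
      (T-cong-≈ N λ λs _ _ → 𝟙-*-cong (ones λs ℕ.≟ suc v) λ eq →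
        𝟙-cong (0ℤ ℤ.≤? crank λs) (suc v ℕ.≤? count (suc v ℕ.<?_) λs)
          (λ p → 0≤⊖⇒≤ (subst (0ℤ ℤ.≤_) (crank-ones≡suc λs eq) p))
          (λ p → subst (0ℤ ℤ.≤_) (sym (crank-ones≡suc λs eq)) (≤⇒0≤⊖ p)))
      (T-ones-large v (suc v ℕ.≤?_))

  C₂≈ : C 2F ≈ C₂ˢ
  C₂≈ = begin
    C 2F
      ≈⟨ mk (λ {n} n≤N → trans (C₂-count n) (trans (cong₂ _+_
           (trans (count-∑ _ (partitions n)) (T-partitions f n≤N)) (sym (⊝-at (x^ 1) n))) (sym (⊕-at (T N f) (⊝ x^ 1) n)))) ⟩
    T N f ⊕ ⊝ x^ 1
      ≈⟨ ⊕-congʳ (≈-trans (T-by ones ones≤ f) (Σ<-suc N _)) ⟩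
    T N (λ λs → 𝟙 (ones λs ℕ.≟ 0) * f λs) ⊕ Σ< N (λ v → T N (λ λs → 𝟙 (ones λs ℕ.≟ suc v) * f λs)) ⊕ ⊝ x^ 1
      ≈⟨ ⊕-congʳ (⊕-cong (no-ones N) (Σ<-cong N some-ones)) ⟩
    𝟏 ⊕ Σ< N (λ v → V ⊗ G (suc v) (suc v)) ⊕ ⊝ x^ 1
      -- The summand w = 0 of `C₂ˢ` is 1 - x: the 1 comes from the empty partition, the -x from the
      -- convention at 1.
      ≈⟨ solve 2 (λ s x → (con 1ℤ :+ s) :- x := (con 1ℤ :- x) :* ((con 1ℤ :* con 1ℤ) :* (con 1ℤ :* con 1ℤ)) :+ s) ≈-refl (Σ< N (λ v → V ⊗ G (suc v) (suc v))) (x^ 1) ⟩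
    V ⊗ ((𝟏 ⊗ 𝟏) ⊗ (𝟏 ⊗ 𝟏)) ⊕ Σ< N (λ v → V ⊗ G (suc v) (suc v))
      ≈⟨ ⊕-congʳ (⊗-congˡ (⊗-cong (⊗-congˡ H-zero) (⊗-congˡ H-zero))) ⟨
    V ⊗ G 0 0 ⊕ Σ< N (λ v → V ⊗ G (suc v) (suc v))
      ≈⟨ Σ<-suc N (λ w → V ⊗ G w w) ⟨
    Σ< (suc N) (λ w → V ⊗ G w w)
      ≈⟨ Σ<-⊗ˡ (suc N) V (λ w → G w w) ⟩
    C₂ˢ ∎
    where
    f : List ℕ → ℤ
    f λs = 𝟙 (crank λs ℤ.≟ 0ℤ)

    f₀ : List ℕ → ℤ
    f₀ λs = 𝟙 (ones λs ℕ.≟ 0) * f λs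

    f₀-∷ : ∀ p λs → f₀ (suc p ∷ λs) ≡ 0ℤ
    f₀-∷ p λs = trans (𝟙-*-cong (ones (suc p ∷ λs) ℕ.≟ 0) λ eq → 𝟙-no (crank (suc p ∷ λs) ℤ.≟ 0ℤ) λ crank≡0 →
      ℕ.1+n≰n (ℕ.≤-trans (ℕ.≤-trans (s≤s z≤n) (v≤max⁺ {v = suc p} 0 (suc p ∷ λs) (inj₂ (here ℕ.≤-refl))))
        (ℕ.≤-reflexive (ℤ.+-injective (trans (sym (crank-ones≡0 (suc p ∷ λs) eq)) crank≡0)))))
      (ℤ.*-zeroʳ (𝟙 (ones (suc p ∷ λs) ℕ.≟ 0)))

    no-ones : ∀ K → T K f₀ ≈ 𝟏
    no-ones zero    = exact (T-zero f₀)
    no-ones (suc K) = begin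
      T (suc K) f₀                                     ≈⟨ T-peel-≈ K f₀ ⟩
      T K f₀ ⊕ x^ suc K ⊗ T (suc K) (f₀ ∘ (suc K ∷_))  ≈⟨ ⊕-cong (no-ones K) (⊗-congˡ (T-𝟘 (suc K) λ λs _ _ → f₀-∷ K λs)) ⟩
      𝟏 ⊕ x^ suc K ⊗ 𝟘                                 ≈⟨ solve 1 (λ x → con 1ℤ :+ x :* con 0ℤ := con 1ℤ) ≈-refl (x^ suc K) ⟩
      𝟏                                                ∎

    some-ones : ∀ v → v ℕ.< N → T N (λ λs → 𝟙 (ones λs ℕ.≟ suc v) * f λs) ≈ V ⊗ G (suc v) (suc v)
    some-ones v v<N = begin
      T N (λ λs → 𝟙 (ones λs ℕ.≟ suc v) * f λs)
        ≈⟨ (T-cong-≈ N λ λs _ _ → 𝟙-*-cong (ones λs ℕ.≟ suc v) λ eq →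
             𝟙-cong (crank λs ℤ.≟ 0ℤ) (suc v ℕ.≟ count (suc v ℕ.<?_) λs)
               (λ p → ⊖≡0⇒≡ (trans (sym (crank-ones≡suc λs eq)) p))
               (λ p → trans (crank-ones≡suc λs eq) (trans (cong (_⊖ suc v) (sym p)) (ℤ.n⊖n≡0 (suc v))))) ⟩
      T N (λ λs → 𝟙 (ones λs ℕ.≟ suc v) * 𝟙 (suc v ℕ.≟ count (suc v ℕ.<?_) λs))
        ≈⟨ T-ones-large v (suc v ℕ.≟_) ⟩
      V ⊗ Σ< (suc N) (λ b → ι (suc v ℕ.≟ b) ⊗ G (suc v) b)
        ≈⟨ ⊗-congˡ (Σ<-δ (s≤s v<N) (G (suc v))) ⟩
      V ⊗ G (suc v) (suc v) ∎

  C₀≈ : C 0F ≈ C₁ˢ ⊕ ⊝ C₂ˢ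
  C₀≈ = ≈-trans (exact λ n → trans (C₀-C₁-C₂ n) (trans (+-congˡ (C 1F n) (sym (⊝-at (C 2F) n))) (sym (⊕-at (C 1F) (⊝ C 2F) n))))
    (⊕-cong C₁≈ (⊝-cong C₂≈))

-- Unimodal compositions

map-unique : ∀ {A B : Set} {f : A → B} {xs} →
             (∀ {x y} → x ∈ xs → y ∈ xs → f x ≡ f y → x ≡ y) → Unique xs → Unique (List.map f xs)
map-unique inj []           = []
map-unique inj (x∉ ∷ xs!) =
  All.map⁺ (All.tabulate λ y∈ eq → All.lookup x∉ y∈ (inj (here refl) (there y∈) eq)) ∷
  map-unique (λ x∈ y∈ → inj (there x∈) (there y∈)) xs!

∑-cartesianProduct : ∀ {A B : Set} (f : A → ℤ) (g : B → ℤ) xs ys →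
                     ∑ (λ (x , y) → f x * g y) (cartesianProduct xs ys) ≡ ∑ f xs * ∑ g ys
∑-cartesianProduct f g []       ys = sym (ℤ.*-zeroˡ (∑ g ys))
∑-cartesianProduct f g (x ∷ xs) ys = begin
  ∑ h (List.map (x ,_) ys ++ cartesianProduct xs ys)           ≡⟨ ∑-++ h (List.map (x ,_) ys) _ ⟩
  ∑ h (List.map (x ,_) ys) + ∑ h (cartesianProduct xs ys)      ≡⟨ cong₂ _+_ (trans (∑-map h (x ,_) ys) (∑-*ˡ (f x) g ys)) (∑-cartesianProduct f g xs ys) ⟩
  f x * ∑ g ys + ∑ f xs * ∑ g ys                               ≡⟨ ℤ.*-distribʳ-+ (∑ g ys) (f x) (∑ f xs) ⟨
  (f x + ∑ f xs) * ∑ g ys                                      ∎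
  where
  open ≡-Reasoning
  h = λ (x , y) → f x * g y

-- Follows the recursion of `_⊗_`, so that `∑-pairs` holds clause by clause.
pairs : ∀ {A B : Set} → (ℕ → List A) → (ℕ → List B) → ℕ → List (A × B)
pairs F G zero    = cartesianProduct (F 0) (G 0)
pairs F G (suc m) = cartesianProduct (F 0) (G (suc m)) ++ pairs (F ∘ suc) G m

∑-pairs : ∀ {A B : Set} (f : A → ℤ) (g : B → ℤ) F G m →
          ∑ (λ (x , y) → f x * g y) (pairs F G m) ≡ ((λ i → ∑ f (F i)) ⊗ (λ j → ∑ g (G j))) m
∑-pairs f g F G zero    = ∑-cartesianProduct f g (F 0) (G 0)
∑-pairs f g F G (suc m) = trans (∑-++ _ (cartesianProduct (F 0) (G (suc m))) _)
  (cong₂ _+_ (∑-cartesianProduct f g (F 0) (G (suc m))) (∑-pairs f g (F ∘ suc) G m))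

∈-pairs⁺ : ∀ {A B : Set} {F : ℕ → List A} {G : ℕ → List B} i j {x y} →
           x ∈ F i → y ∈ G j → (x , y) ∈ pairs F G (i ℕ.+ j)
∈-pairs⁺         zero    zero    x∈ y∈ = ∈-cartesianProduct⁺ x∈ y∈
∈-pairs⁺         zero    (suc j) x∈ y∈ = ∈-++⁺ˡ (∈-cartesianProduct⁺ x∈ y∈)
∈-pairs⁺ {F = F} {G} (suc i) j x∈ y∈ = ∈-++⁺ʳ (cartesianProduct (F 0) (G (suc (i ℕ.+ j)))) (∈-pairs⁺ i j x∈ y∈)

∈-pairs⁻ : ∀ {A B : Set} (F : ℕ → List A) (G : ℕ → List B) m {x y} →
           (x , y) ∈ pairs F G m → ∃[ i ] ∃[ j ] i ℕ.+ j ≡ m × x ∈ F i × y ∈ G j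
∈-pairs⁻ F G zero    xy∈ = let x∈ , y∈ = ∈-cartesianProduct⁻ (F 0) (G 0) xy∈ in 0 , 0 , refl , x∈ , y∈
∈-pairs⁻ F G (suc m) xy∈ with ∈-++⁻ (cartesianProduct (F 0) (G (suc m))) xy∈
... | inj₁ xy∈′ = let x∈ , y∈ = ∈-cartesianProduct⁻ (F 0) (G (suc m)) xy∈′ in 0 , suc m , refl , x∈ , y∈
... | inj₂ xy∈′ = let i , j , eq , x∈ , y∈ = ∈-pairs⁻ (F ∘ suc) G m xy∈′ in suc i , j , cong suc eq , x∈ , y∈

pairs-unique : ∀ {A B : Set} {F : ℕ → List A} {G : ℕ → List B} →
               (∀ {i j x} → x ∈ F i → x ∈ F j → i ≡ j) → (∀ i → Unique (F i)) → (∀ j → Unique (G j)) →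
               ∀ m → Unique (pairs F G m)
pairs-unique disj F! G! zero    = Unique.cartesianProduct⁺ (F! 0) (G! 0)
pairs-unique {F = F} {G} disj F! G! (suc m) = Unique.++⁺ (Unique.cartesianProduct⁺ (F! 0) (G! (suc m)))
  (pairs-unique (λ x∈ x∈′ → ℕ.suc-injective (disj x∈ x∈′)) (F! ∘ suc) G! m)
  λ (xy∈₁ , xy∈₂) → contradiction
    (disj (proj₁ (∈-cartesianProduct⁻ (F 0) (G (suc m)) xy∈₁))
          (let _ , _ , _ , x∈ , _ = ∈-pairs⁻ (F ∘ suc) G m xy∈₂ in x∈))
    λ ()

reverseAcc-Linked : ∀ {A : Set} {R S : A → A → Set} → (∀ {x y} → R x y → S y x) → ∀ {x xs acc} →
                    Linked R (x ∷ xs) → Linked S (x ∷ acc) → Linked S (reverseAcc (x ∷ acc) xs)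
reverseAcc-Linked R⇒S [-]     l = l
reverseAcc-Linked R⇒S (r ∷ k) l = reverseAcc-Linked R⇒S k (R⇒S r ∷ l)

reverse-Linked : ∀ {A : Set} {R S : A → A → Set} → (∀ {x y} → R x y → S y x) → ∀ {xs} →
                 Linked R xs → Linked S (reverse xs)
reverse-Linked R⇒S {[]}     _ = []
reverse-Linked R⇒S {x ∷ xs} l = reverseAcc-Linked R⇒S l [-]

𝒫↑ : ℕ → ℕ → List (List ℕ)
𝒫↑ K n = List.map reverse (𝒫 K n)

IsPartition↑ : ℕ → ℕ → List ℕ → Set
IsPartition↑ K n λs = IsComposition n λs × Linked _≤_ λs × All (_≤ K) λs

reverse-↭ : ∀ (λs : List ℕ) → λs ↭ reverse λs
reverse-↭ = ↭.↭-sym ∘ ↭ₚ.↭-reverse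

∈-𝒫↑⁻ : ∀ K n {λs} → λs ∈ 𝒫↑ K n → IsPartition↑ K n λs
∈-𝒫↑⁻ K n λs∈ with ∈-map⁻ reverse λs∈
... | μs , μs∈ , refl with ∈-𝒫⁻ K n μs∈
...   | (1≤ , eq) , l , ≤K =
  (↭ₚ.All-resp-↭ (reverse-↭ μs) 1≤ , trans (sym (sum-↭ (reverse-↭ μs))) eq) ,
  reverse-Linked (λ p → p) l , ↭ₚ.All-resp-↭ (reverse-↭ μs) ≤K

∈-𝒫↑⁺ : ∀ K n {λs} → IsPartition↑ K n λs → λs ∈ 𝒫↑ K n
∈-𝒫↑⁺ K n {λs} ((1≤ , eq) , l , ≤K) = subst (_∈ 𝒫↑ K n) (reverse-involutive λs) (∈-map⁺ reverse (∈-𝒫⁺ K n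
  ((↭ₚ.All-resp-↭ (reverse-↭ λs) 1≤ , trans (sym (sum-↭ (reverse-↭ λs))) eq) ,
   reverse-Linked (λ p → p) l , ↭ₚ.All-resp-↭ (reverse-↭ λs) ≤K)))

𝒫↑-unique : ∀ K n → Unique (𝒫↑ K n)
𝒫↑-unique K n = Unique.map⁺ reverse-injective (𝒫-unique K n)

-- A unimodal composition with maximal part t + 1, cut before the first such part.
glue : ℕ → List ℕ × List ℕ → List ℕ
glue t (as , bs) = as ++ suc t ∷ bs

glue-injective : ∀ {t} as as′ {bs bs′} → All (_≤ t) as → All (_≤ t) as′ →
                 glue t (as , bs) ≡ glue t (as′ , bs′) → (as , bs) ≡ (as′ , bs′)
glue-injective []       []         _         _         refl = refl
glue-injective []       (_ ∷ _)    _         (≤t ∷ _)  refl = contradiction ≤t ℕ.1+n≰n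
glue-injective (_ ∷ _)  []         (≤t ∷ _)  _         refl = contradiction ≤t ℕ.1+n≰n
glue-injective (a ∷ as) (a′ ∷ as′) (_ ∷ ≤t)  (_ ∷ ≤t′) eq with ∷-injective eq
... | refl , eq′ with glue-injective as as′ ≤t ≤t′ eq′
...   | refl = refl

Unimodal-∷ : ∀ {p q qs} → p ≤ q → Unimodal (q ∷ qs) → Unimodal (p ∷ q ∷ qs)
Unimodal-∷ p≤q (k , up , down) = Fin.suc k , p≤q ∷ up , down

glue-Unimodal : ∀ {t} as {bs} → Linked _≤_ as → All (_≤ t) as → Linked ℕ._≥_ bs → All (_≤ suc t) bs →
                Unimodal (glue t (as , bs))
glue-Unimodal []           _       _         l b≤ = Fin.zero , [-] , Linked-∷ b≤ l
glue-Unimodal (a ∷ [])     _       (a≤ ∷ _)  l b≤ = Unimodal-∷ (ℕ.m≤n⇒m≤1+n a≤) (glue-Unimodal [] [] [] l b≤)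
glue-Unimodal (a ∷ a′ ∷ as) (≤a′ ∷ k) (_ ∷ ≤t) l b≤ = Unimodal-∷ ≤a′ (glue-Unimodal (a′ ∷ as) k ≤t l b≤)

Cut : List ℕ → Set
Cut λs = ∃[ t ] ∃[ as ] ∃[ bs ] λs ≡ glue t (as , bs) × Linked _≤_ as × All (_≤ t) as × Linked ℕ._≥_ bs × All (_≤ suc t) bs

-- The index that witnesses unimodality may belong to any of the maximal parts; the recursion moves
-- the cut to the first one, which makes it unique.
Unimodal⇒Cut : ∀ {λs} → All (1 ≤_) λs → Unimodal λs → Cut λs
Unimodal⇒Cut {p ∷ ps} 1≤ (k , up , down) = go p ps k 1≤ up down
  where
  go : ∀ p ps (k : Fin (suc (length ps))) → All (1 ≤_) (p ∷ ps) →
       Linked _≤_ (take (suc (toℕ k)) (p ∷ ps)) → Linked ℕ._≥_ (drop (toℕ k) (p ∷ ps)) → Cut (p ∷ ps)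
  go (suc t) ps       Fin.zero    _        _          down = t , [] , ps , refl , [] , [] , Linked-tail down , Linked-head down
  go p       (q ∷ qs) (Fin.suc k) (_ ∷ 1≤) (p≤q ∷ up) down with go q qs k 1≤ up down
  -- The tail begins with its maximal part, and p is at most that part: if they are equal the cut
  -- moves to p, otherwise p joins the parts before the cut.
  ... | t , [] , bs , refl , _ , _ , l , b≤ with p ℕ.≟ suc t
  ...   | yes refl = t , [] , suc t ∷ bs , refl , [] , [] , Linked-∷ b≤ l , ℕ.≤-refl ∷ b≤
  ...   | no p≢    = t , p ∷ [] , bs , refl , [-] , ℕ.≤-pred (ℕ.≤∧≢⇒< p≤q p≢) ∷ [] , l , b≤
  go p (q ∷ qs) (Fin.suc k) _ (p≤q ∷ up) down | t , _ ∷ as , bs , refl , k′ , a≤ ∷ as≤ , l , b≤ =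
    t , p ∷ q ∷ as , bs , refl , p≤q ∷ k′ , ℕ.≤-trans p≤q a≤ ∷ a≤ ∷ as≤ , l , b≤

maxPart-glue : ∀ {t as bs} → All (_≤ t) as → All (_≤ suc t) bs → maxPart (glue t (as , bs)) ≡ suc t
maxPart-glue {as = as} a≤ b≤ = max≈v⁺ (∈-++⁺ʳ as (here refl))
  (All.++⁺ (All.map ℕ.m≤n⇒m≤1+n a≤) (ℕ.≤-refl ∷ b≤)) z≤n

sum-glue : ∀ t as bs → sum (glue t (as , bs)) ≡ suc t ℕ.+ (sum as ℕ.+ sum bs)
sum-glue t as bs = trans (sum-++ as (suc t ∷ bs)) (shuffle (sum as) (suc t) (sum bs))
  where
  shuffle : ∀ a t b → a ℕ.+ (t ℕ.+ b) ≡ t ℕ.+ (a ℕ.+ b)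
  shuffle = ℕ-Ring.solve-∀

unimodals : ℕ → List (List ℕ)
unimodals n = filter unimodal? (compositions n)

peak : List ℕ → ℕ
peak = ℕ.pred ∘ maxPart

unimodalsWithPeak : ℕ → ℕ → List (List ℕ)
unimodalsWithPeak t n = filter (λ λs → peak λs ℕ.≟ t) (unimodals n)

∈-unimodals⁻ : ∀ n {λs} → λs ∈ unimodals n → IsComposition n λs × Unimodal λs
∈-unimodals⁻ n λs∈ with ∈-filter⁻ unimodal? {xs = compositions n} λs∈
... | λs∈′ , uni = ∈-compositions⁻ n λs∈′ , uni

unimodalsWithPeak-cut : ∀ t n {λs} → λs ∈ unimodalsWithPeak t n → IsComposition n λs ×
  ∃[ as ] ∃[ bs ] λs ≡ glue t (as , bs) × Linked _≤_ as × All (_≤ t) as × Linked ℕ._≥_ bs × All (_≤ suc t) bs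
unimodalsWithPeak-cut t n λs∈ with ∈-filter⁻ (λ λs → peak λs ℕ.≟ t) {xs = unimodals n} λs∈
... | λs∈′ , eq with ∈-unimodals⁻ n λs∈′
...   | c , uni with Unimodal⇒Cut (proj₁ c) uni
...     | s , as , bs , refl , k , a≤ , l , b≤ with trans (cong ℕ.pred (sym (maxPart-glue {as = as} a≤ b≤))) eq
...       | refl = c , as , bs , refl , k , a≤ , l , b≤

unimodalsWithPeak-unique : ∀ t n → Unique (unimodalsWithPeak t n)
unimodalsWithPeak-unique t n = Unique.filter⁺ _ (Unique.filter⁺ unimodal? (compositions-unique n))

unimodalsWithPeak-< : ∀ t n → n ≤ t → unimodalsWithPeak t n ↭ []
unimodalsWithPeak-< t n n≤t = unique-↭ (unimodalsWithPeak-unique t n) [] empty λ ()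
  where
  empty : ∀ {λs} → λs ∈ unimodalsWithPeak t n → λs ∈ []
  empty λs∈ with unimodalsWithPeak-cut t n λs∈
  ... | (_ , eq) , as , bs , refl , _ = contradiction
    (ℕ.≤-trans (ℕ.m≤m+n (suc t) _) (ℕ.≤-reflexive (trans (sym (sum-glue t as bs)) eq))) (ℕ.≤⇒≯ n≤t)

unimodalsWithPeak-≥ : ∀ t m → unimodalsWithPeak t (suc t ℕ.+ m) ↭ List.map (glue t) (pairs (𝒫↑ t) (𝒫 (suc t)) m)
unimodalsWithPeak-≥ t m = unique-↭ (unimodalsWithPeak-unique t n)
  (map-unique injective (pairs-unique 𝒫↑-disjoint (𝒫↑-unique t) (𝒫-unique (suc t)) m)) to from
  where
  n : ℕ
  n = suc t ℕ.+ m

  𝒫↑-disjoint : ∀ {i j λs} → λs ∈ 𝒫↑ t i → λs ∈ 𝒫↑ t j → i ≡ j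
  𝒫↑-disjoint λs∈ λs∈′ with ∈-𝒫↑⁻ t _ λs∈ | ∈-𝒫↑⁻ t _ λs∈′
  ... | (_ , eq) , _ | (_ , eq′) , _ = trans (sym eq) eq′

  injective : ∀ {x y} → x ∈ pairs (𝒫↑ t) (𝒫 (suc t)) m → y ∈ pairs (𝒫↑ t) (𝒫 (suc t)) m → glue t x ≡ glue t y → x ≡ y
  injective {as , _} {as′ , _} x∈ y∈ with ∈-pairs⁻ (𝒫↑ t) (𝒫 (suc t)) m x∈ | ∈-pairs⁻ (𝒫↑ t) (𝒫 (suc t)) m y∈
  ... | i , _ , _ , as∈ , _ | i′ , _ , _ , as∈′ , _ with ∈-𝒫↑⁻ t i as∈ | ∈-𝒫↑⁻ t i′ as∈′
  ...   | _ , _ , a≤ | _ , _ , a≤′ = glue-injective as as′ a≤ a≤′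

  to : ∀ {λs} → λs ∈ unimodalsWithPeak t n → λs ∈ List.map (glue t) (pairs (𝒫↑ t) (𝒫 (suc t)) m)
  to λs∈ with unimodalsWithPeak-cut t n λs∈
  ... | (1≤ , eq) , as , bs , refl , k , a≤ , l , b≤ with All.++⁻ as 1≤
  ...   | 1≤as , _ ∷ 1≤bs = ∈-map⁺ (glue t) (subst (λ m → (as , bs) ∈ pairs (𝒫↑ t) (𝒫 (suc t)) m)
    (ℕ.+-cancelˡ-≡ (suc t) _ _ (trans (sym (sum-glue t as bs)) eq))
    (∈-pairs⁺ (sum as) (sum bs) (∈-𝒫↑⁺ t (sum as) ((1≤as , refl) , k , a≤)) (∈-𝒫⁺ (suc t) (sum bs) ((1≤bs , refl) , l , b≤))))

  from : ∀ {λs} → λs ∈ List.map (glue t) (pairs (𝒫↑ t) (𝒫 (suc t)) m) → λs ∈ unimodalsWithPeak t n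
  from λs∈ with ∈-map⁻ (glue t) λs∈
  ... | (as , bs) , ab∈ , refl with ∈-pairs⁻ (𝒫↑ t) (𝒫 (suc t)) m ab∈
  ...   | i , j , eq , as∈ , bs∈ with ∈-𝒫↑⁻ t i as∈ | ∈-𝒫⁻ (suc t) j bs∈
  ...     | (1≤as , refl) , k , a≤ | (1≤bs , refl) , l , b≤ =
    ∈-filter⁺ _ (∈-filter⁺ unimodal?
      (∈-compositions⁺ n (All.++⁺ 1≤as (s≤s z≤n ∷ 1≤bs) , trans (sum-glue t as bs) (cong (suc t ℕ.+_) eq)))
      (glue-Unimodal as k a≤ l b≤)) (cong ℕ.pred (maxPart-glue {as = as} a≤ b≤))

-- The weight may depend on the peak and on the parts after the cut only, so the parts before it
-- contribute `H t`. The bound `D` on the degree is free because `u-suc` uses a degree larger than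
-- its `n`.
∑-unimodals : (f : List ℕ → ℤ) (g : ℕ → List ℕ → ℤ) →
              (∀ t as bs → All (_≤ t) as → All (_≤ suc t) bs → f (glue t (as , bs)) ≡ g t bs) →
              ∀ {n D} → n ≤ D → ∑ f (unimodals n) ≡ Σ< (suc D) (λ t → x^ suc t ⊗ (H t ⊗ T (suc t) (g t))) n
∑-unimodals f g f≡g {n} {D} n≤D = begin
  ∑ f (unimodals n)
    ≡⟨ ∑-by peak (suc D) f (unimodals n) (All.tabulate λ λs∈ → s≤s (ℕ.≤-trans (peak≤ (∈-unimodals⁻ n λs∈)) n≤D)) ⟩
  ∑< (suc D) (λ t → ∑ (λ λs → 𝟙 (peak λs ℕ.≟ t) * f λs) (unimodals n))
    ≡⟨ ∑<-cong (suc D) (λ t _ → trans (sym (∑-filter (λ λs → peak λs ℕ.≟ t) f (unimodals n))) (by-peak t n)) ⟩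
  ∑< (suc D) (λ t → (x^ suc t ⊗ (H t ⊗ T (suc t) (g t))) n)
    ≡⟨ Σ<-at (suc D) _ n ⟨
  Σ< (suc D) (λ t → x^ suc t ⊗ (H t ⊗ T (suc t) (g t))) n ∎
  where
  open ≡-Reasoning

  peak≤ : ∀ {λs} → IsComposition n λs × Unimodal λs → peak λs ≤ n
  peak≤ (c , _) = ℕ.≤-trans ℕ.pred[n]≤n (max≤v⁺ z≤n (IsComposition-parts≤ c))

  by-peak : ∀ t n → ∑ f (unimodalsWithPeak t n) ≡ (x^ suc t ⊗ (H t ⊗ T (suc t) (g t))) n
  by-peak t n with ℕ.≤-<-connex n t
  ... | inj₁ n≤t = trans (∑-↭ f (unimodalsWithPeak-< t n n≤t)) (sym (x^-⊗-< (suc t) _ n (s≤s n≤t)))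
  ... | inj₂ t<n with ℕ.m≤n⇒∃[o]m+o≡n t<n
  ...   | m , refl = begin
    ∑ f (unimodalsWithPeak t (suc t ℕ.+ m))                             ≡⟨ ∑-↭ f (unimodalsWithPeak-≥ t m) ⟩
    ∑ f (List.map (glue t) (pairs (𝒫↑ t) (𝒫 (suc t)) m))                ≡⟨ ∑-map f (glue t) (pairs (𝒫↑ t) (𝒫 (suc t)) m) ⟩
    ∑ (f ∘ glue t) (pairs (𝒫↑ t) (𝒫 (suc t)) m)                         ≡⟨ ∑-cong (pairs (𝒫↑ t) (𝒫 (suc t)) m) separate ⟩
    ∑ (λ (as , bs) → 1ℤ * g t bs) (pairs (𝒫↑ t) (𝒫 (suc t)) m)          ≡⟨ ∑-pairs (λ _ → 1ℤ) (g t) (𝒫↑ t) (𝒫 (suc t)) m ⟩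
    ((λ i → ∑ (λ _ → 1ℤ) (𝒫↑ t i)) ⊗ (λ j → ∑ (g t) (𝒫 (suc t) j))) m  ≡⟨ ⊗-cong-≤ m (λ i _ → trans (∑-map (λ _ → 1ℤ) reverse (𝒫 t i)) (sym (T-at t (λ _ → 1ℤ) i))) (λ j _ → sym (T-at (suc t) (g t) j)) ⟩
    (H t ⊗ T (suc t) (g t)) m                                           ≡⟨ x^-⊗-+ (suc t) _ m ⟨
    (x^ suc t ⊗ (H t ⊗ T (suc t) (g t))) (suc t ℕ.+ m)                  ∎
    where
    separate : ∀ {ab} → ab ∈ pairs (𝒫↑ t) (𝒫 (suc t)) m → f (glue t ab) ≡ 1ℤ * g t (proj₂ ab)
    separate {as , bs} ab∈ with ∈-pairs⁻ (𝒫↑ t) (𝒫 (suc t)) m ab∈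
    ... | i , j , _ , as∈ , bs∈ with ∈-𝒫↑⁻ t i as∈ | ∈-𝒫⁻ (suc t) j bs∈
    ...   | _ , _ , a≤ | _ , _ , b≤ = trans (f≡g t as bs a≤ b≤) (sym (ℤ.*-identityˡ (g t bs)))

module _ (N : ℕ) where
  open Identities N

  T-multiplicity : ∀ t m → T (suc t) (λ λs → 𝟙 (multiplicity (suc t) λs ℕ.≟ m)) ≈ x^ (suc t ℕ.* m) ⊗ H t
  T-multiplicity t zero = begin
    T (suc t) f
      ≈⟨ T-peel-≈ t f ⟩
    T t f ⊕ x^ suc t ⊗ T (suc t) (f ∘ (suc t ∷_))
      ≈⟨ ⊕-cong (T-cong-≈ t λ λs _ ≤t → 𝟙-yes (multiplicity (suc t) λs ℕ.≟ 0) (count-none (ℕ._≟ suc t) (All.map (λ { p≤t refl → ℕ.1+n≰n p≤t }) ≤t)))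
           (⊗-congˡ (T-𝟘 (suc t) λ λs _ _ → 𝟙-no (multiplicity (suc t) (suc t ∷ λs) ℕ.≟ 0)
              λ eq → contradiction (trans (sym (count-accept (ℕ._≟ suc t) λs refl)) eq) λ ())) ⟩
    H t ⊕ x^ suc t ⊗ 𝟘
      ≈⟨ solve 2 (λ h x → h :+ x :* con 0ℤ := con 1ℤ :* h) ≈-refl (H t) (x^ suc t) ⟩
    𝟏 ⊗ H t
      ≈⟨ ⊗-congʳ (x^-≡ (ℕ.*-zeroʳ t)) ⟨
    x^ (suc t ℕ.* 0) ⊗ H t ∎
    where
    f : List ℕ → ℤ
    f λs = 𝟙 (multiplicity (suc t) λs ℕ.≟ 0)
  T-multiplicity t (suc m) = begin
    T (suc t) f
      ≈⟨ T-peel-≈ t f ⟩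
    T t f ⊕ x^ suc t ⊗ T (suc t) (f ∘ (suc t ∷_))
      ≈⟨ ⊕-cong (T-𝟘 t λ λs _ ≤t → 𝟙-no (multiplicity (suc t) λs ℕ.≟ suc m) λ eq →
             contradiction (trans (sym eq) (count-none (ℕ._≟ suc t) (All.map (λ { p≤t refl → ℕ.1+n≰n p≤t }) ≤t))) λ ())
           (⊗-congˡ (T-cong-≈ (suc t) λ λs _ _ → trans (cong (λ c → 𝟙 (c ℕ.≟ suc m)) (count-accept (ℕ._≟ suc t) λs refl))
              (𝟙-cong (suc (multiplicity (suc t) λs) ℕ.≟ suc m) (multiplicity (suc t) λs ℕ.≟ m) ℕ.suc-injective (cong suc)))) ⟩
    𝟘 ⊕ x^ suc t ⊗ T (suc t) (λ λs → 𝟙 (multiplicity (suc t) λs ℕ.≟ m))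
      ≈⟨ ≈-trans (⊕-identityˡ-≈ _) (⊗-congˡ (T-multiplicity t m)) ⟩
    x^ suc t ⊗ (x^ (suc t ℕ.* m) ⊗ H t)
      ≈⟨ ≈-trans (≈-sym (⊗-assoc-≈ _ _ _)) (⊗-congʳ (≈-trans (≈-sym (x^-+-≈ (suc t) (suc t ℕ.* m))) (x^-≡ (sym (ℕ.*-suc (suc t) m))))) ⟩
    x^ (suc t ℕ.* suc m) ⊗ H t ∎
    where
    f : List ℕ → ℤ
    f λs = 𝟙 (multiplicity (suc t) λs ℕ.≟ suc m)

  u₀≈ : (λ n → + u 0 (+ n)) ≈ Uˢ 0
  u₀≈ = mk λ {n} n≤N → trans (count≡∑ (compositions n)) (∑-unimodals (λ _ → 1ℤ) (λ _ _ → 1ℤ) (λ _ _ _ _ _ → refl) n≤N)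
    where
    count≡∑ : ∀ xs → + count unimodal? xs ≡ ∑ (λ _ → 1ℤ) (filter unimodal? xs)
    count≡∑ xs = trans (count-∑ unimodal? xs) (trans (∑-cong xs λ {x} _ → sym (ℤ.*-identityʳ (𝟙 (unimodal? x))))
      (sym (∑-filter unimodal? (λ _ → 1ℤ) xs)))

  -- The first maximal part and the m further ones weigh (t+1)(m+1) = (m+1) + t (m+1); the first
  -- summand is the shift in `u (suc m)`.
  peak-summand : ∀ m t → x^ suc t ⊗ (H t ⊗ T (suc t) (λ λs → 𝟙 (multiplicity (suc t) λs ℕ.≟ m)))
                      ≈ x^ suc m ⊗ (x^ (t ℕ.* suc m) ⊗ (H t ⊗ H t))
  peak-summand m t = begin
    x^ suc t ⊗ (H t ⊗ T (suc t) (λ λs → 𝟙 (multiplicity (suc t) λs ℕ.≟ m)))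
      ≈⟨ ⊗-congˡ (⊗-congˡ (T-multiplicity t m)) ⟩
    x^ suc t ⊗ (H t ⊗ (x^ (suc t ℕ.* m) ⊗ H t))
      ≈⟨ solve 3 (λ x y h → x :* (h :* (y :* h)) := (x :* y) :* (h :* h)) ≈-refl (x^ suc t) (x^ (suc t ℕ.* m)) (H t) ⟩
    (x^ suc t ⊗ x^ (suc t ℕ.* m)) ⊗ (H t ⊗ H t)
      ≈⟨ ⊗-congʳ (≈-trans (≈-sym (x^-+-≈ (suc t) (suc t ℕ.* m))) (≈-trans (x^-≡ (exponent t m)) (x^-+-≈ (suc m) (t ℕ.* suc m)))) ⟩
    (x^ suc m ⊗ x^ (t ℕ.* suc m)) ⊗ (H t ⊗ H t)
      ≈⟨ ⊗-assoc-≈ _ _ _ ⟩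
    x^ suc m ⊗ (x^ (t ℕ.* suc m) ⊗ (H t ⊗ H t)) ∎
    where
    exponent : ∀ t m → suc t ℕ.+ suc t ℕ.* m ≡ suc m ℕ.+ t ℕ.* suc m
    exponent = ℕ-Ring.solve-∀

-- The compositions counted have sum n + m + 1, so the series must be known to that order before
-- x^(m+1) is divided out.
u-suc : ∀ m {n D} → n ℕ.+ suc m ≤ D →
        + u (suc m) (+ n) ≡ Σ< (suc D) (λ t → x^ (t ℕ.* suc m) ⊗ (H t ⊗ H t)) n
u-suc m {n} {D} n≤D = begin
  + u (suc m) (+ n)
    ≡⟨ count-∑ _ (compositions L) ⟩
  ∑ (λ λs → 𝟙 (unimodal? λs ×-dec multiplicity (maxPart λs) λs ℕ.≟ suc m)) (compositions L)
    ≡⟨ ∑-cong (compositions L) (λ {λs} _ → 𝟙-× (unimodal? λs) (multiplicity (maxPart λs) λs ℕ.≟ suc m)) ⟩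
  ∑ (λ λs → 𝟙 (unimodal? λs) * f λs) (compositions L)
    ≡⟨ ∑-filter unimodal? f (compositions L) ⟨
  ∑ f (unimodals L)
    ≡⟨ ∑-unimodals f (λ t bs → 𝟙 (multiplicity (suc t) bs ℕ.≟ m)) f-glue n≤D ⟩
  Σ< (suc D) (λ t → x^ suc t ⊗ (H t ⊗ T (suc t) (λ bs → 𝟙 (multiplicity (suc t) bs ℕ.≟ m)))) L
    ≡⟨ at (≈-trans (Σ<-cong (suc D) λ t _ → peak-summand D m t) (Σ<-⊗ˡ (suc D) (x^ suc m) _)) n≤D ⟩
  (x^ suc m ⊗ Σ< (suc D) (λ t → x^ (t ℕ.* suc m) ⊗ (H t ⊗ H t))) L
    ≡⟨ cong (x^ suc m ⊗ Σ< (suc D) _) (ℕ.+-comm n (suc m)) ⟩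
  (x^ suc m ⊗ Σ< (suc D) (λ t → x^ (t ℕ.* suc m) ⊗ (H t ⊗ H t))) (suc m ℕ.+ n)
    ≡⟨ x^-⊗-+ (suc m) _ n ⟩
  Σ< (suc D) (λ t → x^ (t ℕ.* suc m) ⊗ (H t ⊗ H t)) n ∎
  where
  open ≡-Reasoning
  open QSeries D using (at; ≈-trans; Σ<-cong; Σ<-⊗ˡ)
  L : ℕ
  L = n ℕ.+ suc m

  f : List ℕ → ℤ
  f λs = 𝟙 (multiplicity (maxPart λs) λs ℕ.≟ suc m)

  f-glue : ∀ t as bs → All (_≤ t) as → All (_≤ suc t) bs → f (glue t (as , bs)) ≡ 𝟙 (multiplicity (suc t) bs ℕ.≟ m)
  f-glue t as bs a≤ b≤ rewrite maxPart-glue {t} {as} {bs} a≤ b≤ = trans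
    (cong (λ c → 𝟙 (c ℕ.≟ suc m)) (skip as a≤))
    (𝟙-cong (suc (multiplicity (suc t) bs) ℕ.≟ suc m) (multiplicity (suc t) bs ℕ.≟ m) ℕ.suc-injective (cong suc))
    where
    skip : ∀ as → All (_≤ t) as → multiplicity (suc t) (glue t (as , bs)) ≡ suc (multiplicity (suc t) bs)
    skip []       []        = count-accept (ℕ._≟ suc t) bs refl
    skip (a ∷ as) (≤t ∷ a≤) = trans (count-reject (ℕ._≟ suc t) {a} (glue t (as , bs)) λ { refl → ℕ.1+n≰n ≤t }) (skip as a≤)

module USeries (N : ℕ) where
  open Identities N

  -- `u-suc` is used with D = N + m + 1; the summands with t > N that this adds have degree t (m+1)
  -- > N.
  u≈ : ∀ m → (λ n → + u (suc m) (+ n)) ≈ Uˢ (suc m)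
  u≈ m = ≈-trans (mk λ n≤N → u-suc m (ℕ.+-monoˡ-≤ (suc m) n≤N))
    (Σ<-drop (suc N) (suc m) _ λ t N<t → x^-⊗-≈𝟘 _ (ℕ.≤-trans N<t (ℕ.m≤m*n t (suc m))))

-- The truncated pentagonal sum

∑-applyUpTo : ∀ (f : ℕ → ℤ) g n → ∑ f (applyUpTo g n) ≡ ∑< n (f ∘ g)
∑-applyUpTo f g zero    = refl
∑-applyUpTo f g (suc n) = +-congˡ (f (g 0)) (∑-applyUpTo f (g ∘ suc) n)

⊗-∑< : ∀ f g n → (f ⊗ g) n ≡ ∑< (suc n) (λ j → f j * g (n ∸ j))
⊗-∑< f g zero    = sym (ℤ.+-identityʳ _)
⊗-∑< f g (suc n) = +-congˡ (f 0 * g (suc n)) (⊗-∑< (f ∘ suc) g n)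

∑[⋯]-∑< : ∀ k h → ∑[ 1ℤ - + k ⋯ + k ] h ≡ ∑< (k ℕ.+ k) (λ i → h (1ℤ - + k + + i))
∑[⋯]-∑< k h = trans
  (cong (λ n → ∑ (λ i → h (1ℤ - + k + + i)) (upTo n)) length≡)
  (∑-applyUpTo (λ i → h (1ℤ - + k + + i)) id (k ℕ.+ k))
  where
  difference : ∀ K → K - (1ℤ - K) + 1ℤ ≡ K + K
  difference = ℤ-Ring.solve-∀

  length≡ : ∣ (+ k - (1ℤ - + k) + 1ℤ) ℤ.⊔ 0ℤ ∣ ≡ k ℕ.+ k
  length≡ = trans (cong (λ z → ∣ z ℤ.⊔ 0ℤ ∣) (difference (+ k))) (ℕ.⊔-identityʳ (k ℕ.+ k))

-- The range gains -k on the left and k + 1 on the right, the two indices whose terms `Θ (suc k)`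
-- adds.
∑[⋯]-suc : ∀ k h → ∑[ 1ℤ - + suc k ⋯ + suc k ] h ≡ h (- + k) + (∑[ 1ℤ - + k ⋯ + k ] h + h (+ suc k))
∑[⋯]-suc k h = begin
  ∑[ 1ℤ - + suc k ⋯ + suc k ] h
    ≡⟨ ∑[⋯]-∑< (suc k) h ⟩
  h (1ℤ - + suc k + + 0) + ∑< (k ℕ.+ suc k) (λ i → h (1ℤ - + suc k + + suc i))
    ≡⟨ cong₂ _+_ (cong h (first (+ k))) (trans
         (cong (λ n → ∑< n (λ i → h (1ℤ - + suc k + + suc i))) (ℕ.+-suc k k))
         (trans (∑<-cong (suc (k ℕ.+ k)) λ i _ → cong h (shift (+ k) (+ i))) (∑<-last (k ℕ.+ k) (λ i → h (1ℤ - + k + + i))))) ⟩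
  h (- + k) + (∑< (k ℕ.+ k) (λ i → h (1ℤ - + k + + i)) + h (1ℤ - + k + + (k ℕ.+ k)))
    ≡⟨ +-congˡ (h (- + k)) (cong₂ _+_ (sym (∑[⋯]-∑< k h)) (cong h (last (+ k)))) ⟩
  h (- + k) + (∑[ 1ℤ - + k ⋯ + k ] h + h (+ suc k)) ∎
  where
  open ≡-Reasoning
  first : ∀ K → 1ℤ - (1ℤ + K) + 0ℤ ≡ - K
  first = ℤ-Ring.solve-∀

  shift : ∀ K I → 1ℤ - (1ℤ + K) + (1ℤ + I) ≡ 1ℤ - K + I
  shift = ℤ-Ring.solve-∀

  last : ∀ K → 1ℤ - K + (K + K) ≡ 1ℤ + K
  last = ℤ-Ring.solve-∀

pentagonal≡ : ∀ {j w} → j * (+ 3 * j - 1ℤ) ≡ + (w ℕ.* 2) → pentagonal j ≡ + w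
pentagonal≡ {j} {w} eq = begin
  j * (+ 3 * j - 1ℤ) ℤ./ + 2   ≡⟨ cong (ℤ._/ + 2) eq ⟩
  + (w ℕ.* 2) ℤ./ + 2          ≡⟨ ℤ.div-pos-is-/ℕ (+ (w ℕ.* 2)) 2 ⟩
  + (w ℕ.* 2 ℕ./ 2)            ≡⟨ cong +_ (ℕ.m*n/n≡m w 2) ⟩
  + w                          ∎
  where open ≡-Reasoning

tri-*2 : ∀ k → tri k ℕ.* 2 ≡ k ℕ.* suc k
tri-*2 zero    = refl
tri-*2 (suc k) = begin
  (tri k ℕ.+ suc k) ℕ.* 2         ≡⟨ ℕ.*-distribʳ-+ 2 (tri k) (suc k) ⟩
  tri k ℕ.* 2 ℕ.+ suc k ℕ.* 2     ≡⟨ cong (ℕ._+ suc k ℕ.* 2) (tri-*2 k) ⟩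
  k ℕ.* suc k ℕ.+ suc k ℕ.* 2     ≡⟨ rearrange k ⟩
  suc k ℕ.* suc (suc k)           ∎
  where
  open ≡-Reasoning
  rearrange : ∀ k → k ℕ.* suc k ℕ.+ suc k ℕ.* 2 ≡ suc k ℕ.* suc (suc k)
  rearrange = ℕ-Ring.solve-∀

pentagonal-neg : ∀ k → pentagonal (- + k) ≡ + (k ℕ.* k ℕ.+ tri k)
pentagonal-neg k = pentagonal≡ { - + k} (begin
  - + k * (+ 3 * - + k - 1ℤ)             ≡⟨ negate (+ k) ⟩
  + k * (+ 3 * + k + 1ℤ)                 ≡⟨ cong (λ z → + k * (z + 1ℤ)) (ℤ.pos-* 3 k) ⟨
  + k * + (3 ℕ.* k ℕ.+ 1)                ≡⟨ ℤ.pos-* k (3 ℕ.* k ℕ.+ 1) ⟨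
  + (k ℕ.* (3 ℕ.* k ℕ.+ 1))              ≡⟨ cong +_ (trans (double k) (trans (cong (k ℕ.* k ℕ.* 2 ℕ.+_) (sym (tri-*2 k))) (sym (ℕ.*-distribʳ-+ 2 (k ℕ.* k) (tri k))))) ⟩
  + ((k ℕ.* k ℕ.+ tri k) ℕ.* 2)          ∎)
  where
  open ≡-Reasoning
  negate : ∀ K → - K * (+ 3 * - K - 1ℤ) ≡ K * (+ 3 * K + 1ℤ)
  negate = ℤ-Ring.solve-∀

  double : ∀ k → k ℕ.* (3 ℕ.* k ℕ.+ 1) ≡ k ℕ.* k ℕ.* 2 ℕ.+ k ℕ.* suc k
  double = ℕ-Ring.solve-∀

pentagonal-suc : ∀ k → pentagonal (+ suc k) ≡ + (k ℕ.* k ℕ.+ tri k ℕ.+ (k ℕ.+ suc k))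
pentagonal-suc k = pentagonal≡ {+ suc k} (begin
  + suc k * (+ 3 * + suc k - 1ℤ)         ≡⟨ expand (+ k) ⟩
  + suc k * (+ 3 * + k + + 2)            ≡⟨ cong (λ z → + suc k * (z + + 2)) (ℤ.pos-* 3 k) ⟨
  + suc k * + (3 ℕ.* k ℕ.+ 2)            ≡⟨ ℤ.pos-* (suc k) (3 ℕ.* k ℕ.+ 2) ⟨
  + (suc k ℕ.* (3 ℕ.* k ℕ.+ 2))          ≡⟨ cong +_ (trans (double k) (trans (cong ((k ℕ.* k ℕ.+ (k ℕ.+ suc k)) ℕ.* 2 ℕ.+_) (sym (tri-*2 k))) (regroup (k ℕ.* k) (k ℕ.+ suc k) (tri k)))) ⟩
  + ((k ℕ.* k ℕ.+ tri k ℕ.+ (k ℕ.+ suc k)) ℕ.* 2) ∎)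
  where
  open ≡-Reasoning
  expand : ∀ K → (1ℤ + K) * (+ 3 * (1ℤ + K) - 1ℤ) ≡ (1ℤ + K) * (+ 3 * K + + 2)
  expand = ℤ-Ring.solve-∀

  double : ∀ k → suc k ℕ.* (3 ℕ.* k ℕ.+ 2) ≡ (k ℕ.* k ℕ.+ (k ℕ.+ suc k)) ℕ.* 2 ℕ.+ k ℕ.* suc k
  double = ℕ-Ring.solve-∀

  regroup : ∀ a b t → (a ℕ.+ b) ℕ.* 2 ℕ.+ t ℕ.* 2 ≡ (a ℕ.+ t ℕ.+ b) ℕ.* 2
  regroup = ℕ-Ring.solve-∀

uˢ : ℕ → Series
uˢ m n = + u m (+ n)

-- The convention that `u` is 0 at negative arguments matches the vanishing coefficients below x^e.
x^-⊗-u : ∀ m e n → (x^ e ⊗ uˢ m) n ≡ + u m (+ n - + e)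
x^-⊗-u m e n with ℕ.≤-<-connex e n
... | inj₂ n<e = begin
  (x^ e ⊗ uˢ m) n        ≡⟨ x^-⊗-< e (uˢ m) n n<e ⟩
  0ℤ                     ≡⟨ negative (e ∸ n) (ℕ.m<n⇒0<n∸m n<e) ⟨
  + u m (- + (e ∸ n))    ≡⟨ cong (λ z → + u m z) (trans (ℤ.[+m]-[+n]≡m⊖n n e) (ℤ.⊖-< n<e)) ⟨
  + u m (+ n - + e)      ∎
  where
  open ≡-Reasoning
  negative : ∀ d → 0 ℕ.< d → + u m (- + d) ≡ 0ℤ
  negative (suc d) _ = refl
... | inj₁ e≤n with ℕ.m≤n⇒∃[o]m+o≡n e≤n
...   | i , refl = trans (x^-⊗-+ e (uˢ m) i) (cong (λ z → + u m z) (sym (cancel (+ e) (+ i))))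
  where
  cancel : ∀ E I → E + I - E ≡ I
  cancel = ℤ-Ring.solve-∀

Θ⊗u : ∀ m k n → (Θ k ⊗ uˢ m) n ≡ ∑[ 1ℤ - + k ⋯ + k ] (λ j → ([-1]^ j) * + u m (+ n - pentagonal j))
Θ⊗u m zero    n = trans (⊗-cong-≤ n (λ i _ → 𝟘-at i) (λ _ _ → refl)) (⊗-zeroˡ (uˢ m) n)
Θ⊗u m (suc k) n = begin
  (Θ (suc k) ⊗ uˢ m) n
    ≡⟨ at expand ℕ.≤-refl ⟩
  (sgn k ⊗ (x^ w ⊗ uˢ m) ⊕ (Θ k ⊗ uˢ m ⊕ sgn (suc k) ⊗ (x^ (w ℕ.+ (k ℕ.+ suc k)) ⊗ uˢ m))) n
    ≡⟨ trans (⊕-at _ _ n) (+-congˡ ((sgn k ⊗ (x^ w ⊗ uˢ m)) n) (⊕-at _ _ n)) ⟩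
  (sgn k ⊗ (x^ w ⊗ uˢ m)) n + ((Θ k ⊗ uˢ m) n + (sgn (suc k) ⊗ (x^ (w ℕ.+ (k ℕ.+ suc k)) ⊗ uˢ m)) n)
    ≡⟨ cong₂ _+_ (term (- + k) (sym (ℤ.∣-i∣≡∣i∣ (+ k))) (pentagonal-neg k))
         (cong₂ _+_ (Θ⊗u m k n) (term (+ suc k) {suc k} refl (pentagonal-suc k))) ⟩
  h (- + k) + (∑[ 1ℤ - + k ⋯ + k ] h + h (+ suc k))
    ≡⟨ ∑[⋯]-suc k h ⟨
  ∑[ 1ℤ - + suc k ⋯ + suc k ] h ∎
  where
  open ≡-Reasoning
  open Identities n using (_≈_; at; ≈-refl; ≈-trans; ⊕-congˡ; ⊗-congʳ; ⊗-cong; sgn-suc; x^-+-≈; ≈-sym; solve; _:=_; _:+_; _:-_; _:*_; :-_; con)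

  w : ℕ
  w = k ℕ.* k ℕ.+ tri k

  h : ℤ → ℤ
  h j = ([-1]^ j) * + u m (+ n - pentagonal j)

  expand : Θ (suc k) ⊗ uˢ m ≈ sgn k ⊗ (x^ w ⊗ uˢ m) ⊕ (Θ k ⊗ uˢ m ⊕ sgn (suc k) ⊗ (x^ (w ℕ.+ (k ℕ.+ suc k)) ⊗ uˢ m))
  expand = ≈-trans
    (solve 5 (λ t s x y u → (t :+ s :* (x :* (con 1ℤ :- y))) :* u := s :* (x :* u) :+ (t :* u :+ (:- s) :* ((x :* y) :* u))) ≈-refl
      (Θ k) (sgn k) (x^ w) (x^ (k ℕ.+ suc k)) (uˢ m))
    (⊕-congˡ (⊕-congˡ (⊗-cong (≈-sym (sgn-suc k)) (⊗-congʳ (≈-sym (x^-+-≈ w (k ℕ.+ suc k)))))))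

  term : ∀ j {s e} → s ≡ ∣ j ∣ → pentagonal j ≡ + e → (const (-1ℤ ℤ.^ s) ⊗ (x^ e ⊗ uˢ m)) n ≡ h j
  term j {s} {e} s≡ e≡ = trans (const-⊗ (-1ℤ ℤ.^ s) (x^ e ⊗ uˢ m) n)
    (cong₂ _*_ (cong (-1ℤ ℤ.^_) s≡) (trans (x^-⊗-u m e n) (cong (λ z → + u m (+ n - z)) (sym e≡))))

-- Comparison of coefficients

module _ (N : ℕ) where
  open Identities N
  open MSeries N using (M≈)
  open CSeries N using (C₀≈; C₁≈; C₂≈)
  open USeries N using (u≈)

  u≈P⊗C : ∀ m → uˢ (toℕ m) ≈ P ⊗ C m
  u≈P⊗C 0F = ≈-trans (u₀≈ N) (≈-trans U₀≈P⊗C₀ (⊗-congˡ (≈-sym C₀≈)))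
  u≈P⊗C 1F = ≈-trans (u≈ 0) (≈-trans U₁≈P⊗C₁ (⊗-congˡ (≈-sym C₁≈)))
  u≈P⊗C 2F = ≈-trans (u≈ 1) (≈-trans U₂≈P⊗C₂ (⊗-congˡ (≈-sym C₂≈)))

  truncated-identity : ∀ j m → let k = suc j in
    sgn k ⊗ (C m ⊕ ⊝ (Θ k ⊗ uˢ (toℕ m))) ≈ C m ⊗ (λ n → + M k n)
  truncated-identity j m = begin
    sgn k ⊗ (C m ⊕ ⊝ (Θ k ⊗ uˢ (toℕ m)))
      ≈⟨ ⊗-congˡ (⊕-congˡ (⊝-cong (⊗-congˡ (u≈P⊗C m)))) ⟩
    sgn k ⊗ (C m ⊕ ⊝ (Θ k ⊗ (P ⊗ C m)))
      ≈⟨ solve 4 (λ s c t p → s :* (c :- t :* (p :* c)) := s :* (c :- (p :* t) :* c)) ≈-refl (sgn k) (C m) (Θ k) P ⟩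
    sgn k ⊗ (C m ⊕ ⊝ ((P ⊗ Θ k) ⊗ C m))
      ≈⟨ ⊗-cong (sgn-suc j) (⊕-congˡ (⊝-cong (⊗-congʳ (P⊗Θ j)))) ⟩
    ⊝ sgn j ⊗ (C m ⊕ ⊝ ((𝟏 ⊕ sgn j ⊗ Mˢ j) ⊗ C m))
      ≈⟨ solve 3 (λ s c m → (:- s) :* (c :- (con 1ℤ :+ s :* m) :* c) := (s :* s) :* (c :* m)) ≈-refl (sgn j) (C m) (Mˢ j) ⟩
    (sgn j ⊗ sgn j) ⊗ (C m ⊗ Mˢ j)
      ≈⟨ ≈-trans (⊗-congʳ (sgn⊗sgn j)) (⊗-identityˡ-≈ _) ⟩
    C m ⊗ Mˢ j
      ≈⟨ ⊗-congˡ (M≈ j) ⟨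
    C m ⊗ (λ n → + M k n) ∎
    where
    k : ℕ
    k = suc j

theorem1p2 : (k n : ℕ) → 1 ≤ k → 1 ≤ n → (m : Fin 3) →
    ([-1]^ (+ k)) * (C m n - ∑[ 1ℤ - + k ⋯ + k ] (λ j → ([-1]^ j) * + u (toℕ m) (+ n - pentagonal j)))
    ≡ ∑[0⋯ n ] (λ j → C m j * + M k (n ∸ j))
theorem1p2 k@(suc j) n _ _ m = begin
  ([-1]^ (+ k)) * (C m n - ∑[ 1ℤ - + k ⋯ + k ] (λ j → ([-1]^ j) * + u (toℕ m) (+ n - pentagonal j)))
    ≡⟨ cong (λ z → ([-1]^ (+ k)) * (C m n - z)) (Θ⊗u (toℕ m) k n) ⟨
  ([-1]^ (+ k)) * (C m n - (Θ k ⊗ uˢ (toℕ m)) n)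
    ≡⟨ cong (([-1]^ (+ k)) *_) (trans (⊕-at (C m) _ n) (+-congˡ (C m n) (⊝-at _ n))) ⟨
  ([-1]^ (+ k)) * (C m ⊕ ⊝ (Θ k ⊗ uˢ (toℕ m))) n
    ≡⟨ const-⊗ ([-1]^ (+ k)) _ n ⟨
  (sgn k ⊗ (C m ⊕ ⊝ (Θ k ⊗ uˢ (toℕ m)))) n
    -- The order of truncation is taken to be `n` itself.
    ≡⟨ Identities.at (truncated-identity n j m) ℕ.≤-refl ⟩
  (C m ⊗ (λ i → + M k i)) n
    ≡⟨ ⊗-∑< (C m) (λ i → + M k i) n ⟩
  ∑< (suc n) (λ j → C m j * + M k (n ∸ j))
    ≡⟨ ∑-applyUpTo (λ j → C m j * + M k (n ∸ j)) id (suc n) ⟨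
  ∑[0⋯ n ] (λ j → C m j * + M k (n ∸ j)) ∎
  where open ≡-Reasoning
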